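{- Let $\mathcal{M}$ and $\mathcal{N}$ be countable nonstandard models of $\mathrm{I}\Sigma_1$, let $c\in M$ and $a,b\in N$, and let $I$ be a proper cut shared by $\mathcal{M}$ and $\mathcal{N}$ that is closed under exponentiation. The following are equivalent: (1) There is a proper initial embedding $j:\mathcal{M}\to\mathcal{N}$ such that $j(c)=a$, $j(M)<b$ (i.e. every element of $j(M)$ is below $b$), and $j(i)=i$ for all $i\in I$. (2) $\mathrm{SSy}_I(\mathcal{M})=\mathrm{SSy}_I(\mathcal{N})$, and for all $i\in I$ and all $\Delta_0$-formulae $\delta(x,y,z)$, if $\mathcal{M}\models\exists z\,\delta(i,c,z)$ then $\mathcal{N}\models\exists z<b\,\delta(i,a,z)$.
   Context: $\mathrm{I}\Sigma_1$ is Peano Arithmetic with induction restricted to $\Sigma_1$-formulae. A cut is an initial segment without largest element; $I$ is shared by $\mathcal{M}$ and $\mathcal{N}$ if it is a proper cut of both and the two models induce the same structure on $I$. $I$ is closed under exponentiation if $2^x$ exists and lies in $I$ for every $x\in I$. An embedding $j:\mathcal{M}\to\mathcal{N}$ is an isomorphism onto a submodel of $\mathcal{N}$; it is initial if $j(M)$ is an initial segment of $\mathcal{N}$, and proper if $j(M)\ne N$. Ackermann membership: $xEy$ iff the $x$-th bit of the binary expansion of $y$ is $1$; for $c\in M$, $(c_E)^{\mathcal{M}}:=\{x\in M:\mathcal{M}\models xEc\}$. $\mathrm{SSy}_I(\mathcal{M}):=\{(c_E)^{\mathcal{M}}\cap I: c\in M\}$. -}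

module Defs where

open import Data.Nat using (ℕ; zero; suc)
open import Data.Fin using (Fin)
open import Data.Vec using (Vec; _∷_; []; lookup)
open import Data.Product using (Σ; _×_; _,_)
open import Data.Sum using (_⊎_)
open import Data.Empty using (⊥)
open import Relation.Nullary using (¬_)
open import Relation.Binary.PropositionalEquality using (_≡_; _≢_)

-- Syntax of first-order arithmetic in the language {0, S, +, ·, <}
-- (de Bruijn variables: var 0 is the most recently bound / first entry
-- of the environment).

data Term (n : ℕ) : Set where
  var  : Fin n → Term n
  zer  : Term n
  sc   : Term n → Term n
  _+ᵗ_ : Term n → Term n → Term n
  _*ᵗ_ : Term n → Term n → Term n

data Formula (n : ℕ) : Set where
  _≈ᶠ_ : Term n → Term n → Formula n
  _<ᶠ_ : Term n → Term n → Formula n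
  ⊥ᶠ   : Formula n
  _∧ᶠ_ : Formula n → Formula n → Formula n
  _∨ᶠ_ : Formula n → Formula n → Formula n
  _⇒ᶠ_ : Formula n → Formula n → Formula n
  ∀ᶠ   : Formula (suc n) → Formula n
  ∃ᶠ   : Formula (suc n) → Formula n
  ∀<ᶠ  : Term n → Formula (suc n) → Formula n
  ∃<ᶠ  : Term n → Formula (suc n) → Formula n

data IsΔ₀ {n : ℕ} : Formula n → Set where
  eq  : ∀ t u → IsΔ₀ (t ≈ᶠ u)
  lt  : ∀ t u → IsΔ₀ (t <ᶠ u)
  bot : IsΔ₀ ⊥ᶠ
  and : ∀ {φ ψ} → IsΔ₀ φ → IsΔ₀ ψ → IsΔ₀ (φ ∧ᶠ ψ)
  or  : ∀ {φ ψ} → IsΔ₀ φ → IsΔ₀ ψ → IsΔ₀ (φ ∨ᶠ ψ)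
  imp : ∀ {φ ψ} → IsΔ₀ φ → IsΔ₀ ψ → IsΔ₀ (φ ⇒ᶠ ψ)
  ball : ∀ t {φ} → IsΔ₀ φ → IsΔ₀ (∀<ᶠ t φ)
  bex  : ∀ t {φ} → IsΔ₀ φ → IsΔ₀ (∃<ᶠ t φ)

data IsΣ₁ {n : ℕ} : Formula n → Set where
  δ₀ : ∀ {φ} → IsΔ₀ φ → IsΣ₁ φ
  ex : ∀ {φ} → IsΣ₁ {suc n} φ → IsΣ₁ (∃ᶠ φ)

record Structure : Set₁ where
  field
    Carrier : Set
    𝟎       : Carrier
    𝐒       : Carrier → Carrier
    _⊕_     : Carrier → Carrier → Carrier
    _⊗_     : Carrier → Carrier → Carrier
    _≺_     : Carrier → Carrier → Set

open Structure public using (Carrier)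
module St = Structure

module _ (M : Structure) where
  open Structure M renaming (Carrier to A)

  ⟦_⟧ᵗ : ∀ {n} → Term n → Vec A n → A
  ⟦ var i ⟧ᵗ ρ = lookup ρ i
  ⟦ zer ⟧ᵗ ρ = 𝟎
  ⟦ sc t ⟧ᵗ ρ = 𝐒 (⟦ t ⟧ᵗ ρ)
  ⟦ t +ᵗ u ⟧ᵗ ρ = ⟦ t ⟧ᵗ ρ ⊕ ⟦ u ⟧ᵗ ρ
  ⟦ t *ᵗ u ⟧ᵗ ρ = ⟦ t ⟧ᵗ ρ ⊗ ⟦ u ⟧ᵗ ρ

  Sat : ∀ {n} → Formula n → Vec A n → Set
  Sat (t ≈ᶠ u) ρ = ⟦ t ⟧ᵗ ρ ≡ ⟦ u ⟧ᵗ ρ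
  Sat (t <ᶠ u) ρ = ⟦ t ⟧ᵗ ρ ≺ ⟦ u ⟧ᵗ ρ
  Sat ⊥ᶠ ρ = ⊥
  Sat (φ ∧ᶠ ψ) ρ = Sat φ ρ × Sat ψ ρ
  Sat (φ ∨ᶠ ψ) ρ = Sat φ ρ ⊎ Sat ψ ρ
  Sat (φ ⇒ᶠ ψ) ρ = Sat φ ρ → Sat ψ ρ
  Sat (∀ᶠ φ) ρ = (x : A) → Sat φ (x ∷ ρ)
  Sat (∃ᶠ φ) ρ = Σ A λ x → Sat φ (x ∷ ρ)
  Sat (∀<ᶠ t φ) ρ = (x : A) → x ≺ ⟦ t ⟧ᵗ ρ → Sat φ (x ∷ ρ)
  Sat (∃<ᶠ t φ) ρ = Σ A λ x → x ≺ ⟦ t ⟧ᵗ ρ × Sat φ (x ∷ ρ)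

  record IsModelIΣ₁ : Set where
    field
      S≢0     : ∀ x → 𝐒 x ≢ 𝟎
      S-inj   : ∀ x y → 𝐒 x ≡ 𝐒 y → x ≡ y
      +-zero  : ∀ x → x ⊕ 𝟎 ≡ x
      +-suc   : ∀ x y → x ⊕ 𝐒 y ≡ 𝐒 (x ⊕ y)
      *-zero  : ∀ x → x ⊗ 𝟎 ≡ 𝟎
      *-suc   : ∀ x y → x ⊗ 𝐒 y ≡ (x ⊗ y) ⊕ x
      <-def₁  : ∀ x y → x ≺ y → Σ A λ z → x ⊕ 𝐒 z ≡ y
      <-def₂  : ∀ x y z → x ⊕ 𝐒 z ≡ y → x ≺ y
      Σ₁-ind  : ∀ {n} (φ : Formula (suc n)) → IsΣ₁ φ → (ρ : Vec A n) →
                Sat φ (𝟎 ∷ ρ) →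
                ((x : A) → Sat φ (x ∷ ρ) → Sat φ (𝐒 x ∷ ρ)) →
                (x : A) → Sat φ (x ∷ ρ)

  numeral : ℕ → A
  numeral zero = 𝟎
  numeral (suc n) = 𝐒 (numeral n)

  Countable : Set
  Countable = Σ (ℕ → A) λ f → (x : A) → Σ ℕ λ k → f k ≡ x

  Nonstandard : Set
  Nonstandard = Σ A λ c → (k : ℕ) → numeral k ≺ c

  -- Exponentiation 2^x, defined as usual in IΣ₁ via Gödel's β-function:
  -- β(a,b,i) = a mod (1 + (i+1)·b).

  two : A
  two = 𝐒 (𝐒 𝟎)

  Beta : A → A → A → A → Set
  Beta a b i r = Σ A λ q → (a ≡ (q ⊗ 𝐒 (𝐒 i ⊗ b)) ⊕ r) × (r ≺ 𝐒 (𝐒 i ⊗ b))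

  Exp : A → A → Set
  Exp x y = Σ A λ a → Σ A λ b →
              Beta a b 𝟎 (𝐒 𝟎) ×
              ((i : A) → i ≺ x → (v : A) → Beta a b i v → Beta a b (𝐒 i) (two ⊗ v)) ×
              Beta a b x y

  -- Ackermann membership: x E y  iff the x-th binary digit of y is 1,
  -- i.e.  2^x ≤ (y mod 2^(x+1)).
  AckE : A → A → Set
  AckE x y = Σ A λ p → Exp x p × Σ A λ q → Σ A λ r →
               (y ≡ (q ⊗ (two ⊗ p)) ⊕ r) × (r ≺ (two ⊗ p)) × ¬ (r ≺ p)

-- A cut shared by M and N.  The common cut is given as an abstract set I
-- with inclusions into both models, whose images are proper cuts
-- (nonempty initial segments with no largest element) and on which the
-- two models induce the same structure.

record SharedCut (M N : Structure) : Set₁ where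
  field
    I   : Set
    ιM  : I → Carrier M
    ιN  : I → Carrier N
    ιM-inj : ∀ x y → ιM x ≡ ιM y → x ≡ y
    ιN-inj : ∀ x y → ιN x ≡ ιN y → x ≡ y
    nonempty  : I
    M-initial : (x : I) (m : Carrier M) → St._≺_ M m (ιM x) → Σ I λ y → ιM y ≡ m
    M-nomax   : (x : I) → Σ I λ y → St._≺_ M (ιM x) (ιM y)
    M-proper  : Σ (Carrier M) λ m → (x : I) → ιM x ≢ m
    N-initial : (x : I) (m : Carrier N) → St._≺_ N m (ιN x) → Σ I λ y → ιN y ≡ m
    N-nomax   : (x : I) → Σ I λ y → St._≺_ N (ιN x) (ιN y)
    N-proper  : Σ (Carrier N) λ m → (x : I) → ιN x ≢ m
    same-0 : (x : I) → (ιM x ≡ St.𝟎 M) → (ιN x ≡ St.𝟎 N)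
    same-0' : (x : I) → (ιN x ≡ St.𝟎 N) → (ιM x ≡ St.𝟎 M)
    same-S : (x y : I) → (St.𝐒 M (ιM x) ≡ ιM y) → (St.𝐒 N (ιN x) ≡ ιN y)
    same-S' : (x y : I) → (St.𝐒 N (ιN x) ≡ ιN y) → (St.𝐒 M (ιM x) ≡ ιM y)
    same-+ : (x y z : I) → (St._⊕_ M (ιM x) (ιM y) ≡ ιM z) → (St._⊕_ N (ιN x) (ιN y) ≡ ιN z)
    same-+' : (x y z : I) → (St._⊕_ N (ιN x) (ιN y) ≡ ιN z) → (St._⊕_ M (ιM x) (ιM y) ≡ ιM z)
    same-* : (x y z : I) → (St._⊗_ M (ιM x) (ιM y) ≡ ιM z) → (St._⊗_ N (ιN x) (ιN y) ≡ ιN z)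
    same-*' : (x y z : I) → (St._⊗_ N (ιN x) (ιN y) ≡ ιN z) → (St._⊗_ M (ιM x) (ιM y) ≡ ιM z)
    same-< : (x y : I) → St._≺_ M (ιM x) (ιM y) → St._≺_ N (ιN x) (ιN y)
    same-<' : (x y : I) → St._≺_ N (ιN x) (ιN y) → St._≺_ M (ιM x) (ιM y)

open SharedCut public

ClosedUnderExp : ∀ {M N} → SharedCut M N → Set
ClosedUnderExp {M} C = (x : I C) → Σ (Carrier M) λ y → Exp M (ιM C x) y × Σ (I C) λ k → ιM C k ≡ y

SameSSy : ∀ {M N} → SharedCut M N → Set
SameSSy {M} {N} C =
  ((c : Carrier M) → Σ (Carrier N) λ d → (i : I C) →
       (AckE M (ιM C i) c → AckE N (ιN C i) d) × (AckE N (ιN C i) d → AckE M (ιM C i) c)) ×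
  ((d : Carrier N) → Σ (Carrier M) λ c → (i : I C) →
       (AckE M (ιM C i) c → AckE N (ιN C i) d) × (AckE N (ιN C i) d → AckE M (ιM C i) c))

record IsEmbedding (M N : Structure) (j : Carrier M → Carrier N) : Set where
  field
    inj    : ∀ x y → j x ≡ j y → x ≡ y
    pres-0 : j (St.𝟎 M) ≡ St.𝟎 N
    pres-S : ∀ x → j (St.𝐒 M x) ≡ St.𝐒 N (j x)
    pres-+ : ∀ x y → j (St._⊕_ M x y) ≡ St._⊕_ N (j x) (j y)
    pres-* : ∀ x y → j (St._⊗_ M x y) ≡ St._⊗_ N (j x) (j y)
    pres-< : ∀ x y → St._≺_ M x y → St._≺_ N (j x) (j y)
    refl-< : ∀ x y → St._≺_ N (j x) (j y) → St._≺_ M x y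

IsInitial : (M N : Structure) → (Carrier M → Carrier N) → Set
IsInitial M N j = (x : Carrier M) (y : Carrier N) → St._≺_ N y (j x) → Σ (Carrier M) λ z → j z ≡ y

IsProper : (M N : Structure) → (Carrier M → Carrier N) → Set
IsProper M N j = Σ (Carrier N) λ y → (x : Carrier M) → j x ≢ y

Cond1 : (M N : Structure) (C : SharedCut M N) (c : Carrier M) (a b : Carrier N) → Set
Cond1 M N C c a b =
  Σ (Carrier M → Carrier N) λ j →
    IsEmbedding M N j × IsInitial M N j × IsProper M N j ×
    (j c ≡ a) × ((x : Carrier M) → St._≺_ N (j x) b) ×
    ((i : I C) → j (ιM C i) ≡ ιN C i)

Cond2 : (M N : Structure) (C : SharedCut M N) (c : Carrier M) (a b : Carrier N) → Set
Cond2 M N C c a b =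
  SameSSy C ×
  ((i : I C) (δ : Formula 3) → IsΔ₀ δ →
     Σ (Carrier M) (λ z → Sat M δ (ιM C i ∷ c ∷ z ∷ [])) →
     Σ (Carrier N) (λ z → St._≺_ N z b × Sat N δ (ιN C i ∷ a ∷ z ∷ [])))

{-# OPTIONS --safe #-}
module Submission where

-- (1) ⇒ (2): Δ₀ formulas are absolute along an initial embedding. A number of N is cut down
-- modulo 2^j(m), where m lies outside I and 2^m exists, to land in the image of j.
--
-- (2) ⇒ (1): a back-and-forth between tuples satisfying the second half of (2). A universal
-- Σ₁ formula turns the type to be realised into a Σ₁ subset of I; its complement is coded
-- (Σ₁ comprehension for Ackermann sets), moved to the other model by equality of the standard
-- systems, and realised by overspill (forth) or Σ₁ underspill (back). The pieces of the code
-- below elements of I lie in I, so the instances that are transferred have parameters in I.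
--
-- Only standard formulas ever need a truth value, so no syntax is developed inside the models:
-- truth is witnessed by finite sets of claims "expression e has value v in environment s",
-- each justified by other claims of the set, and soundness and completeness of such
-- certificates are proved by induction on expressions in the metatheory.

open import Defs
open import Level using (0ℓ)
open import Algebra.Bundles using (CommutativeSemiring)
open import Algebra.Structures.Biased using (isCommutativeSemiringˡ)
import Algebra.Solver.Ring.NaturalCoefficients.Default
open import Axiom.ExcludedMiddle using (ExcludedMiddle)
open import Data.Empty using (⊥; ⊥-elim)
open import Data.Fin using (Fin; zero; suc; _↑ʳ_)
open import Data.Nat using (ℕ; zero; suc; _≤′_; ≤′-reflexive; ≤′-step) renaming (_+_ to _+ℕ_)
import Data.Nat.Properties as ℕₚ
open import Data.Product using (Σ; _×_; _,_; proj₁; proj₂; map; map₁; map₂)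
open import Data.Sum using (_⊎_; inj₁; inj₂; [_,_]′)
import Data.Sum as Sum
open import Data.Vec using (Vec; _∷_; []; lookup)
import Data.Vec as Vec
open import Data.Vec.Properties using (lookup-map)
open import Data.Vec.Relation.Unary.All using (All; []; _∷_)
import Data.Vec.Relation.Unary.All as All
open import Function.Base using (id)
open import Function.Bundles using (_⇔_; mk⇔)
open import Relation.Nullary using (¬_; Dec; yes; no)
open import Relation.Binary.PropositionalEquality using (_≡_; _≢_; refl; sym; trans; cong; cong₂; subst; subst₂; isEquivalence)

-- Δ₀ formulas and substitution

-- The two models enter unequally: a witness anywhere in M must give a witness below b in N. Below
-- b, Σ₁ truth in N becomes Δ₀, so its failure can be coded in the back step, and in the forth step
-- b passes through overspill as an ordinary parameter.
--
-- Coding the complement of the type keeps both steps Σ₁. Forth asks that each x below k is in the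
-- complement or satisfies θ; back asks that some x in the complement satisfies θ. In both,
-- membership occurs positively.
--
-- Induction is restricted to Σ₁ formulas, so a statement with a bounded universal quantifier in
-- front of an existential one is first given a common bound for its witnesses by collection, and
-- only then transferred or spilled.
--
-- Two codings of sets coexist. Certificates concern arbitrary elements and are coded by
-- divisibility, which needs only multiplication. Ackermann codes serve for subsets of I, where 2^x
-- is at hand: in M by closure of I, in N by transfer. Overspill provides one exponent outside I as
-- well.

record Δ₀F (n : ℕ) : Set where
  constructor mkΔ
  field
    formula : Formula n
    bounded : IsΔ₀ formula

open Δ₀F public

infix 0 _⊨_
_⊨_ : (M : Structure) → ∀ {n} → Δ₀F n → Vec (Carrier M) n → Set
(M ⊨ φ) ρ = Sat M (formula φ) ρ

infix 4 _≐_ _⋖_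
infixr 3 _∧̇_
infixr 2 _∨̇_
infixr 1 _⇒̇_

_≐_ _⋖_ : ∀ {n} → Term n → Term n → Δ₀F n
t ≐ u = mkΔ (t ≈ᶠ u) (eq t u)
t ⋖ u = mkΔ (t <ᶠ u) (lt t u)

⊥̇ : ∀ {n} → Δ₀F n
⊥̇ = mkΔ ⊥ᶠ bot

_∧̇_ _∨̇_ _⇒̇_ : ∀ {n} → Δ₀F n → Δ₀F n → Δ₀F n
φ ∧̇ ψ = mkΔ (formula φ ∧ᶠ formula ψ) (and (bounded φ) (bounded ψ))
φ ∨̇ ψ = mkΔ (formula φ ∨ᶠ formula ψ) (or (bounded φ) (bounded ψ))
φ ⇒̇ ψ = mkΔ (formula φ ⇒ᶠ formula ψ) (imp (bounded φ) (bounded ψ))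

¬̇_ : ∀ {n} → Δ₀F n → Δ₀F n
¬̇ φ = φ ⇒̇ ⊥̇

∀̇< ∃̇< : ∀ {n} → Term n → Δ₀F (suc n) → Δ₀F n
∀̇< t φ = mkΔ (∀<ᶠ t (formula φ)) (ball t (bounded φ))
∃̇< t φ = mkΔ (∃<ᶠ t (formula φ)) (bex t (bounded φ))

v0 : ∀ {n} → Term (1 +ℕ n)
v0 = var zero
v1 : ∀ {n} → Term (2 +ℕ n)
v1 = var (suc zero)
v2 : ∀ {n} → Term (3 +ℕ n)
v2 = var (suc (suc zero))
v3 : ∀ {n} → Term (4 +ℕ n)
v3 = var (3 ↑ʳ zero)
v4 : ∀ {n} → Term (5 +ℕ n)
v4 = var (4 ↑ʳ zero)
v5 : ∀ {n} → Term (6 +ℕ n)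
v5 = var (5 ↑ʳ zero)
v6 : ∀ {n} → Term (7 +ℕ n)
v6 = var (6 ↑ʳ zero)
v7 : ∀ {n} → Term (8 +ℕ n)
v7 = var (7 ↑ʳ zero)
Subst : ℕ → ℕ → Set
Subst m n = Fin m → Term n

subᵗ : ∀ {m n} → Subst m n → Term m → Term n
subᵗ σ (var i) = σ i
subᵗ σ zer = zer
subᵗ σ (sc t) = sc (subᵗ σ t)
subᵗ σ (t +ᵗ u) = subᵗ σ t +ᵗ subᵗ σ u
subᵗ σ (t *ᵗ u) = subᵗ σ t *ᵗ subᵗ σ u

↑ : ∀ {n} k → Subst n (k +ℕ n)
↑ k i = var (k ↑ʳ i)

wk : ∀ {n} → Term n → Term (suc n)
wk = subᵗ (↑ 1)

infixr 5 _◂_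
_◂_ : ∀ {m n} → Term n → Subst m n → Subst (suc m) n
(t ◂ σ) zero = t
(t ◂ σ) (suc i) = σ i

lift : ∀ {m n} → Subst m n → Subst (suc m) (suc n)
lift σ = v0 ◂ λ i → wk (σ i)

subᶠ : ∀ {m n} → Subst m n → Formula m → Formula n
subᶠ σ (t ≈ᶠ u) = subᵗ σ t ≈ᶠ subᵗ σ u
subᶠ σ (t <ᶠ u) = subᵗ σ t <ᶠ subᵗ σ u
subᶠ σ ⊥ᶠ = ⊥ᶠ
subᶠ σ (φ ∧ᶠ ψ) = subᶠ σ φ ∧ᶠ subᶠ σ ψ
subᶠ σ (φ ∨ᶠ ψ) = subᶠ σ φ ∨ᶠ subᶠ σ ψ
subᶠ σ (φ ⇒ᶠ ψ) = subᶠ σ φ ⇒ᶠ subᶠ σ ψ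
subᶠ σ (∀ᶠ φ) = ∀ᶠ (subᶠ (lift σ) φ)
subᶠ σ (∃ᶠ φ) = ∃ᶠ (subᶠ (lift σ) φ)
subᶠ σ (∀<ᶠ t φ) = ∀<ᶠ (subᵗ σ t) (subᶠ (lift σ) φ)
subᶠ σ (∃<ᶠ t φ) = ∃<ᶠ (subᵗ σ t) (subᶠ (lift σ) φ)

subᶠ-Δ₀ : ∀ {m n} (σ : Subst m n) {φ} → IsΔ₀ φ → IsΔ₀ (subᶠ σ φ)
subᶠ-Δ₀ σ (eq t u) = eq _ _
subᶠ-Δ₀ σ (lt t u) = lt _ _
subᶠ-Δ₀ σ bot = bot
subᶠ-Δ₀ σ (and p q) = and (subᶠ-Δ₀ σ p) (subᶠ-Δ₀ σ q)
subᶠ-Δ₀ σ (or p q) = or (subᶠ-Δ₀ σ p) (subᶠ-Δ₀ σ q)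
subᶠ-Δ₀ σ (imp p q) = imp (subᶠ-Δ₀ σ p) (subᶠ-Δ₀ σ q)
subᶠ-Δ₀ σ (ball t p) = ball _ (subᶠ-Δ₀ (lift σ) p)
subᶠ-Δ₀ σ (bex t p) = bex _ (subᶠ-Δ₀ (lift σ) p)

infixl 8 _[_]
_[_] : ∀ {m n} → Δ₀F m → Subst m n → Δ₀F n
φ [ σ ] = mkΔ (subᶠ σ (formula φ)) (subᶠ-Δ₀ σ (bounded φ))

module _ (M : Structure) where
  private
    A = Carrier M

  _⊩_↦_ : ∀ {m n} → Vec A n → Subst m n → Vec A m → Set
  ρ ⊩ σ ↦ ρ′ = ∀ i → ⟦_⟧ᵗ M (σ i) ρ ≡ lookup ρ′ i

  ⟦subᵗ⟧ : ∀ {m n} {σ : Subst m n} {ρ ρ′} → ρ ⊩ σ ↦ ρ′ →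
           ∀ t → ⟦_⟧ᵗ M (subᵗ σ t) ρ ≡ ⟦_⟧ᵗ M t ρ′
  ⟦subᵗ⟧ h (var i) = h i
  ⟦subᵗ⟧ h zer = refl
  ⟦subᵗ⟧ h (sc t) = cong (St.𝐒 M) (⟦subᵗ⟧ h t)
  ⟦subᵗ⟧ h (t +ᵗ u) = cong₂ (St._⊕_ M) (⟦subᵗ⟧ h t) (⟦subᵗ⟧ h u)
  ⟦subᵗ⟧ h (t *ᵗ u) = cong₂ (St._⊗_ M) (⟦subᵗ⟧ h t) (⟦subᵗ⟧ h u)

  ⟦wk⟧ : ∀ {n} (t : Term n) {x ρ} → ⟦_⟧ᵗ M (wk t) (x ∷ ρ) ≡ ⟦_⟧ᵗ M t ρ
  ⟦wk⟧ t = ⟦subᵗ⟧ (λ i → refl) t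

  ⊩-lift : ∀ {m n} (σ : Subst m n) {ρ ρ′} → ρ ⊩ σ ↦ ρ′ → ∀ {x} → (x ∷ ρ) ⊩ lift σ ↦ (x ∷ ρ′)
  ⊩-lift σ h zero = refl
  ⊩-lift σ h (suc i) = trans (⟦wk⟧ (σ i)) (h i)

  Sat-sub : ∀ {m n} {σ : Subst m n} {ρ ρ′} → ρ ⊩ σ ↦ ρ′ → ∀ φ →
            (Sat M (subᶠ σ φ) ρ → Sat M φ ρ′) × (Sat M φ ρ′ → Sat M (subᶠ σ φ) ρ)
  Sat-sub h (t ≈ᶠ u) = subst₂ _≡_ (⟦subᵗ⟧ h t) (⟦subᵗ⟧ h u) ,
                       subst₂ _≡_ (sym (⟦subᵗ⟧ h t)) (sym (⟦subᵗ⟧ h u))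
  Sat-sub h (t <ᶠ u) = subst₂ (St._≺_ M) (⟦subᵗ⟧ h t) (⟦subᵗ⟧ h u) ,
                       subst₂ (St._≺_ M) (sym (⟦subᵗ⟧ h t)) (sym (⟦subᵗ⟧ h u))
  Sat-sub h ⊥ᶠ = id , id
  Sat-sub h (φ ∧ᶠ ψ) = map (proj₁ (Sat-sub h φ)) (proj₁ (Sat-sub h ψ)) ,
                       map (proj₂ (Sat-sub h φ)) (proj₂ (Sat-sub h ψ))
  Sat-sub h (φ ∨ᶠ ψ) = Sum.map (proj₁ (Sat-sub h φ)) (proj₁ (Sat-sub h ψ)) ,
                       Sum.map (proj₂ (Sat-sub h φ)) (proj₂ (Sat-sub h ψ))
  Sat-sub h (φ ⇒ᶠ ψ) = (λ f x → proj₁ (Sat-sub h ψ) (f (proj₂ (Sat-sub h φ) x))) ,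
                       (λ f x → proj₂ (Sat-sub h ψ) (f (proj₁ (Sat-sub h φ) x)))
  Sat-sub {σ = σ} h (∀ᶠ φ) = (λ f x → proj₁ (Sat-sub (⊩-lift σ h) φ) (f x)) ,
                     (λ f x → proj₂ (Sat-sub (⊩-lift σ h) φ) (f x))
  Sat-sub {σ = σ} h (∃ᶠ φ) = (λ { (x , p) → x , proj₁ (Sat-sub (⊩-lift σ h) φ) p }) ,
                     (λ { (x , p) → x , proj₂ (Sat-sub (⊩-lift σ h) φ) p })
  Sat-sub {σ = σ} h (∀<ᶠ t φ) =
    (λ f x l → proj₁ (Sat-sub (⊩-lift σ h) φ) (f x (subst (St._≺_ M x) (sym (⟦subᵗ⟧ h t)) l))) ,
    (λ f x l → proj₂ (Sat-sub (⊩-lift σ h) φ) (f x (subst (St._≺_ M x) (⟦subᵗ⟧ h t) l)))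
  Sat-sub {σ = σ} h (∃<ᶠ t φ) =
    (λ { (x , l , p) → x , subst (St._≺_ M x) (⟦subᵗ⟧ h t) l , proj₁ (Sat-sub (⊩-lift σ h) φ) p }) ,
    (λ { (x , l , p) → x , subst (St._≺_ M x) (sym (⟦subᵗ⟧ h t)) l , proj₂ (Sat-sub (⊩-lift σ h) φ) p })

  sub⇒ : ∀ {m n} (φ : Δ₀F m) {σ : Subst m n} {ρ ρ′} → ρ ⊩ σ ↦ ρ′ → (M ⊨ φ [ σ ]) ρ → (M ⊨ φ) ρ′
  sub⇒ φ h = proj₁ (Sat-sub h (formula φ))

  sub⇐ : ∀ {m n} (φ : Δ₀F m) {σ : Subst m n} {ρ ρ′} → ρ ⊩ σ ↦ ρ′ → (M ⊨ φ) ρ′ → (M ⊨ φ [ σ ]) ρ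
  sub⇐ φ h = proj₂ (Sat-sub h (formula φ))

-- Arithmetic in a model of IΣ₁

module Arith (em : ExcludedMiddle 0ℓ) (M : Structure) (isM : IsModelIΣ₁ M) where
  open IsModelIΣ₁ isM public
  open Structure M public renaming (Carrier to A; 𝟎 to 0#; 𝐒 to S; _⊕_ to infixl 6 _+_; _⊗_ to infixl 7 _*_; _≺_ to infix 4 _<_)

  -- Induction is available only for syntactic formulas, so each use names its formula and puts the
  -- parameters into the environment. `Sat` computes, so the formula unfolds to the intended
  -- statement unless a substitution intervenes.
  ind₀ : ∀ {n} (φ : Δ₀F (suc n)) (ρ : Vec A n) → (M ⊨ φ) (0# ∷ ρ) →
         (∀ x → (M ⊨ φ) (x ∷ ρ) → (M ⊨ φ) (S x ∷ ρ)) → ∀ x → (M ⊨ φ) (x ∷ ρ)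
  ind₀ φ = Σ₁-ind (formula φ) (δ₀ (bounded φ))

  ind₁ : ∀ {n} (φ : Δ₀F (2 +ℕ n)) (ρ : Vec A n) → let P = λ x → Σ A λ w → (M ⊨ φ) (w ∷ x ∷ ρ) in
         P 0# → (∀ x → P x → P (S x)) → ∀ x → P x
  ind₁ φ = Σ₁-ind (∃ᶠ (formula φ)) (ex (δ₀ (bounded φ)))

  ind₂ : ∀ {n} (φ : Δ₀F (3 +ℕ n)) (ρ : Vec A n) →
         let P = λ x → Σ A λ v → Σ A λ w → (M ⊨ φ) (w ∷ v ∷ x ∷ ρ) in
         P 0# → (∀ x → P x → P (S x)) → ∀ x → P x
  ind₂ φ = Σ₁-ind (∃ᶠ (∃ᶠ (formula φ))) (ex (ex (δ₀ (bounded φ))))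

  1# 2# : A
  1# = S 0#
  2# = S 1#

  +-identityˡ : ∀ x → 0# + x ≡ x
  +-identityˡ = ind₀ (zer +ᵗ v0 ≐ v0) [] (+-zero 0#) (λ x h → trans (+-suc 0# x) (cong S h))

  +-sucˡ : ∀ x y → S x + y ≡ S (x + y)
  +-sucˡ x = ind₀ (sc v1 +ᵗ v0 ≐ sc (v1 +ᵗ v0)) (x ∷ [])
    (trans (+-zero _) (cong S (sym (+-zero _))))
    (λ y h → trans (+-suc _ y) (trans (cong S h) (cong S (sym (+-suc x y)))))

  +-comm : ∀ x y → x + y ≡ y + x
  +-comm x = ind₀ (v1 +ᵗ v0 ≐ v0 +ᵗ v1) (x ∷ [])
    (trans (+-zero x) (sym (+-identityˡ x)))
    (λ y h → trans (+-suc x y) (trans (cong S h) (sym (+-sucˡ y x))))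

  +-assoc : ∀ x y z → (x + y) + z ≡ x + (y + z)
  +-assoc x y = ind₀ ((v1 +ᵗ v2) +ᵗ v0 ≐ v1 +ᵗ (v2 +ᵗ v0)) (x ∷ y ∷ [])
    (trans (+-zero _) (cong (x +_) (sym (+-zero y))))
    (λ z h → trans (+-suc _ z) (trans (cong S h) (trans (sym (+-suc x _)) (cong (x +_) (sym (+-suc y z))))))

  *-zeroˡ : ∀ x → 0# * x ≡ 0#
  *-zeroˡ = ind₀ (zer *ᵗ v0 ≐ zer) [] (*-zero 0#)
    (λ x h → trans (*-suc 0# x) (trans (+-zero _) h))

  private
    swap : ∀ a b c → (a + b) + c ≡ (a + c) + b
    swap a b c = trans (+-assoc a b c) (trans (cong (a +_) (+-comm b c)) (sym (+-assoc a c b)))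

  *-sucˡ : ∀ x y → S x * y ≡ x * y + y
  *-sucˡ x = ind₀ (sc v1 *ᵗ v0 ≐ (v1 *ᵗ v0) +ᵗ v0) (x ∷ [])
    (trans (*-zero _) (sym (trans (+-zero _) (*-zero x))))
    (λ y h → trans (*-suc _ y) (trans (cong (_+ S x) h) (trans (+-suc _ x)
       (trans (cong S (trans (swap (x * y) y x) (cong (_+ y) (sym (*-suc x y))))) (sym (+-suc _ y))))))

  *-comm : ∀ x y → x * y ≡ y * x
  *-comm x = ind₀ (v1 *ᵗ v0 ≐ v0 *ᵗ v1) (x ∷ [])
    (trans (*-zero x) (sym (*-zeroˡ x)))
    (λ y h → trans (*-suc x y) (trans (cong (_+ x) h) (sym (*-sucˡ y x))))

  *-distribˡ : ∀ x y z → x * (y + z) ≡ x * y + x * z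
  *-distribˡ x y = ind₀ (v1 *ᵗ (v2 +ᵗ v0) ≐ (v1 *ᵗ v2) +ᵗ (v1 *ᵗ v0)) (x ∷ y ∷ [])
    (trans (cong (x *_) (+-zero y)) (sym (trans (cong (x * y +_) (*-zero x)) (+-zero _))))
    (λ z h → trans (cong (x *_) (+-suc y z)) (trans (*-suc x _) (trans (cong (_+ x) h)
       (trans (+-assoc _ _ x) (cong (x * y +_) (sym (*-suc x z)))))))

  *-distribʳ : ∀ x y z → (y + z) * x ≡ y * x + z * x
  *-distribʳ x y z = trans (*-comm _ x) (trans (*-distribˡ x y z) (cong₂ _+_ (*-comm x y) (*-comm x z)))

  *-assoc : ∀ x y z → (x * y) * z ≡ x * (y * z)
  *-assoc x y = ind₀ ((v1 *ᵗ v2) *ᵗ v0 ≐ v1 *ᵗ (v2 *ᵗ v0)) (x ∷ y ∷ [])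
    (trans (*-zero _) (sym (trans (cong (x *_) (*-zero y)) (*-zero x))))
    (λ z h → trans (*-suc _ z) (trans (cong (_+ x * y) h)
       (trans (sym (*-distribˡ x _ _)) (cong (x *_) (sym (*-suc y z))))))

  *-identityˡ : ∀ x → 1# * x ≡ x
  *-identityˡ x = trans (*-sucˡ 0# x) (trans (cong (_+ x) (*-zeroˡ x)) (+-identityˡ x))

  *-identityʳ : ∀ x → x * 1# ≡ x
  *-identityʳ x = trans (*-comm x 1#) (*-identityˡ x)

  commutativeSemiring : CommutativeSemiring 0ℓ 0ℓ
  commutativeSemiring = record
    { Carrier = A ; _≈_ = _≡_ ; _+_ = _+_ ; _*_ = _*_ ; 0# = 0# ; 1# = 1#
    ; isCommutativeSemiring = isCommutativeSemiringˡ record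
      { +-isCommutativeMonoid = record
        { isMonoid = record
          { isSemigroup = record
            { isMagma = record { isEquivalence = isEquivalence ; ∙-cong = cong₂ _+_ }
            ; assoc = +-assoc }
          ; identity = +-identityˡ , +-zero }
        ; comm = +-comm }
      ; *-isCommutativeMonoid = record
        { isMonoid = record
          { isSemigroup = record
            { isMagma = record { isEquivalence = isEquivalence ; ∙-cong = cong₂ _*_ }
            ; assoc = *-assoc }
          ; identity = *-identityˡ , *-identityʳ }
        ; comm = *-comm }
      ; distribʳ = *-distribʳ
      ; zeroˡ = *-zeroˡ } }

  open Algebra.Solver.Ring.NaturalCoefficients.Default commutativeSemiring public
    using (solve; _:=_; _:+_; _:*_; con)

  S≡+1 : ∀ x → S x ≡ x + 1#
  S≡+1 x = sym (trans (+-suc x 0#) (cong S (+-zero x)))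

  +-cancelʳ : ∀ x y z → x + z ≡ y + z → x ≡ y
  +-cancelʳ x y = ind₀ ((v1 +ᵗ v0 ≐ v2 +ᵗ v0) ⇒̇ v1 ≐ v2) (x ∷ y ∷ [])
    (λ h → trans (sym (+-zero x)) (trans h (+-zero y)))
    (λ z h e → h (S-inj _ _ (trans (sym (+-suc x z)) (trans e (+-suc y z)))))

  +-cancelˡ : ∀ z {x y} → z + x ≡ z + y → x ≡ y
  +-cancelˡ z {x} {y} e = +-cancelʳ x y z (trans (+-comm x z) (trans e (+-comm z y)))

  infix 4 _≤_
  _≤_ : A → A → Set
  x ≤ y = Σ A λ z → x + z ≡ y

  ≤-refl : ∀ {x} → x ≤ x
  ≤-refl = 0# , +-zero _

  ≤-reflexive : ∀ {x y} → x ≡ y → x ≤ y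
  ≤-reflexive refl = ≤-refl

  ≤-trans : ∀ {x y z} → x ≤ y → y ≤ z → x ≤ z
  ≤-trans (a , refl) (b , refl) = a + b , sym (+-assoc _ a b)

  x≤x+y : ∀ {x y} → x ≤ x + y
  x≤x+y {y = y} = y , refl

  y≤x+y : ∀ {x y} → y ≤ x + y
  y≤x+y {x} {y} = x , +-comm y x

  0≤ : ∀ {x} → 0# ≤ x
  0≤ {x} = x , +-identityˡ x

  <⇒S≤ : ∀ {x y} → x < y → S x ≤ y
  <⇒S≤ {x} {y} l with <-def₁ x y l
  ... | z , e = z , trans (+-sucˡ x z) (trans (sym (+-suc x z)) e)

  S≤⇒< : ∀ {x y} → S x ≤ y → x < y
  S≤⇒< {x} {y} (z , e) = <-def₂ x y z (trans (+-suc x z) (trans (sym (+-sucˡ x z)) e))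

  S≤S : ∀ {x y} → x ≤ y → S x ≤ S y
  S≤S (z , refl) = z , +-sucˡ _ z

  S≤S⁻ : ∀ {x y} → S x ≤ S y → x ≤ y
  S≤S⁻ (z , e) = z , S-inj _ _ (trans (sym (+-sucˡ _ z)) e)

  ≤⇒<S : ∀ {x y} → x ≤ y → x < S y
  ≤⇒<S l = S≤⇒< (S≤S l)

  <S⇒≤ : ∀ {x y} → x < S y → x ≤ y
  <S⇒≤ l = S≤S⁻ (<⇒S≤ l)

  x≤Sx : ∀ {x} → x ≤ S x
  x≤Sx {x} = 1# , sym (S≡+1 x)

  x<Sx : ∀ {x} → x < S x
  x<Sx = ≤⇒<S ≤-refl

  <⇒≤ : ∀ {x y} → x < y → x ≤ y
  <⇒≤ l = ≤-trans x≤Sx (<⇒S≤ l)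

  <-≤-trans : ∀ {x y z} → x < y → y ≤ z → x < z
  <-≤-trans p q = S≤⇒< (≤-trans (<⇒S≤ p) q)

  ≤-<-trans : ∀ {x y z} → x ≤ y → y < z → x < z
  ≤-<-trans p q = S≤⇒< (≤-trans (S≤S p) (<⇒S≤ q))

  <-trans : ∀ {x y z} → x < y → y < z → x < z
  <-trans p q = <-≤-trans p (<⇒≤ q)

  x+y≡0⇒x≡0 : ∀ {x y} → x + y ≡ 0# → x ≡ 0#
  x+y≡0⇒x≡0 {x} {y} e = +-cancelʳ x 0# y (trans e (sym y≡0+y)) where
    y≡0 : y ≡ 0#
    y≡0 = ind₀ ((v1 +ᵗ v0 ≐ zer) ⇒̇ v0 ≐ zer) (x ∷ []) (λ _ → refl)
            (λ z _ e' → ⊥-elim (S≢0 _ (trans (sym (+-suc x z)) e'))) y e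
    y≡0+y : 0# + y ≡ 0#
    y≡0+y = trans (+-identityˡ y) y≡0

  <-irrefl : ∀ {x} → ¬ x < x
  <-irrefl {x} l with <-def₁ x x l
  ... | z , e = S≢0 z (+-cancelˡ x (trans e (sym (+-zero x))))

  x≮0 : ∀ {x} → ¬ x < 0#
  x≮0 {x} l = <-irrefl (<-≤-trans l 0≤)

  0<S : ∀ {x} → 0# < S x
  0<S = ≤⇒<S 0≤

  zero-or-suc : ∀ x → x ≡ 0# ⊎ Σ A λ y → x ≡ S y
  zero-or-suc x with ind₀ (v0 ≐ zer ∨̇ ∃̇< v0 (v1 ≐ sc v0)) [] (inj₁ refl) (λ y _ → inj₂ (y , x<Sx , refl)) x
  ... | inj₁ e = inj₁ e
  ... | inj₂ (y , _ , e) = inj₂ (y , e)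

  ≤⇒≡⊎< : ∀ {x y} → x ≤ y → x ≡ y ⊎ x < y
  ≤⇒≡⊎< {x} {y} (z , e) with zero-or-suc z
  ... | inj₁ refl = inj₁ (trans (sym (+-zero x)) e)
  ... | inj₂ (w , refl) = inj₂ (<-def₂ x y w e)

  ≤⊎> : ∀ x y → x ≤ y ⊎ y < x
  ≤⊎> x y with ind₀ (v0 ⋖ v1 ∨̇ (v0 ≐ v1 ∨̇ v1 ⋖ v0)) (y ∷ []) base step x
    where
    base : 0# < y ⊎ (0# ≡ y ⊎ y < 0#)
    base with ≤⇒≡⊎< (0≤ {y})
    ... | inj₁ e = inj₂ (inj₁ e)
    ... | inj₂ l = inj₁ l
    step : ∀ x → x < y ⊎ (x ≡ y ⊎ y < x) → S x < y ⊎ (S x ≡ y ⊎ y < S x)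
    step x (inj₁ l) with ≤⇒≡⊎< (<⇒S≤ l)
    ... | inj₁ e = inj₂ (inj₁ e)
    ... | inj₂ l' = inj₁ l'
    step x (inj₂ (inj₁ refl)) = inj₂ (inj₂ x<Sx)
    step x (inj₂ (inj₂ l)) = inj₂ (inj₂ (<-trans l x<Sx))
  ... | inj₁ l = inj₁ (<⇒≤ l)
  ... | inj₂ (inj₁ refl) = inj₁ ≤-refl
  ... | inj₂ (inj₂ l) = inj₂ l

  <-cmp : ∀ x y → x < y ⊎ (x ≡ y ⊎ y < x)
  <-cmp x y with ≤⊎> x y
  ... | inj₂ l = inj₂ (inj₂ l)
  ... | inj₁ l with ≤⇒≡⊎< l
  ...   | inj₁ e = inj₂ (inj₁ e)
  ...   | inj₂ l' = inj₁ l'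

  ≤⇒≯ : ∀ {x y} → x ≤ y → ¬ y < x
  ≤⇒≯ p q = <-irrefl (≤-<-trans p q)

  ≤-antisym : ∀ {x y} → x ≤ y → y ≤ x → x ≡ y
  ≤-antisym p q with ≤⇒≡⊎< p
  ... | inj₁ e = e
  ... | inj₂ l = ⊥-elim (≤⇒≯ q l)

  +-mono-≤ : ∀ {a b c d} → a ≤ b → c ≤ d → a + c ≤ b + d
  +-mono-≤ {a} {_} {c} (x , refl) (y , refl) =
    x + y , solve 4 (λ a c x y → (a :+ c) :+ (x :+ y) := (a :+ x) :+ (c :+ y)) refl a c x y

  *-mono-≤ : ∀ {a b c d} → a ≤ b → c ≤ d → a * c ≤ b * d
  *-mono-≤ {a} {_} {c} (x , refl) (y , refl) =
    x * c + (a + x) * y ,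
    solve 4 (λ a c x y → a :* c :+ (x :* c :+ (a :+ x) :* y) := (a :+ x) :* (c :+ y)) refl a c x y

  +-mono-<-≤ : ∀ {a b c d} → a < b → c ≤ d → a + c < b + d
  +-mono-<-≤ {a} {_} {c} p q = S≤⇒< (≤-trans (≤-reflexive (sym (+-sucˡ a c))) (+-mono-≤ (<⇒S≤ p) q))

  +-mono-≤-< : ∀ {a b c d} → a ≤ b → c < d → a + c < b + d
  +-mono-≤-< {a} {b} {c} {d} p q = subst₂ _<_ (+-comm c a) (+-comm d b) (+-mono-<-≤ q p)

  *-monoʳ-≤ : ∀ x {y z} → y ≤ z → x * y ≤ x * z
  *-monoʳ-≤ x = *-mono-≤ (≤-refl {x})

  *-monoˡ-≤ : ∀ x {y z} → y ≤ z → y * x ≤ z * x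
  *-monoˡ-≤ x l = *-mono-≤ l (≤-refl {x})

  *-cancel-< : ∀ z {x y} → z * x < z * y → x < y
  *-cancel-< z {x} {y} l with ≤⊎> y x
  ... | inj₂ p = p
  ... | inj₁ p = ⊥-elim (≤⇒≯ (*-monoʳ-≤ z p) l)

  x≤y*x : ∀ {x y} → 0# < y → x ≤ y * x
  x≤y*x {x} {y} l = ≤-trans (≤-reflexive (sym (*-identityˡ x))) (*-monoˡ-≤ x (<⇒S≤ l))

  x≤x*y : ∀ {x y} → 0# < y → x ≤ x * y
  x≤x*y {x} {y} l = ≤-trans (x≤y*x l) (≤-reflexive (*-comm y x))

  -- Division with remainder and pairing.

  DivMod : A → A → A → A → Set
  DivMod a d q r = a ≡ q * d + r × r < d

  divMod : ∀ a d → 0# < d → Σ A λ q → Σ A λ r → DivMod a d q r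
  divMod a d d>0 = ind₂ ((v2 ≐ (v1 *ᵗ v3) +ᵗ v0) ∧̇ (v0 ⋖ v3)) (d ∷ [])
    (0# , 0# , sym (trans (+-zero _) (*-zeroˡ d)) , d>0)
    step a
    where
    step : ∀ x → Σ A (λ q → Σ A λ r → DivMod x d q r) → Σ A (λ q → Σ A λ r → DivMod (S x) d q r)
    step x (q , r , e , l) with ≤⇒≡⊎< (<⇒S≤ l)
    ... | inj₂ l' = q , S r , trans (cong S e) (sym (+-suc _ r)) , l'
    ... | inj₁ e' = S q , 0# , trans (cong S e) (trans (sym (+-suc _ r)) (trans (cong (q * d +_) e') (sym (trans (+-zero _) (*-sucˡ q d))))) , d>0

  private
    quotient-≮ : ∀ {a d q r q' r'} → DivMod a d q r → DivMod a d q' r' → ¬ q < q'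
    quotient-≮ {a} {d} {q} {r} {q'} {r'} (e , l) (e' , l') p = <-irrefl (<-≤-trans (+-mono-≤-< (≤-refl {q * d}) l)
      (≤-trans (≤-reflexive (sym (*-sucˡ q d))) (≤-trans (*-monoˡ-≤ d (<⇒S≤ p)) (≤-trans x≤x+y (≤-reflexive (trans (sym e') e))))))

  divMod-unique : ∀ {a d q r q' r'} → DivMod a d q r → DivMod a d q' r' → q ≡ q' × r ≡ r'
  divMod-unique {a} {d} {q} {r} {q'} {r'} x@(e , _) x'@(e' , _) with <-cmp q q'
  ... | inj₁ p = ⊥-elim (quotient-≮ x x' p)
  ... | inj₂ (inj₁ refl) = refl , +-cancelˡ (q * d) (trans (sym e) e')
  ... | inj₂ (inj₂ p) = ⊥-elim (quotient-≮ x' x p)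

  -- A polynomial, hence a term of the language. With s = x + y the value lies between s² and s² +
  -- s, so below (s + 1)²; it therefore determines s, and then x.
  pair : A → A → A
  pair x y = (x + y) * (x + y) + x

  x≤x*x : ∀ {x} → x ≤ x * x
  x≤x*x {x} with zero-or-suc x
  ... | inj₁ refl = 0≤
  ... | inj₂ (y , refl) = x≤x*y 0<S

  fst≤pair : ∀ {x y} → x ≤ pair x y
  fst≤pair = y≤x+y

  snd≤pair : ∀ {x y} → y ≤ pair x y
  snd≤pair = ≤-trans y≤x+y (≤-trans x≤x*x x≤x+y)

  pair-mono : ∀ {x x' y y'} → x ≤ x' → y ≤ y' → pair x y ≤ pair x' y'
  pair-mono p q = +-mono-≤ (*-mono-≤ (+-mono-≤ p q) (+-mono-≤ p q)) p

  private
    pair-sum-≮ : ∀ {x y x' y'} → pair x y ≡ pair x' y' → ¬ x + y < x' + y'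
    pair-sum-≮ {x} {y} {x'} {y'} e l = <-irrefl (subst (_< pair x' y') e (<-≤-trans (≤⇒<S
      (≤-trans (+-mono-≤ (≤-refl {(x + y) * (x + y)}) (x≤x+y {x} {y})) (x + y , refl)))
      (≤-trans (≤-reflexive sq) (≤-trans (*-mono-≤ (<⇒S≤ l) (<⇒S≤ l)) x≤x+y))))
      where
      sq : S ((x + y) * (x + y) + (x + y) + (x + y)) ≡ S (x + y) * S (x + y)
      sq = trans (S≡+1 _) (trans (solve 1 (λ s → s :* s :+ s :+ s :+ con 1 := (s :+ con 1) :* (s :+ con 1)) refl (x + y))
             (sym (cong₂ _*_ (S≡+1 _) (S≡+1 _))))

  pair-injective : ∀ {x y x' y'} → pair x y ≡ pair x' y' → x ≡ x' × y ≡ y'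
  pair-injective {x} {y} {x'} {y'} e with <-cmp (x + y) (x' + y')
  ... | inj₁ l = ⊥-elim (pair-sum-≮ e l)
  ... | inj₂ (inj₂ l) = ⊥-elim (pair-sum-≮ (sym e) l)
  ... | inj₂ (inj₁ s) = x≡x' , +-cancelˡ x (trans s (cong (_+ y') (sym x≡x')))
    where
    x≡x' : x ≡ x'
    x≡x' = +-cancelˡ ((x + y) * (x + y)) (trans e (cong (λ s → s * s + x') (sym s)))

-- Finite sets coded by divisibility

infix 4 _∈̇_
-- The moduli 1 + (x + 1)q are those of Gödel's β-function, but a set is coded by the product p of
-- the moduli of its elements instead of by remainders. The cofactor is at most p, which makes
-- membership Δ₀.
_∈̇_ : ∀ {n} → Term n → Term n × Term n × Term n → Δ₀F n
x ∈̇ (p , q , k) = x ⋖ k ∧̇ ∃̇< (sc p) (sc (sc (wk x) *ᵗ wk q) *ᵗ v0 ≐ wk p)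

module FinSets (em : ExcludedMiddle 0ℓ) (M : Structure) (isM : IsModelIΣ₁ M) where
  open Arith em M isM

  infix 4 _∣_
  _∣_ : A → A → Set
  m ∣ a = Σ A λ h → m * h ≡ a

  ∣-+-cancel : ∀ {m a b} → m ∣ a → m ∣ a + b → m ∣ b
  ∣-+-cancel {m} {a} {b} (g , refl) (h , e) with ≤⊎> g h
  ... | inj₁ (c , refl) = c , +-cancelˡ (m * g) (trans (sym (*-distribˡ m g c)) e)
  ... | inj₂ l = 0# , trans (*-zero m) (sym b≡0)
    where
    b≡0 : b ≡ 0#
    b≡0 = +-cancelˡ (m * g) (trans (≤-antisym (≤-trans (≤-reflexive (sym e)) (*-monoʳ-≤ m (<⇒≤ l))) x≤x+y) (sym (+-zero _)))

  ∣-*ʳ : ∀ {m a} b → m ∣ a → m ∣ a * b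
  ∣-*ʳ {m} b (h , refl) = h * b , sym (*-assoc m h b)

  ∣-bounded : ∀ {m a} → S m ∣ a → Σ A λ h → h < S a × S m * h ≡ a
  ∣-bounded (h , refl) = h , ≤⇒<S (x≤y*x 0<S) , refl

  modulus : A → A → A
  modulus q u = S (u * q)

  -- The moduli at u and u + d are coprime when d divides q:
  -- 1 ≡ (1 + uq) − u (q/d) d, and d is a combination of the two moduli.
  modulus-coprime : ∀ u d q h p → q ≡ d * h →
    (modulus q (u + d) ∣ p * modulus q u → modulus q (u + d) ∣ p) ×
    (modulus q u ∣ p * modulus q (u + d) → modulus q u ∣ p)
  modulus-coprime u d q h p refl = left , right
    where
    finish : ∀ v → modulus q v ∣ p * d → modulus q v ∣ p
    finish v dv = ∣-+-cancel {a = p * d * (h * v)} (∣-*ʳ (h * v) dv)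
      (p , trans (cong (_* p) (S≡+1 (v * q)))
        (solve 4 (λ v d h p → (v :* (d :* h) :+ con 1) :* p := p :* d :* (h :* v) :+ p) refl v d h p))
    left : modulus q (u + d) ∣ p * modulus q u → modulus q (u + d) ∣ p
    left (g , e) = finish (u + d) (∣-+-cancel {a = modulus q (u + d) * (p * u)} (p * u , refl)
      (g * (u + d) , trans (sym (*-assoc _ g _)) (trans (cong (_* (u + d)) e)
        (trans (cong (λ m → p * m * (u + d)) (S≡+1 (u * q)))
        (trans (solve 4 (λ u d h p → p :* (u :* (d :* h) :+ con 1) :* (u :+ d) :=
                        ((u :+ d) :* (d :* h) :+ con 1) :* (p :* u) :+ p :* d) refl u d h p)
          (cong (λ m → m * (p * u) + p * d) (sym (S≡+1 ((u + d) * q)))))))))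
    right : modulus q u ∣ p * modulus q (u + d) → modulus q u ∣ p
    right (g , e) = finish u (∣-+-cancel {a = modulus q u * (g * u)} (g * u , refl)
      ((u + d) * p , sym (trans (cong (_+ p * d) (trans (sym (*-assoc _ g u)) (cong (_* u) e)))
        (trans (cong (λ m → p * m * u + p * d) (S≡+1 ((u + d) * q)))
        (trans (solve 4 (λ u d h p → p :* ((u :+ d) :* (d :* h) :+ con 1) :* u :+ p :* d :=
                        (u :* (d :* h) :+ con 1) :* ((u :+ d) :* p)) refl u d h p)
          (cong (_* ((u + d) * p)) (sym (S≡+1 (u * q)))))))))

  -- Differences of distinct elements below K have to divide q for `modulus-coprime` to apply;
  -- positivity of q keeps the moduli from being 1.
  common-multiple : ∀ K → Σ A λ q → 0# < q × (∀ d → d < K → S d ∣ q)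
  common-multiple K = proj₁ found , proj₁ (proj₂ found) , λ d l → map₂ proj₂ (proj₂ (proj₂ found) d l)
    where
    P : A → A → Set
    P q K = 0# < q × (∀ d → d < K → Σ A λ h → h < S q × S d * h ≡ q)
    step : ∀ K → Σ A (λ q → P q K) → Σ A (λ q → P q (S K))
    step K (q , q>0 , f) = q * S K , <-≤-trans q>0 (x≤x*y 0<S) , g
      where
      g : ∀ d → d < S K → Σ A λ h → h < S (q * S K) × S d * h ≡ q * S K
      g d l with ≤⇒≡⊎< (<S⇒≤ l)
      ... | inj₁ refl = ∣-bounded (q , *-comm _ q)
      ... | inj₂ l' = ∣-bounded (∣-*ʳ (S K) (map₂ proj₂ (f d l')))
    found : Σ A λ q → P q K
    found = ind₁ (zer ⋖ v0 ∧̇ ∀̇< v1 (∃̇< (sc v1) (sc v1 *ᵗ v0 ≐ v2))) []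
      (1# , 0<S , λ d l → ⊥-elim (x≮0 l)) step K

  FinSet : Set
  FinSet = A × A × A

  infix 4 _∈_
  _∈_ : A → FinSet → Set
  x ∈ (p , q , k) = x < k × Σ A λ h → h < S p × modulus q (S x) * h ≡ p

  -- Run through k and multiply p by the modulus of k exactly when φ holds at k. The moduli below K
  -- are pairwise coprime, so the new factor puts no other element into the set.
  comprehension : ∀ {n} (φ : Δ₀F (suc n)) (ρ : Vec A n) K →
    Σ A λ p → Σ A λ q → ∀ x →
      (x ∈ (p , q , K) → x < K × (M ⊨ φ) (x ∷ ρ)) × (x < K × (M ⊨ φ) (x ∷ ρ) → x ∈ (p , q , K))
  comprehension {n} φ ρ K with common-multiple K
  ... | q , q>0 , div-q = proj₁ final , q , λ x →
      (λ { (l , h) → l , proj₂ (proj₁ (proj₂ final x l) h) }) ,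
      (λ { (l , h) → l , proj₂ (proj₂ final x l) (l , h) })
    where
    σ : Subst (suc n) (5 +ℕ n)
    σ = v0 ◂ ↑ 5
    D : A → A → Set
    D p x = Σ A λ h → h < S p × modulus q (S x) * h ≡ p
    P : A → A → Set
    P p k = ∀ x → x < K → (D p x → x < k × (M ⊨ φ) (x ∷ ρ)) × (x < k × (M ⊨ φ) (x ∷ ρ) → D p x)
    dF : Δ₀F (5 +ℕ n)
    dF = ∃̇< (sc v1) (sc (sc v1 *ᵗ v5) *ᵗ v0 ≐ v2)
    F : Δ₀F (4 +ℕ n)
    F = ∀̇< v2 ((dF ⇒̇ v0 ⋖ v2 ∧̇ φ [ σ ]) ∧̇ (v0 ⋖ v2 ∧̇ φ [ σ ] ⇒̇ dF))
    to : ∀ {p k} → (M ⊨ F) (p ∷ k ∷ K ∷ q ∷ ρ) → P p k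
    to f x l = (λ d → map₂ (sub⇒ M φ (λ { zero → refl ; (suc i) → refl })) (proj₁ (f x l) d)) ,
               (λ { (l' , s) → proj₂ (f x l) (l' , sub⇐ M φ (λ { zero → refl ; (suc i) → refl }) s) })
    from : ∀ {p k} → P p k → (M ⊨ F) (p ∷ k ∷ K ∷ q ∷ ρ)
    from f x l = (λ d → map₂ (sub⇐ M φ (λ { zero → refl ; (suc i) → refl })) (proj₁ (f x l) d)) ,
                 (λ { (l' , s) → proj₂ (f x l) (l' , sub⇒ M φ (λ { zero → refl ; (suc i) → refl }) s) })
    base : P 1# 0#
    base x l = (λ { (h , _ , e) → ⊥-elim (no-unit h e) }) , λ { (l' , _) → ⊥-elim (x≮0 l') }
      where
      no-unit : ∀ h → modulus q (S x) * h ≢ 1#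
      no-unit h e with zero-or-suc h
      ... | inj₁ refl = S≢0 _ (trans (sym e) (*-zero _))
      ... | inj₂ (h' , refl) = ≤⇒≯ (≤-trans x≤x*y-S (≤-reflexive e)) (≤⇒<S (<⇒S≤ (<-≤-trans q>0 (x≤y*x 0<S))))
        where
        x≤x*y-S : modulus q (S x) ≤ modulus q (S x) * S h'
        x≤x*y-S = x≤x*y 0<S
    coprime : ∀ {p x k} → x < K → k < K → x ≢ k → modulus q (S x) ∣ p * modulus q (S k) → modulus q (S x) ∣ p
    coprime {p} {x} {k} lx lk ne dv with <-cmp x k
    ... | inj₂ (inj₁ e) = ⊥-elim (ne e)
    ... | inj₁ l with <-def₁ x k l
    ...   | d , refl with div-q d (≤-<-trans (≤-trans x≤Sx y≤x+y) lk)
    ...     | h , e = proj₂ (modulus-coprime (S x) (S d) q h p (sym e))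
                      (subst (λ u → modulus q (S x) ∣ p * modulus q u) (sym (+-sucˡ x (S d))) dv)
    coprime {p} {x} {k} lx lk ne dv | inj₂ (inj₂ l) with <-def₁ k x l
    ...   | d , refl with div-q d (≤-<-trans (≤-trans x≤Sx y≤x+y) lx)
    ...     | h , e = subst (λ u → modulus q u ∣ p) (+-sucˡ k (S d)) (proj₁ (modulus-coprime (S k) (S d) q h p (sym e))
                      (subst (λ u → modulus q u ∣ p * modulus q (S k)) (sym (+-sucˡ k (S d))) dv))
    step : ∀ k → Σ A (λ p → P p k) → Σ A (λ p → P p (S k))
    step k (p , f) with em {P = k < K × (M ⊨ φ) (k ∷ ρ)}
    -- This case includes every k from K on: the induction runs over all k, but membership is
    -- specified only below K.
    ... | no n = p , λ x l → (λ d → map₁ (λ a → <-trans a x<Sx) (proj₁ (f x l) d)) , back x l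
      where
      back : ∀ x → x < K → x < S k × (M ⊨ φ) (x ∷ ρ) → D p x
      back x l (l' , s) with ≤⇒≡⊎< (<S⇒≤ l')
      ... | inj₁ refl = ⊥-elim (n (l , s))
      ... | inj₂ l'' = proj₂ (f x l) (l'' , s)
    ... | yes (k<K , sat) = p * modulus q (S k) , λ x l → forth x l , back x l
      where
      forth : ∀ x → x < K → D (p * modulus q (S k)) x → x < S k × (M ⊨ φ) (x ∷ ρ)
      forth x l (h , _ , e) with em {P = x ≡ k}
      ... | yes refl = x<Sx , sat
      ... | no ne = map₁ (λ a → <-trans a x<Sx) (proj₁ (f x l) (∣-bounded (coprime l k<K ne (h , e))))
      back : ∀ x → x < K → x < S k × (M ⊨ φ) (x ∷ ρ) → D (p * modulus q (S k)) x
      back x l (l' , s) with ≤⇒≡⊎< (<S⇒≤ l')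
      ... | inj₁ refl = ∣-bounded (p , *-comm _ p)
      ... | inj₂ l'' = ∣-bounded (∣-*ʳ (modulus q (S k)) (map₂ proj₂ (proj₂ (f x l) (l'' , s))))
    final : Σ A λ p → P p K
    final = map₂ to (ind₁ F (K ∷ q ∷ ρ) (1# , from base)
      (λ k → λ { (p , f) → map₂ from (step k (p , to f)) }) K)

-- Truth certificates and a universal Σ₁ formula

data Op : Set where
  add mul eqv : Op

-- Terms and Δ₀ formulas are merged into one kind of expression with values in the model, so that a
-- certificate needs one kind of claim and seven rules. `top` and `drop` read an environment coded
-- by nested pairs.
data Expr : ℕ → Set where
  nil  : ∀ {n} → Expr n
  top  : ∀ {n} → Expr (suc n)
  drop : ∀ {n} → Expr n → Expr (suc n)
  bin  : ∀ {n} → Op → Expr n → Expr n → Expr n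
  some : ∀ {n} → Expr n → Expr (suc n) → Expr n

data Tag : Set where
  nilT topT dropT someT : Tag
  binT : Op → Tag

tagℕ : Tag → ℕ
tagℕ nilT = 0
tagℕ topT = 1
tagℕ dropT = 2
tagℕ someT = 3
tagℕ (binT add) = 4
tagℕ (binT mul) = 5
tagℕ (binT eqv) = 6

untag : ℕ → Tag
untag 0 = nilT
untag 1 = topT
untag 2 = dropT
untag 3 = someT
untag 4 = binT add
untag 5 = binT mul
untag _ = binT eqv

-- A left inverse yields injectivity of the tags without comparing them two by two.
untag-tagℕ : ∀ t → untag (tagℕ t) ≡ t
untag-tagℕ nilT = refl
untag-tagℕ topT = refl
untag-tagℕ dropT = refl
untag-tagℕ someT = refl
untag-tagℕ (binT add) = refl
untag-tagℕ (binT mul) = refl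
untag-tagℕ (binT eqv) = refl

numᵗ : ∀ {n} → ℕ → Term n
numᵗ zero = zer
numᵗ (suc k) = sc (numᵗ k)

pairᵗ : ∀ {n} → Term n → Term n → Term n
pairᵗ t u = ((t +ᵗ u) *ᵗ (t +ᵗ u)) +ᵗ t

claimᵗ : ∀ {n} → Term n → Term n → Term n → Term n
claimᵗ e s v = pairᵗ e (pairᵗ s v)

nodeᵗ : ∀ {n} → Tag → Term n → Term n → Term n
nodeᵗ t a b = pairᵗ (numᵗ (tagℕ t)) (pairᵗ a b)

SetTerm : ℕ → Set
SetTerm n = Term n × Term n × Term n

wkˢ : ∀ {n} → SetTerm n → SetTerm (suc n)
wkˢ (p , q , k) = wk p , wk q , wk k

opF : ∀ {n} → Op → (y z v : Term n) → Δ₀F n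
opF add y z v = v ≐ y +ᵗ z
opF mul y z v = v ≐ y *ᵗ z
opF eqv y z v = (y ≐ z ∧̇ v ≐ sc zer) ∨̇ (¬̇ (y ≐ z) ∧̇ v ≐ zer)

-- How the claim "node t a b has value v in environment s" is justified by claims in T.
ruleF : ∀ {n} → Tag → (a b s v : Term n) → SetTerm n → Δ₀F n
ruleF nilT a b s v T = v ≐ zer
ruleF topT a b s v T = ∃̇< (sc s) (wk s ≐ pairᵗ (wk v) v0)
ruleF dropT a b s v T = ∃̇< (sc s) (∃̇< (sc (wk s))
  (wk (wk s) ≐ pairᵗ v1 v0 ∧̇ claimᵗ (wk (wk a)) v0 (wk (wk v)) ∈̇ wkˢ (wkˢ T)))
ruleF (binT o) a b s v T@(_ , _ , k) = ∃̇< k (∃̇< (wk k)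
  (claimᵗ (wk (wk a)) (wk (wk s)) v1 ∈̇ wkˢ (wkˢ T) ∧̇
   claimᵗ (wk (wk b)) (wk (wk s)) v0 ∈̇ wkˢ (wkˢ T) ∧̇ opF o v1 v0 (wk (wk v))))
ruleF someT a b s v T@(_ , _ , k) = ∃̇< k (claimᵗ (wk a) (wk s) v0 ∈̇ wkˢ T ∧̇
  ((wk v ≐ zer ∧̇ ∀̇< v0 (claimᵗ (wk (wk b)) (pairᵗ v0 (wk (wk s))) zer ∈̇ wkˢ (wkˢ T))) ∨̇
   (wk v ≐ sc zer ∧̇ ∃̇< v0 (∃̇< (wk (wk k))
      (¬̇ (v0 ≐ zer) ∧̇ claimᵗ (wk (wk (wk b))) (pairᵗ v1 (wk (wk (wk s)))) v0 ∈̇ wkˢ (wkˢ (wkˢ T)))))))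

-- A claim in the set is below k and its components do not exceed it, so bounding all four
-- quantifiers by k loses nothing.
supportedAt : Tag → Δ₀F 3
supportedAt t = ∀̇< v2 (∀̇< v3 (∀̇< v4 (∀̇< v5
  (claimᵗ (nodeᵗ t v3 v2) v1 v0 ∈̇ (v4 , v5 , v6) ⇒̇ ruleF t v3 v2 v1 v0 (v4 , v5 , v6)))))

supportedF : Δ₀F 3
supportedF = supportedAt nilT ∧̇ supportedAt topT ∧̇ supportedAt dropT ∧̇ supportedAt someT ∧̇
  supportedAt (binT add) ∧̇ supportedAt (binT mul) ∧̇ supportedAt (binT eqv)

-- One layer of enlargement: the old claims and all claims with tag t that the old ones justify. An
-- expression needs one layer for each of its nodes.
extensionF : Tag → Δ₀F 4
extensionF t = v0 ∈̇ (v1 , v2 , v3) ∨̇ ∃̇< (sc v0) (∃̇< (sc v1) (∃̇< (sc v2) (∃̇< (sc v3)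
  (v4 ≐ claimᵗ (nodeᵗ t v3 v2) v1 v0 ∧̇ ruleF t v3 v2 v1 v0 (v5 , v6 , v7)))))

oneᴱ : ∀ {n} → Expr n
oneᴱ = bin eqv nil nil

negᴱ : ∀ {n} → Expr n → Expr n
negᴱ e = bin eqv e nil

termᴱ : ∀ {n} → Term n → Expr n
termᴱ (var zero) = top
termᴱ (var (suc i)) = drop (termᴱ (var i))
termᴱ zer = nil
termᴱ (sc t) = bin add (termᴱ t) oneᴱ
termᴱ (t +ᵗ u) = bin add (termᴱ t) (termᴱ u)
termᴱ (t *ᵗ u) = bin mul (termᴱ t) (termᴱ u)

-- A formula is true when its expression is nonzero (junk on unbounded quantifiers).
formulaᴱ : ∀ {n} → Formula n → Expr n
formulaᴱ (t ≈ᶠ u) = bin eqv (termᴱ t) (termᴱ u)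
formulaᴱ (t <ᶠ u) = some (termᴱ u) (bin eqv top (drop (termᴱ t)))
formulaᴱ ⊥ᶠ = nil
formulaᴱ (φ ∧ᶠ ψ) = bin mul (formulaᴱ φ) (formulaᴱ ψ)
formulaᴱ (φ ∨ᶠ ψ) = bin add (formulaᴱ φ) (formulaᴱ ψ)
formulaᴱ (φ ⇒ᶠ ψ) = bin add (negᴱ (formulaᴱ φ)) (formulaᴱ ψ)
formulaᴱ (∀ᶠ φ) = nil
formulaᴱ (∃ᶠ φ) = nil
formulaᴱ (∀<ᶠ t φ) = negᴱ (some (termᴱ t) (negᴱ (formulaᴱ φ)))
formulaᴱ (∃<ᶠ t φ) = some (termᴱ t) (formulaᴱ φ)

-- A true formula may have any nonzero value. Negating twice normalises it to 1, so truth is a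
-- single claim.
truthᴱ : ∀ {n} → Δ₀F n → Expr n
truthᴱ φ = negᴱ (negᴱ (formulaᴱ (formula φ)))

envᵗ : ∀ {m n} → Subst n m → Term m
envᵗ {n = zero} σ = zer
envᵗ {n = suc n} σ = pairᵗ (σ zero) (envᵗ (λ i → σ (suc i)))

setσ : ∀ {n} → Subst 3 (4 +ℕ n)
setσ = v3 ◂ v2 ◂ v1 ◂ λ ()

-- θ(w, ⟨e, i⟩, u): below w there are z and a supported set containing the claim
-- that the formula coded by e is true at (z, i, u).
universalF : ∀ n → Δ₀F (2 +ℕ n)
universalF n = ∃̇< v0 (∃̇< (sc v2) (∃̇< (sc v3) (v4 ≐ pairᵗ v1 v0 ∧̇
  ∃̇< v3 (∃̇< v4 (∃̇< v5 (∃̇< v6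
    (v0 ≐ pairᵗ v6 (pairᵗ v4 (envᵗ (↑ 9))) ∧̇
     supportedF [ setσ ] ∧̇
     claimᵗ v5 v0 (sc zer) ∈̇ (v3 , v2 , v1))))))))

module Certificates (em : ExcludedMiddle 0ℓ) (M : Structure) (isM : IsModelIΣ₁ M) where
  open Arith em M isM
  open FinSets em M isM

  numeral-injective : ∀ m n → numeral M m ≡ numeral M n → m ≡ n
  numeral-injective zero zero e = refl
  numeral-injective zero (suc n) e = ⊥-elim (S≢0 _ (sym e))
  numeral-injective (suc m) zero e = ⊥-elim (S≢0 _ e)
  numeral-injective (suc m) (suc n) e = cong suc (numeral-injective m n (S-inj _ _ e))

  tag : Tag → A
  tag t = numeral M (tagℕ t)

  tag-injective : ∀ {t u} → tag t ≡ tag u → t ≡ u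
  tag-injective {t} {u} e = trans (sym (untag-tagℕ t)) (trans (cong untag (numeral-injective _ _ e)) (untag-tagℕ u))

  claim : A → A → A → A
  claim e s v = pair e (pair s v)

  node : Tag → A → A → A
  node t a b = pair (tag t) (pair a b)

  code : ∀ {n} → Expr n → A
  code nil = node nilT 0# 0#
  code top = node topT 0# 0#
  code (drop e) = node dropT (code e) 0#
  code (bin o e f) = node (binT o) (code e) (code f)
  code (some t e) = node someT (code t) (code e)

  env : ∀ {n} → Vec A n → A
  env [] = 0#
  env (x ∷ ρ) = pair x (env ρ)

  OpRel : Op → A → A → A → Set
  OpRel o y z v = (M ⊨ opF o v0 v1 v2) (y ∷ z ∷ v ∷ [])

  Rule : Tag → (a b s v : A) → FinSet → Set
  Rule nilT a b s v T = v ≡ 0#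
  Rule topT a b s v T = Σ A λ s' → s' < S s × s ≡ pair v s'
  Rule dropT a b s v T = Σ A λ y → y < S s × Σ A λ s' → s' < S s × s ≡ pair y s' × claim a s' v ∈ T
  Rule (binT o) a b s v T@(_ , _ , k) = Σ A λ y → y < k × Σ A λ z → z < k ×
    claim a s y ∈ T × claim b s z ∈ T × OpRel o y z v
  Rule someT a b s v T@(_ , _ , k) = Σ A λ y → y < k × claim a s y ∈ T ×
    ((v ≡ 0# × (∀ x → x < y → claim b (pair x s) 0# ∈ T)) ⊎
     (v ≡ 1# × Σ A λ x → x < y × Σ A λ u → u < k × u ≢ 0# × claim b (pair x s) u ∈ T))

  Supported : FinSet → Set
  Supported T = ∀ t a b s v → claim (node t a b) s v ∈ T → Rule t a b s v T

  -- The two sides agree by computation only when the tag is a constructor, hence the cases here and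
  -- in the next two lemmas.
  rule-supported : ∀ t {a b s v p q k} →
    (M ⊨ ruleF t v3 v2 v1 v0 (v4 , v5 , v6)) (v ∷ s ∷ b ∷ a ∷ p ∷ q ∷ k ∷ []) ≡ Rule t a b s v (p , q , k)
  rule-supported nilT = refl
  rule-supported topT = refl
  rule-supported dropT = refl
  rule-supported someT = refl
  rule-supported (binT add) = refl
  rule-supported (binT mul) = refl
  rule-supported (binT eqv) = refl

  claim-supported : ∀ t {a b s v p q k} →
    (M ⊨ claimᵗ (nodeᵗ t v3 v2) v1 v0 ∈̇ (v4 , v5 , v6)) (v ∷ s ∷ b ∷ a ∷ p ∷ q ∷ k ∷ []) ≡
    (claim (node t a b) s v ∈ (p , q , k))
  claim-supported nilT = refl
  claim-supported topT = refl
  claim-supported dropT = refl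
  claim-supported someT = refl
  claim-supported (binT add) = refl
  claim-supported (binT mul) = refl
  claim-supported (binT eqv) = refl

  rule-extension : ∀ t {a b s v x p q k} →
    (M ⊨ ruleF t v3 v2 v1 v0 (v5 , v6 , v7)) (v ∷ s ∷ b ∷ a ∷ x ∷ p ∷ q ∷ k ∷ []) ≡ Rule t a b s v (p , q , k)
  rule-extension nilT = refl
  rule-extension topT = refl
  rule-extension dropT = refl
  rule-extension someT = refl
  rule-extension (binT add) = refl
  rule-extension (binT mul) = refl
  rule-extension (binT eqv) = refl

  ⟦numᵗ⟧ : ∀ k {n} {ρ : Vec A n} → ⟦_⟧ᵗ M (numᵗ k) ρ ≡ numeral M k
  ⟦numᵗ⟧ zero = refl
  ⟦numᵗ⟧ (suc k) = cong S (⟦numᵗ⟧ k)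

  claim-parts : ∀ t a b s v → let c = claim (node t a b) s v in a ≤ c × b ≤ c × s ≤ c × v ≤ c
  claim-parts t a b s v = ≤-trans fst≤pair (≤-trans snd≤pair fst≤pair) , ≤-trans snd≤pair (≤-trans snd≤pair fst≤pair) ,
                ≤-trans fst≤pair snd≤pair , ≤-trans snd≤pair snd≤pair

  value< : ∀ {e s v T} → claim e s v ∈ T → v < proj₂ (proj₂ T)
  value< (l , _) = ≤-<-trans (≤-trans snd≤pair snd≤pair) l

  supportedF⇒ : ∀ p q k → (M ⊨ supportedF) (p ∷ q ∷ k ∷ []) → Supported (p , q , k)
  supportedF⇒ p q k F = λ t a b s v m → subst id (rule-supported t {a} {b} {s} {v} {p} {q} {k})
    (at t a (≤-<-trans (proj₁ (claim-parts t a b s v)) (proj₁ m)) b (≤-<-trans (proj₁ (proj₂ (claim-parts t a b s v))) (proj₁ m))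
       s (≤-<-trans (proj₁ (proj₂ (proj₂ (claim-parts t a b s v)))) (proj₁ m)) v (≤-<-trans (proj₂ (proj₂ (proj₂ (claim-parts t a b s v)))) (proj₁ m))
       (subst id (sym (claim-supported t {a} {b} {s} {v} {p} {q} {k})) m))
    where
    at : ∀ t → (M ⊨ supportedAt t) (p ∷ q ∷ k ∷ [])
    at nilT = proj₁ F
    at topT = proj₁ (proj₂ F)
    at dropT = proj₁ (proj₂ (proj₂ F))
    at someT = proj₁ (proj₂ (proj₂ (proj₂ F)))
    at (binT add) = proj₁ (proj₂ (proj₂ (proj₂ (proj₂ F))))
    at (binT mul) = proj₁ (proj₂ (proj₂ (proj₂ (proj₂ (proj₂ F)))))
    at (binT eqv) = proj₂ (proj₂ (proj₂ (proj₂ (proj₂ (proj₂ F)))))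

  supportedF⇐ : ∀ p q k → Supported (p , q , k) → (M ⊨ supportedF) (p ∷ q ∷ k ∷ [])
  supportedF⇐ p q k h = at nilT , at topT , at dropT , at someT , at (binT add) , at (binT mul) , at (binT eqv)
    where
    at : ∀ t → (M ⊨ supportedAt t) (p ∷ q ∷ k ∷ [])
    at t a _ b _ s _ v _ m = subst id (sym (rule-supported t {a} {b} {s} {v} {p} {q} {k})) (h t a b s v
      (subst id (claim-supported t {a} {b} {s} {v} {p} {q} {k}) m))

  infix 4 _⊆_
  _⊆_ : FinSet → FinSet → Set
  T ⊆ T' = proj₂ (proj₂ T) ≤ proj₂ (proj₂ T') × (∀ x → x ∈ T → x ∈ T')

  ⊆-trans : ∀ {T T' T''} → T ⊆ T' → T' ⊆ T'' → T ⊆ T''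
  ⊆-trans (k , f) (l , g) = ≤-trans k l , λ x m → g x (f x m)

  -- Claims occur only positively in the rules: that no x below y makes the body nonzero is
  -- expressed by claims of value 0, not by missing claims. Enlarging a set therefore never destroys
  -- a justification.
  Rule-mono : ∀ t {a b s v T T'} → T ⊆ T' → Rule t a b s v T → Rule t a b s v T'
  Rule-mono nilT i r = r
  Rule-mono topT i r = r
  Rule-mono dropT (_ , i) (y , l , s' , l' , e , m) = y , l , s' , l' , e , i _ m
  Rule-mono (binT o) (k , i) (y , l , z , l' , m , m' , r) =
    y , <-≤-trans l k , z , <-≤-trans l' k , i _ m , i _ m' , r
  Rule-mono someT (k , i) (y , l , m , inj₁ (e , f)) = y , <-≤-trans l k , i _ m , inj₁ (e , λ x l' → i _ (f x l'))
  Rule-mono someT (k , i) (y , l , m , inj₂ (e , x , l' , u , l'' , ne , m')) =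
    y , <-≤-trans l k , i _ m , inj₂ (e , x , l' , u , <-≤-trans l'' k , ne , i _ m')

  claim-injective : ∀ {x a b s v x' a' b' s' v'} → claim (pair x (pair a b)) s v ≡ claim (pair x' (pair a' b')) s' v' →
    x ≡ x' × a ≡ a' × b ≡ b' × s ≡ s' × v ≡ v'
  claim-injective e with pair-injective e
  ... | e₁ , e₂ with pair-injective e₁
  ...   | e₃ , e₄ = e₃ , proj₁ (pair-injective e₄) , proj₂ (pair-injective e₄) , proj₁ (pair-injective e₂) , proj₂ (pair-injective e₂)

  Extension : Tag → FinSet → A → Set
  Extension t T x = Σ A λ a → Σ A λ b → Σ A λ s → Σ A λ v → x ≡ claim (node t a b) s v × Rule t a b s v T

  extensionF⇒ : ∀ t {x p q k} → (M ⊨ extensionF t) (x ∷ p ∷ q ∷ k ∷ []) → x ∈ (p , q , k) ⊎ Extension t (p , q , k) x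
  extensionF⇒ t (inj₁ m) = inj₁ m
  extensionF⇒ t {x} {p} {q} {k} (inj₂ (a , _ , b , _ , s , _ , v , _ , e , r)) = inj₂ (a , b , s , v ,
    trans e (cong (λ n → claim (pair n (pair a b)) s v) (⟦numᵗ⟧ (tagℕ t) {ρ = v ∷ s ∷ b ∷ a ∷ x ∷ p ∷ q ∷ k ∷ []})) ,
    subst id (rule-extension t {a} {b} {s} {v} {x} {p} {q} {k}) r)

  rule-cong : ∀ {t t' a a' b b' s s' v v'} T → t ≡ t' → a ≡ a' × b ≡ b' × s ≡ s' × v ≡ v' →
    Rule t' a' b' s' v' T → Rule t a b s v T
  rule-cong T refl (refl , refl , refl , refl) r = r

  extension-rule : ∀ {t t' a b s v T} → Extension t T (claim (node t' a b) s v) → Rule t' a b s v T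
  extension-rule {t} {t'} {a} {b} {s} {v} {T} (a' , b' , s' , v' , e , r) =
    rule-cong T (tag-injective {t'} {t} (proj₁ parts)) (proj₂ parts) r
    where
    parts : tag t' ≡ tag t × a ≡ a' × b ≡ b' × s ≡ s' × v ≡ v'
    parts = claim-injective e

  -- K bounds the new claims that are wanted, and the height K + k leaves room for the old ones. New
  -- claims are justified by old ones, so support survives by `Rule-mono`.
  extend : ∀ t T K → Supported T → Σ FinSet λ T' → T ⊆ T' × Supported T' ×
    (∀ a b s v → claim (node t a b) s v < K → Rule t a b s v T → claim (node t a b) s v ∈ T')
  extend t T@(p , q , k) K sup = T' , T⊆T' , sup' , new
    where
    found = comprehension (extensionF t) (p ∷ q ∷ k ∷ []) (K + k)
    T' : FinSet
    T' = proj₁ found , proj₁ (proj₂ found) , K + k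
    spec : ∀ x → (x ∈ T' → x < K + k × (M ⊨ extensionF t) (x ∷ p ∷ q ∷ k ∷ [])) ×
                 (x < K + k × (M ⊨ extensionF t) (x ∷ p ∷ q ∷ k ∷ []) → x ∈ T')
    spec = proj₂ (proj₂ found)
    T⊆T' : T ⊆ T'
    T⊆T' = y≤x+y , λ x m → proj₂ (spec x) (<-≤-trans (proj₁ m) y≤x+y , inj₁ m)
    new : ∀ a b s v → claim (node t a b) s v < K → Rule t a b s v T → claim (node t a b) s v ∈ T'
    new a b s v l r = proj₂ (spec _) (<-≤-trans l x≤x+y , inj₂
      (a , ≤⇒<S (proj₁ (claim-parts t a b s v)) , b , ≤⇒<S (proj₁ (proj₂ (claim-parts t a b s v))) ,
       s , ≤⇒<S (proj₁ (proj₂ (proj₂ (claim-parts t a b s v)))) , v , ≤⇒<S (proj₂ (proj₂ (proj₂ (claim-parts t a b s v)))) ,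
       cong (λ x → claim (pair x (pair a b)) s v) (sym (⟦numᵗ⟧ (tagℕ t))) , subst id (sym (rule-extension t {a} {b} {s} {v} {_} {p} {q} {k})) r))
    sup' : Supported T'
    sup' t' a b s v m = by-cases (extensionF⇒ t (proj₂ (proj₁ (spec (claim (node t' a b) s v)) m)))
      where
      by-cases : claim (node t' a b) s v ∈ T ⊎ Extension t T (claim (node t' a b) s v) → Rule t' a b s v T'
      by-cases (inj₁ m') = Rule-mono t' {T = T} {T'} T⊆T' (sup t' a b s v m')
      by-cases (inj₂ ext) = Rule-mono t' {T = T} {T'} T⊆T' (extension-rule ext)

  -- Values of expressions; soundness and completeness of certificates.

  truth : {P : Set} → Dec P → A
  truth (yes _) = 1#
  truth (no _) = 0#

  truth-yes : ∀ {P : Set} (d : Dec P) → P → truth d ≡ 1#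
  truth-yes (yes _) _ = refl
  truth-yes (no n) p = ⊥-elim (n p)

  truth-no : ∀ {P : Set} (d : Dec P) → ¬ P → truth d ≡ 0#
  truth-no (yes p) n = ⊥-elim (n p)
  truth-no (no _) _ = refl

  truth≢0 : ∀ {P : Set} (d : Dec P) → truth d ≢ 0# → P
  truth≢0 (yes p) _ = p
  truth≢0 (no _) n = ⊥-elim (n refl)

  truth≤1 : ∀ {P : Set} (d : Dec P) → truth d ≤ 1#
  truth≤1 (yes _) = ≤-refl
  truth≤1 (no _) = 0≤

  dne : {P : Set} → ¬ ¬ P → P
  dne {P} nn with em {P = P}
  ... | yes p = p
  ... | no n = ⊥-elim (nn n)

  opVal : Op → A → A → A
  opVal add y z = y + z
  opVal mul y z = y * z
  opVal eqv y z = truth (em {P = y ≡ z})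

  val : ∀ {n} → Expr n → Vec A n → A
  val nil ρ = 0#
  val top (x ∷ ρ) = x
  val (drop e) (x ∷ ρ) = val e ρ
  val (bin o e f) ρ = opVal o (val e ρ) (val f ρ)
  val (some t e) ρ = truth (em {P = Σ A λ x → x < val t ρ × val e (x ∷ ρ) ≢ 0#})

  OpRel-sound : ∀ o {y z v} → OpRel o y z v → v ≡ opVal o y z
  OpRel-sound add r = r
  OpRel-sound mul r = r
  OpRel-sound eqv (inj₁ (e , refl)) = sym (truth-yes em e)
  OpRel-sound eqv (inj₂ (n , refl)) = sym (truth-no em n)

  OpRel-complete : ∀ o y z → OpRel o y z (opVal o y z)
  OpRel-complete add y z = refl
  OpRel-complete mul y z = refl
  OpRel-complete eqv y z with em {P = y ≡ z}
  ... | yes e = inj₁ (e , refl)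
  ... | no n = inj₂ (n , refl)

  -- A supported set may also contain claims about nonstandard codes. They do no harm, since the
  -- rule at a standard node refers only to its subexpressions.
  sound : ∀ {T} → Supported T → ∀ {n} (e : Expr n) ρ v → claim (code e) (env ρ) v ∈ T → v ≡ val e ρ
  sound sup nil ρ v m = sup nilT 0# 0# (env ρ) v m
  sound sup top (x ∷ ρ) v m =
    let s' , _ , es = sup topT 0# 0# (env (x ∷ ρ)) v m in
    sym (proj₁ (pair-injective {x} {env ρ} {v} {s'} es))
  sound {T} sup (drop e) (x ∷ ρ) v m =
    let y , _ , s' , _ , es , m' = sup dropT (code e) 0# (env (x ∷ ρ)) v m in
    sound sup e ρ v (subst (λ s → claim (code e) s v ∈ T) (sym (proj₂ (pair-injective {x} {env ρ} {y} {s'} es))) m')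
  sound sup (bin o e f) ρ v m =
    let y , _ , z , _ , my , mz , r = sup (binT o) (code e) (code f) (env ρ) v m in
    OpRel-sound o (subst₂ (λ y z → OpRel o y z v) (sound sup e ρ y my) (sound sup f ρ z mz) r)
  sound {T} sup (some t e) ρ v m =
    let y , _ , my , c = sup someT (code t) (code e) (env ρ) v m in
    cases (sound sup t ρ y my) c
    where
    cases : ∀ {y} → y ≡ val t ρ →
      (v ≡ 0# × (∀ x → x < y → claim (code e) (env (x ∷ ρ)) 0# ∈ T)) ⊎
      (v ≡ 1# × Σ A λ x → x < y × Σ A λ u → u < proj₂ (proj₂ T) × u ≢ 0# × claim (code e) (env (x ∷ ρ)) u ∈ T) →
      v ≡ val (some t e) ρ
    cases refl (inj₁ (e₀ , f)) = trans e₀ (sym (truth-no em λ { (x , l , ne) → ne (sym (sound sup e (x ∷ ρ) 0# (f x l))) }))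
    cases refl (inj₂ (e₁ , x , l , u , _ , ne , mu)) =
      trans e₁ (sym (truth-yes em (x , l , λ z → ne (trans (sound sup e (x ∷ ρ) u mu) z))))

  ≤-max : ∀ {n} {ρ : Vec A n} {B} C → All (_≤ B) ρ → All (_≤ B + C) ρ
  ≤-max C = All.map (λ l → ≤-trans l x≤x+y)

  -- The bound is uniform in the environment because the claims for all environments below B enter
  -- in one comprehension, which needs a common height.
  val-bound : ∀ {n} (e : Expr n) B → Σ A λ C → ∀ ρ → All (_≤ B) ρ → val e ρ ≤ C
  val-bound nil B = 0# , λ _ _ → ≤-refl
  val-bound top B = B , λ { (x ∷ ρ) (l ∷ _) → l }
  val-bound (drop e) B = map₂ (λ { f (x ∷ ρ) (_ ∷ ls) → f ρ ls }) (val-bound e B)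
  val-bound (bin add e f) B with val-bound e B | val-bound f B
  ... | C , g | D , h = C + D , λ ρ ls → +-mono-≤ (g ρ ls) (h ρ ls)
  val-bound (bin mul e f) B with val-bound e B | val-bound f B
  ... | C , g | D , h = C * D , λ ρ ls → *-mono-≤ (g ρ ls) (h ρ ls)
  val-bound (bin eqv e f) B = 1# , λ _ _ → truth≤1 em
  val-bound (some t e) B = 1# , λ _ _ → truth≤1 em

  env-bound : ∀ n B → Σ A λ C → ∀ (ρ : Vec A n) → All (_≤ B) ρ → env ρ ≤ C
  env-bound zero B = 0# , λ { [] _ → ≤-refl }
  env-bound (suc n) B with env-bound n B
  ... | C , f = pair B C , λ { (x ∷ ρ) (l ∷ ls) → pair-mono l (f ρ ls) }

  Contains : FinSet → ∀ {n} → Expr n → A → Set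
  Contains T e B = ∀ ρ → All (_≤ B) ρ → claim (code e) (env ρ) (val e ρ) ∈ T

  Extends : FinSet → ∀ {n} → Expr n → A → Set
  Extends T e B = Σ FinSet λ T' → T ⊆ T' × Supported T' × Contains T' e B

  private
    add-claims : ∀ t {n} (e : Expr n) {a b} → code e ≡ node t a b → ∀ B T → Supported T →
      (∀ ρ → All (_≤ B) ρ → Rule t a b (env ρ) (val e ρ) T) → Extends T e B
    add-claims t {n} e {a} {b} ce B T sup rules = T' , proj₁ (proj₂ ext) , proj₁ (proj₂ (proj₂ ext)) , has
      where
      C = proj₁ (val-bound e B)
      E = proj₁ (env-bound n B)
      ext = extend t T (S (claim (code e) E C)) sup
      T' = proj₁ ext
      has : Contains T' e B
      has ρ ls = subst (λ c → claim c (env ρ) (val e ρ) ∈ T') (sym ce)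
        (proj₂ (proj₂ (proj₂ ext)) a b (env ρ) (val e ρ)
          (≤⇒<S (pair-mono (≤-reflexive (sym ce)) (pair-mono (proj₂ (env-bound n B) ρ ls) (proj₂ (val-bound e B) ρ ls)))) (rules ρ ls))

    extends-trans : ∀ {T T' n} {e : Expr n} {B} → T ⊆ T' → Extends T' e B → Extends T e B
    extends-trans {T} {T'} i (T'' , j , r) = T'' , ⊆-trans {T} {T'} {T''} i j , r

    some-rule : ∀ {n} (t : Expr n) (e : Expr (suc n)) B C {T} → (∀ ρ → All (_≤ B) ρ → val t ρ ≤ C) →
      Contains T t B → Contains T e (B + C) →
      ∀ ρ → All (_≤ B) ρ → Rule someT (code t) (code e) (env ρ) (val (some t e) ρ) T
    some-rule t e B C {T} bd has₁ has₂ ρ ls = val t ρ , value< (has₁ ρ ls) , has₁ ρ ls , cases em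
      where
      has : ∀ x → x < val t ρ → claim (code e) (env (x ∷ ρ)) (val e (x ∷ ρ)) ∈ T
      has x l = has₂ (x ∷ ρ) (≤-trans (<⇒≤ l) (≤-trans (bd ρ ls) y≤x+y) ∷ ≤-max C ls)
      cases : Dec (Σ A λ x → x < val t ρ × val e (x ∷ ρ) ≢ 0#) →
        (val (some t e) ρ ≡ 0# × (∀ x → x < val t ρ → claim (code e) (env (x ∷ ρ)) 0# ∈ T)) ⊎
        (val (some t e) ρ ≡ 1# × Σ A λ x → x < val t ρ × Σ A λ u → u < proj₂ (proj₂ T) × u ≢ 0# × claim (code e) (env (x ∷ ρ)) u ∈ T)
      cases (yes (x , l , ne)) = inj₂ (truth-yes em (x , l , ne) , x , l , val e (x ∷ ρ) , value< (has x l) , ne , has x l)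
      cases (no n) = inj₁ (truth-no em n , λ x l →
        subst (λ v → claim (code e) (env (x ∷ ρ)) v ∈ T) (dne λ ne → n (x , l , ne)) (has x l))

  complete : ∀ {n} (e : Expr n) B T → Supported T → Extends T e B
  complete nil B T sup = add-claims nilT nil refl B T sup (λ _ _ → refl)
  complete top B T sup = add-claims topT top refl B T sup
    (λ { (x ∷ ρ) _ → env ρ , ≤⇒<S (snd≤pair {x} {env ρ}) , refl })
  complete (drop e) B T sup =
    let T₁ , i , sup₁ , has = complete e B T sup in
    extends-trans {T} {T₁} {e = drop e} i (add-claims dropT (drop e) refl B T₁ sup₁
      (λ { (x ∷ ρ) (_ ∷ ls) → x , ≤⇒<S (fst≤pair {x} {env ρ}) , env ρ , ≤⇒<S (snd≤pair {x} {env ρ}) , refl , has ρ ls }))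
  complete (bin o e f) B T sup =
    let T₁ , i₁ , sup₁ , has₁ = complete e B T sup
        T₂ , i₂ , sup₂ , has₂ = complete f B T₁ sup₁
        has₁' : Contains T₂ e B
        has₁' = λ ρ ls → proj₂ i₂ _ (has₁ ρ ls) in
    extends-trans {T} {T₂} {e = bin o e f} (⊆-trans {T} {T₁} {T₂} i₁ i₂) (add-claims (binT o) (bin o e f) refl B T₂ sup₂
      (λ ρ ls → val e ρ , value< (has₁' ρ ls) , val f ρ , value< (has₂ ρ ls) ,
         has₁' ρ ls , has₂ ρ ls , OpRel-complete o (val e ρ) (val f ρ)))
  complete (some t e) B T sup =
    let T₁ , i₁ , sup₁ , has₁ = complete t B T sup
        C , bd = val-bound t B
        -- The body is needed at environments extended by any x below the value of t, which is at
        -- most C; the bound B + C covers x and the old entries.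
        T₂ , i₂ , sup₂ , has₂ = complete e (B + C) T₁ sup₁ in
    extends-trans {T} {T₂} {e = some t e} (⊆-trans {T} {T₁} {T₂} i₁ i₂) (add-claims someT (some t e) refl B T₂ sup₂
      (some-rule t e B C {T₂} bd (λ ρ ls → proj₂ i₂ _ (has₁ ρ ls)) has₂))

  vec-bound : ∀ {n} (ρ : Vec A n) → Σ A λ B → All (_≤ B) ρ
  vec-bound [] = 0# , []
  vec-bound (x ∷ ρ) with vec-bound ρ
  ... | B , ls = B + x , y≤x+y ∷ ≤-max x ls

  -- Δ₀ formulas as expressions, and the universal formula in a model.

  termᴱ-val : ∀ {n} (t : Term n) ρ → val (termᴱ t) ρ ≡ ⟦_⟧ᵗ M t ρ
  termᴱ-val (var zero) (x ∷ ρ) = refl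
  termᴱ-val (var (suc i)) (x ∷ ρ) = termᴱ-val (var i) ρ
  termᴱ-val zer ρ = refl
  termᴱ-val (sc t) ρ = trans (cong₂ _+_ (termᴱ-val t ρ) (truth-yes em refl)) (sym (S≡+1 _))
  termᴱ-val (t +ᵗ u) ρ = cong₂ _+_ (termᴱ-val t ρ) (termᴱ-val u ρ)
  termᴱ-val (t *ᵗ u) ρ = cong₂ _*_ (termᴱ-val t ρ) (termᴱ-val u ρ)

  1≢0 : 1# ≢ 0#
  1≢0 = S≢0 0#

  negᴱ⇒ : ∀ {n} (e : Expr n) ρ → val (negᴱ e) ρ ≢ 0# → val e ρ ≡ 0#
  negᴱ⇒ e ρ = truth≢0 em

  negᴱ⇐ : ∀ {n} (e : Expr n) ρ → val e ρ ≡ 0# → val (negᴱ e) ρ ≡ 1#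
  negᴱ⇐ e ρ = truth-yes em

  ≢0 : ∀ {P : Set} (d : Dec P) → P → truth d ≢ 0#
  ≢0 d p e = 1≢0 (trans (sym (truth-yes d p)) e)

  formulaᴱ-correct : ∀ {n} {φ : Formula n} → IsΔ₀ φ → ∀ ρ →
    (val (formulaᴱ φ) ρ ≢ 0# → Sat M φ ρ) × (Sat M φ ρ → val (formulaᴱ φ) ρ ≢ 0#)
  formulaᴱ-correct (eq t u) ρ =
    (λ n → trans (sym (termᴱ-val t ρ)) (trans (truth≢0 em n) (termᴱ-val u ρ))) ,
    (λ e → ≢0 em (trans (termᴱ-val t ρ) (trans e (sym (termᴱ-val u ρ)))))
  formulaᴱ-correct (lt t u) ρ = (λ n → there (truth≢0 em n)) , (λ l → ≢0 em (back l))
    where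
    there : Σ A (λ x → x < val (termᴱ u) ρ × truth (em {P = x ≡ val (termᴱ t) ρ}) ≢ 0#) → ⟦_⟧ᵗ M t ρ < ⟦_⟧ᵗ M u ρ
    there (x , l , n) = subst₂ _<_ (trans (truth≢0 em n) (termᴱ-val t ρ)) (termᴱ-val u ρ) l
    back : ⟦_⟧ᵗ M t ρ < ⟦_⟧ᵗ M u ρ → Σ A (λ x → x < val (termᴱ u) ρ × truth (em {P = x ≡ val (termᴱ t) ρ}) ≢ 0#)
    back l = ⟦_⟧ᵗ M t ρ , subst (⟦_⟧ᵗ M t ρ <_) (sym (termᴱ-val u ρ)) l , ≢0 em (sym (termᴱ-val t ρ))
  formulaᴱ-correct bot ρ = (λ n → n refl) , λ ()
  formulaᴱ-correct (and {φ} {ψ} p q) ρ with formulaᴱ-correct p ρ | formulaᴱ-correct q ρ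
  ... | f , f' | g , g' =
    (λ n → f (λ e → n (trans (cong (_* _) e) (*-zeroˡ _))) , g (λ e → n (trans (cong (_ *_) e) (*-zero _)))) ,
    (λ { (x , y) → nonzero (f' x) (g' y) })
    where
    nonzero : ∀ {x y} → x ≢ 0# → y ≢ 0# → x * y ≢ 0#
    nonzero {x} {y} nx ny e with zero-or-suc x | zero-or-suc y
    ... | inj₁ z | _ = nx z
    ... | inj₂ _ | inj₁ z = ny z
    ... | inj₂ (x' , refl) | inj₂ (y' , refl) = S≢0 (S x' * y' + x') (trans (sym (trans (*-suc (S x') y') (+-suc (S x' * y') x'))) e)
  formulaᴱ-correct (or {φ} {ψ} p q) ρ with formulaᴱ-correct p ρ | formulaᴱ-correct q ρ
  ... | f , f' | g , g' = fwd , λ { (inj₁ x) e → f' x (x+y≡0⇒x≡0 e) ; (inj₂ y) e → g' y (x+y≡0⇒x≡0 (trans (+-comm _ _) e)) }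
    where
    fwd : val (formulaᴱ φ) ρ + val (formulaᴱ ψ) ρ ≢ 0# → Sat M φ ρ ⊎ Sat M ψ ρ
    fwd n with em {P = val (formulaᴱ φ) ρ ≡ 0#}
    ... | no nz = inj₁ (f nz)
    ... | yes z = inj₂ (g (λ z' → n (trans (cong₂ _+_ z z') (+-zero 0#))))
  formulaᴱ-correct (imp {φ} {ψ} p q) ρ with formulaᴱ-correct p ρ | formulaᴱ-correct q ρ
  ... | f , f' | g , g' = fwd , bwd
    where
    fwd : val (formulaᴱ (φ ⇒ᶠ ψ)) ρ ≢ 0# → Sat M φ ρ → Sat M ψ ρ
    fwd n x = g (λ z → n (trans (cong₂ _+_ (truth-no em (f' x)) z) (+-zero 0#)))
    bwd : (Sat M φ ρ → Sat M ψ ρ) → val (formulaᴱ (φ ⇒ᶠ ψ)) ρ ≢ 0#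
    bwd h e = 1≢0 (trans (sym (negᴱ⇐ (formulaᴱ φ) ρ (dne λ nz → g' (h (f nz)) (x+y≡0⇒x≡0 (trans (+-comm _ _) e))))) (x+y≡0⇒x≡0 e))
  formulaᴱ-correct (ball t {φ} p) ρ = fwd , bwd
    where
    fwd : val (formulaᴱ (∀<ᶠ t φ)) ρ ≢ 0# → Sat M (∀<ᶠ t φ) ρ
    fwd n x l = proj₁ (formulaᴱ-correct p (x ∷ ρ)) λ z →
      ≢0 em (x , subst (x <_) (sym (termᴱ-val t ρ)) l , ≢0 em z) (negᴱ⇒ (some (termᴱ t) (negᴱ (formulaᴱ φ))) ρ n)
    bwd : Sat M (∀<ᶠ t φ) ρ → val (formulaᴱ (∀<ᶠ t φ)) ρ ≢ 0#
    bwd h = ≢0 em (truth-no em λ { (x , l , n) →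
      proj₂ (formulaᴱ-correct p (x ∷ ρ)) (h x (subst (x <_) (termᴱ-val t ρ) l)) (negᴱ⇒ (formulaᴱ φ) (x ∷ ρ) n) })
  formulaᴱ-correct (bex t {φ} p) ρ = fwd , bwd
    where
    fwd : val (formulaᴱ (∃<ᶠ t φ)) ρ ≢ 0# → Sat M (∃<ᶠ t φ) ρ
    fwd n with truth≢0 em n
    ... | x , l , n' = x , subst (x <_) (termᴱ-val t ρ) l , proj₁ (formulaᴱ-correct p (x ∷ ρ)) n'
    bwd : Sat M (∃<ᶠ t φ) ρ → val (formulaᴱ (∃<ᶠ t φ)) ρ ≢ 0#
    bwd (x , l , s) = ≢0 em (x , subst (x <_) (sym (termᴱ-val t ρ)) l , proj₂ (formulaᴱ-correct p (x ∷ ρ)) s)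

  certificate-sound : ∀ {n} (φ : Δ₀F n) ρ {T} → Supported T →
    claim (code (truthᴱ φ)) (env ρ) 1# ∈ T → (M ⊨ φ) ρ
  certificate-sound φ ρ sup m = proj₁ (formulaᴱ-correct (bounded φ) ρ) λ z →
    1≢0 (trans (sound sup (truthᴱ φ) ρ 1# m)
      (truth-no em λ e → 1≢0 (trans (sym (negᴱ⇐ (formulaᴱ (formula φ)) ρ z)) e)))

  certificate-complete : ∀ {n} (φ : Δ₀F n) ρ → (M ⊨ φ) ρ →
    Σ FinSet λ T → Supported T × claim (code (truthᴱ φ)) (env ρ) 1# ∈ T
  certificate-complete φ ρ s =
    let T , _ , sup , has = complete (truthᴱ φ) (proj₁ (vec-bound ρ)) (0# , 0# , 0#) (λ t a b s v m → ⊥-elim (x≮0 (proj₁ m))) in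
    T , sup , subst (λ v → claim (code (truthᴱ φ)) (env ρ) v ∈ T) truth≡1 (has ρ (proj₂ (vec-bound ρ)))
    where
    truth≡1 : val (truthᴱ φ) ρ ≡ 1#
    truth≡1 = negᴱ⇐ (negᴱ (formulaᴱ (formula φ))) ρ (truth-no em (proj₂ (formulaᴱ-correct (bounded φ) ρ) s))

  ⟦envᵗ⟧ : ∀ {m n} {σ : Subst n m} {ρ} {ρ′ : Vec A n} → _⊩_↦_ M ρ σ ρ′ → ⟦_⟧ᵗ M (envᵗ σ) ρ ≡ env ρ′
  ⟦envᵗ⟧ {n = zero} {ρ′ = []} h = refl
  ⟦envᵗ⟧ {n = suc n} {ρ′ = x ∷ ρ′} h = cong₂ pair (h zero) (⟦envᵗ⟧ {ρ′ = ρ′} (λ i → h (suc i)))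

  Universal : ∀ {n} → A → A → Vec A n → Set
  Universal w x ρ = Σ A λ z → Σ A λ e → Σ A λ i → Σ FinSet λ { T@(p , q , k) →
    (z < w × p < w × q < w × k < w × env (z ∷ i ∷ ρ) < w) ×
    x ≡ pair e i × Supported T × claim e (env (z ∷ i ∷ ρ)) 1# ∈ T }

  universalF⇒ : ∀ {n} (ρ : Vec A n) {w x} → (M ⊨ universalF n) (w ∷ x ∷ ρ) → Universal w x ρ
  universalF⇒ ρ {w} {x} (z , lz , e , _ , i , _ , ee , p , lp , q , lq , k , lk , s , ls , es , sup , m) =
    z , e , i , (p , q , k) , (lz , lp , lq , lk , subst (_< w) s≡env ls) , ee ,
    supportedF⇒ p q k (sub⇒ M supportedF {setσ} {s ∷ k ∷ q ∷ p ∷ i ∷ e ∷ z ∷ w ∷ x ∷ ρ} {p ∷ q ∷ k ∷ []} (λ { zero → refl ; (suc zero) → refl ; (suc (suc zero)) → refl }) sup) ,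
    subst (λ s → claim e s 1# ∈ (p , q , k)) s≡env m
    where
    s≡env : s ≡ env (z ∷ i ∷ ρ)
    s≡env = trans es (cong (λ s → pair z (pair i s)) (⟦envᵗ⟧ {ρ′ = ρ} (λ _ → refl)))

  universalF⇐ : ∀ {n} (ρ : Vec A n) {w x} → Universal w x ρ → (M ⊨ universalF n) (w ∷ x ∷ ρ)
  universalF⇐ ρ {w} {x} (z , e , i , (p , q , k) , (lz , lp , lq , lk , ls) , ee , sup , m) =
    z , lz , e , ≤⇒<S (≤-trans (fst≤pair {e} {i}) (≤-reflexive (sym ee))) ,
    i , ≤⇒<S (≤-trans (snd≤pair {e} {i}) (≤-reflexive (sym ee))) , ee ,
    p , lp , q , lq , k , lk , env (z ∷ i ∷ ρ) , ls ,
    cong (λ s → pair z (pair i s)) (sym (⟦envᵗ⟧ {ρ′ = ρ} (λ _ → refl))) ,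
    sub⇐ M supportedF {setσ} {env (z ∷ i ∷ ρ) ∷ k ∷ q ∷ p ∷ i ∷ e ∷ z ∷ w ∷ x ∷ ρ} {p ∷ q ∷ k ∷ []} (λ { zero → refl ; (suc zero) → refl ; (suc (suc zero)) → refl }) (supportedF⇐ p q k sup) , m

  -- Because the formula itself records that z is below w, a bound on w is handed down to the
  -- witness of δ. This is how `universal-Inv` keeps witnesses below b.
  universal-sound : ∀ {n} (ρ : Vec A n) (δ : Δ₀F (2 +ℕ n)) {w i} →
    Universal w (pair (code (truthᴱ δ)) i) ρ → Σ A λ z → z < w × (M ⊨ δ) (z ∷ i ∷ ρ)
  universal-sound ρ δ {w} {i} (z , e , i' , T , (lz , _) , ee , sup , m) =
    z , lz , certificate-sound δ (z ∷ i ∷ ρ) {T} sup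
      (subst₂ (λ e i → claim e (env (z ∷ i ∷ ρ)) 1# ∈ T) (sym (proj₁ parts)) (sym (proj₂ parts)) m)
    where
    parts : code (truthᴱ δ) ≡ e × i ≡ i'
    parts = pair-injective ee

  universal-complete : ∀ {n} (ρ : Vec A n) (δ : Δ₀F (2 +ℕ n)) {z i} → (M ⊨ δ) (z ∷ i ∷ ρ) →
    Σ A λ w → Universal w (pair (code (truthᴱ δ)) i) ρ
  universal-complete ρ δ {z} {i} sat =
    let (p , q , k) , sup , m = certificate-complete δ (z ∷ i ∷ ρ) sat
        s = env (z ∷ i ∷ ρ) in
    S (z + (p + (q + (k + s)))) , z , code (truthᴱ δ) , i , (p , q , k) ,
    (≤⇒<S x≤x+y , ≤⇒<S (≤-trans x≤x+y y≤x+y) , ≤⇒<S (≤-trans x≤x+y (≤-trans y≤x+y y≤x+y)) ,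
     ≤⇒<S (≤-trans x≤x+y (≤-trans y≤x+y (≤-trans y≤x+y y≤x+y))) ,
     ≤⇒<S (≤-trans y≤x+y (≤-trans y≤x+y (≤-trans y≤x+y y≤x+y)))) , refl , sup , m

-- Exponentiation and Ackermann membership

betaF : ∀ {n} → (a b i r : Term n) → Δ₀F n
betaF a b i r = ∃̇< (sc a) (wk a ≐ (v0 *ᵗ sc (sc (wk i) *ᵗ wk b)) +ᵗ wk r ∧̇ wk r ⋖ sc (sc (wk i) *ᵗ wk b))

-- `Exp` quantifies over all v. A β-value is smaller than its modulus, so that quantifier can be
-- bounded.
expCodeF : ∀ {n} → (a b x y : Term n) → Δ₀F n
expCodeF a b x y = betaF a b zer (sc zer) ∧̇
  ∀̇< x (∀̇< (sc (sc v0 *ᵗ wk b)) (betaF (wk (wk a)) (wk (wk b)) v1 v0 ⇒̇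
    betaF (wk (wk a)) (wk (wk b)) (sc v1) (sc (sc zer) *ᵗ v0))) ∧̇
  betaF a b x y

-- `AckE` asserts that 2^x exists, so it is Σ₁ and its negation is Π₁. Where 2^x exists, digit 0 is
-- a Σ₁ substitute for the negation.
data Digit : Set where
  𝟙 𝟘 : Digit

digitF : Digit → ∀ {n} → (r p : Term n) → Δ₀F n
digitF 𝟙 r p = r ⋖ sc (sc zer) *ᵗ p ∧̇ ¬̇ (r ⋖ p)
digitF 𝟘 r p = r ⋖ p

-- The x-th binary digit of y is e, with the exponential table for 2^x below w.
ackF : Digit → ∀ {n} → (w x y : Term n) → Δ₀F n
ackF e w x y = ∃̇< w (∃̇< (wk w) (∃̇< (wk (wk w)) (expCodeF v2 v1 (wk (wk (wk x))) v0 ∧̇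
  ∃̇< (sc (wk (wk (wk y)))) (∃̇< (sc (wk (wk (wk (wk y)))))
    (wk (wk (wk (wk (wk y)))) ≐ (v1 *ᵗ (sc (sc zer) *ᵗ v2)) +ᵗ v0 ∧̇ digitF e v0 v2)))))

expDomF : ∀ {n} → (w x : Term n) → Δ₀F n
expDomF w x = ∃̇< w (∃̇< (wk w) (∃̇< (wk (wk w)) (expCodeF v2 v1 (wk (wk (wk x))) v0)))

module Exponentials (em : ExcludedMiddle 0ℓ) (M : Structure) (isM : IsModelIΣ₁ M) where
  open Arith em M isM

  -- The induction is on j, for a common bound on the witnesses of all x below j. The disjunct that
  -- k is below j makes the step hold beyond k, where `h` says nothing; similar guards recur in the
  -- inductions along tables.
  collection : ∀ {n} (θ : Δ₀F (2 +ℕ n)) ρ k → (∀ x → x < k → Σ A λ w → (M ⊨ θ) (w ∷ x ∷ ρ)) →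
    Σ A λ W → ∀ x → x < k → Σ A λ w → w < W × (M ⊨ θ) (w ∷ x ∷ ρ)
  collection {n} θ ρ k h = finish (ind₁ (v2 ⋖ v1 ∨̇ ∀̇< v1 (∃̇< v1 (θ [ σ ]))) (k ∷ ρ) (0# , inj₂ λ x l → ⊥-elim (x≮0 l)) step k)
    where
    σ : Subst (2 +ℕ n) (5 +ℕ n)
    σ = v0 ◂ v1 ◂ ↑ 5
    P : A → A → Set
    P j W = k < j ⊎ (∀ x → x < j → Σ A λ w → w < W × (M ⊨ θ [ σ ]) (w ∷ x ∷ W ∷ j ∷ k ∷ ρ))
    into : ∀ {w x W j} → (M ⊨ θ) (w ∷ x ∷ ρ) → (M ⊨ θ [ σ ]) (w ∷ x ∷ W ∷ j ∷ k ∷ ρ)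
    into = sub⇐ M θ (λ { zero → refl ; (suc zero) → refl ; (suc (suc i)) → refl })
    out : ∀ {w x W j} → (M ⊨ θ [ σ ]) (w ∷ x ∷ W ∷ j ∷ k ∷ ρ) → (M ⊨ θ) (w ∷ x ∷ ρ)
    out = sub⇒ M θ (λ { zero → refl ; (suc zero) → refl ; (suc (suc i)) → refl })
    finish : Σ A (P k) → Σ A λ W → ∀ x → x < k → Σ A λ w → w < W × (M ⊨ θ) (w ∷ x ∷ ρ)
    finish (W , inj₁ l) = ⊥-elim (<-irrefl l)
    finish (W , inj₂ f) = W , λ x l → let w , l' , s = f x l in w , l' , out {w} {x} {W} {k} s
    step : ∀ j → Σ A (P j) → Σ A (P (S j))
    step j (W , inj₁ l) = W , inj₁ (<-trans l x<Sx)
    step j (W , inj₂ f) with ≤⊎> k j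
    ... | inj₁ l = W , inj₁ (≤⇒<S l)
    ... | inj₂ l = W + S w , inj₂ g
      where
      w = proj₁ (h j l)
      g : ∀ x → x < S j → Σ A λ w' → w' < W + S w × (M ⊨ θ [ σ ]) (w' ∷ x ∷ W + S w ∷ S j ∷ k ∷ ρ)
      g x l' with ≤⇒≡⊎< (<S⇒≤ l')
      ... | inj₁ refl = w , <-≤-trans x<Sx y≤x+y , into (proj₂ (h j l))
      ... | inj₂ l'' = let w' , lw , s = f x l'' in w' , <-≤-trans lw x≤x+y , into (out {w'} {x} {W} {j} s)

  BetaB : A → A → A → A → Set
  BetaB a b i r = (M ⊨ betaF v0 v1 v2 v3) (a ∷ b ∷ i ∷ r ∷ [])

  β⇒ : ∀ {a b i r} → BetaB a b i r → Beta M a b i r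
  β⇒ (q , _ , e , l) = q , e , l

  β⇐ : ∀ {a b i r} → Beta M a b i r → BetaB a b i r
  β⇐ (q , e , l) = q , ≤⇒<S (≤-trans (x≤x*y 0<S) (≤-trans x≤x+y (≤-reflexive (sym e)))) , e , l

  beta-unique : ∀ {a b i r r'} → Beta M a b i r → Beta M a b i r' → r ≡ r'
  beta-unique (q , x) (q' , x') = proj₂ (divMod-unique x x')

  β : A → A → A → A
  β a b i = proj₁ (proj₂ (divMod a (S (S i * b)) 0<S))

  β-Beta : ∀ a b i → Beta M a b i (β a b i)
  β-Beta a b i = proj₁ (divMod a (S (S i * b)) 0<S) , proj₂ (proj₂ (divMod a (S (S i * b)) 0<S))

  ExpCode : A → A → A → A → Set
  ExpCode a b x y = Beta M a b 0# 1# ×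
    ((i : A) → i < x → (v : A) → Beta M a b i v → Beta M a b (S i) (2# * v)) × Beta M a b x y

  ExpCodeB : A → A → A → A → Set
  ExpCodeB a b x y = (M ⊨ expCodeF v0 v1 v2 v3) (a ∷ b ∷ x ∷ y ∷ [])

  expCode⇒ : ∀ {a b x y} → ExpCodeB a b x y → ExpCode a b x y
  expCode⇒ {a} {b} {x} {y} (s , f , e) = β⇒ {a} {b} {0#} {1#} s ,
    (λ i l v bv → β⇒ {a} {b} {S i} {2# * v} (f i l v (proj₂ (proj₂ bv)) (β⇐ {a} {b} {i} {v} bv))) , β⇒ {a} {b} {x} {y} e

  expCode⇐ : ∀ {a b x y} → ExpCode a b x y → ExpCodeB a b x y
  expCode⇐ {a} {b} {x} {y} (s , f , e) = β⇐ {a} {b} {0#} {1#} s ,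
    (λ i l v _ bv → β⇐ {a} {b} {S i} {2# * v} (f i l v (β⇒ {a} {b} {i} {v} bv))) , β⇐ {a} {b} {x} {y} e

  -- The β-table that certifies one power 2^m contains every 2^i with i up to m.
  module Table {a b m y : A} (code : ExpCode a b m y) where
    E : A → A
    E = β a b

    E-suc : ∀ {i} → i < m → E (S i) ≡ 2# * E i
    E-suc {i} l = beta-unique {a} {b} {S i} (β-Beta a b (S i)) (proj₁ (proj₂ code) i l (E i) (β-Beta a b i))

    Exp-E : ∀ {i} → i ≤ m → Exp M i (E i)
    Exp-E {i} l = a , b , proj₁ code , (λ i' l' → proj₁ (proj₂ code) i' (<-≤-trans l' l)) , β-Beta a b i

    E-end : E m ≡ y
    E-end = beta-unique {a} {b} {m} (β-Beta a b m) (proj₂ (proj₂ code))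

    -- The second bound will close I under multiplication. The factor 2 is there because i² exceeds
    -- 2^i at i = 3.
    E-growth : ∀ i → i ≤ m → i < E i × i * i ≤ 2# * E i
    E-growth i i≤m = finish (ind₁ (v2 ⋖ v1 ∨̇ (betaF v3 v4 v1 v0 ∧̇ v1 ⋖ v0 ∧̇ v1 *ᵗ v1 ⋖ sc (sc (sc zer) *ᵗ v0))) (m ∷ a ∷ b ∷ [])
        (1# , inj₂ (β⇐ {a} {b} {0#} {1#} (proj₁ code) , 0<S , ≤⇒<S (≤-trans (≤-reflexive (*-zero 0#)) 0≤))) step i)
      where
      P : A → A → Set
      P i v = m < i ⊎ (BetaB a b i v × i < v × i * i < S (2# * v))
      finish : Σ A (P i) → i < E i × i * i ≤ 2# * E i
      finish (v , inj₁ l) = ⊥-elim (≤⇒≯ i≤m l)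
      finish (v , inj₂ (bv , l , l')) = subst (λ v → i < v × i * i ≤ 2# * v)
        (beta-unique {a} {b} {i} (β⇒ {a} {b} {i} {v} bv) (β-Beta a b i)) (l , <S⇒≤ l')
      double : ∀ v → v + v ≡ 2# * v
      double v = sym (trans (*-sucˡ 1# v) (cong (_+ v) (*-identityˡ v)))
      step : ∀ i → Σ A (P i) → Σ A (P (S i))
      step i (v , inj₁ l) = v , inj₁ (<-trans l x<Sx)
      step i (v , inj₂ (bv , l , l')) with ≤⊎> m i
      ... | inj₁ l = v , inj₁ (≤⇒<S l)
      ... | inj₂ i<m = 2# * v , inj₂ (β⇐ {a} {b} {S i} {2# * v} (proj₁ (proj₂ code) i i<m v (β⇒ {a} {b} {i} {v} bv)) ,
          <-≤-trans (≤-<-trans (<⇒S≤ l) (≤-<-trans (≤-reflexive (sym (+-identityˡ v))) (+-mono-<-≤ v>0 (≤-refl {v})))) (≤-reflexive (double v)) ,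
          -- (i + 1)² = i² + i + (i + 1) ≤ 2v + v + v = 2(2v).
          ≤⇒<S (≤-trans (≤-reflexive sq) (≤-trans (+-mono-≤ (<S⇒≤ l') (+-mono-≤ (<⇒≤ l) (<⇒S≤ l)))
            (≤-trans (+-mono-≤ (≤-refl {2# * v}) (≤-reflexive (double v))) (≤-reflexive (double (2# * v)))))))
        where
        v>0 : 0# < v
        v>0 = ≤-<-trans 0≤ l
        sq : S i * S i ≡ i * i + (i + S i)
        sq = trans (*-sucˡ i (S i)) (trans (cong (_+ S i) (*-suc i i)) (+-assoc (i * i) i (S i)))

    E-pos : ∀ {i} → i ≤ m → 0# < E i
    E-pos {i} l = ≤-<-trans 0≤ (proj₁ (E-growth i l))

    E-divides : ∀ {i j} → i < j → j ≤ m → Σ A λ h → E j ≡ 2# * E i * h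
    E-divides {i} {j} i<j j≤m = finish (ind₂ ((v3 ⋖ v2 ∨̇ v2 ⋖ sc v6) ∨̇ (betaF v4 v5 v2 v1 ∧̇ v1 ≐ (sc (sc zer) *ᵗ v7) *ᵗ v0)) (m ∷ a ∷ b ∷ i ∷ E i ∷ [])
        (0# , 0# , inj₁ (inj₂ 0<S)) step j)
      where
      P : A → A → A → Set
      P j v h = (m < j ⊎ j < S i) ⊎ (BetaB a b j v × v ≡ 2# * E i * h)
      finish : Σ A (λ v → Σ A (P j v)) → Σ A λ h → E j ≡ 2# * E i * h
      finish (v , h , inj₁ (inj₁ l)) = ⊥-elim (≤⇒≯ j≤m l)
      finish (v , h , inj₁ (inj₂ l)) = ⊥-elim (≤⇒≯ (<S⇒≤ l) i<j)
      finish (v , h , inj₂ (bv , e)) = h , trans (beta-unique {a} {b} {j} (β-Beta a b j) (β⇒ {a} {b} {j} {v} bv)) e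
      step : ∀ j → Σ A (λ v → Σ A (P j v)) → Σ A (λ v → Σ A (P (S j) v))
      step j (v , h , p) with ≤⊎> m j
      ... | inj₁ l = v , h , inj₁ (inj₁ (≤⇒<S l))
      ... | inj₂ j<m with <-cmp j i
      ...   | inj₁ l = v , h , inj₁ (inj₂ (≤⇒<S (<⇒S≤ l)))
      ...   | inj₂ (inj₁ refl) = E (S i) , 1# , inj₂ (β⇐ {a} {b} {S i} {E (S i)} (β-Beta a b (S i)) , trans (E-suc j<m) (sym (*-identityʳ _)))
      ...   | inj₂ (inj₂ l) with p
      ...     | inj₁ (inj₁ l') = ⊥-elim (<-irrefl (<-trans l' j<m))
      ...     | inj₁ (inj₂ l') = ⊥-elim (≤⇒≯ (<S⇒≤ l') l)
      ...     | inj₂ (bv , e) = E (S j) , 2# * h , inj₂ (β⇐ {a} {b} {S j} {E (S j)} (β-Beta a b (S j)) ,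
                trans (E-suc j<m) (trans (cong (2# *_) (trans (beta-unique {a} {b} {j} (β-Beta a b j) (β⇒ {a} {b} {j} {v} bv)) e))
                  (solve 3 (λ t u h → t :* (t :* u :* h) := t :* u :* (t :* h)) refl 2# (E i) h)))

  -- The two tables may have different codes; an induction along both finds a common value at every
  -- i up to x.
  Exp-unique : ∀ {x y y'} → Exp M x y → Exp M x y' → y ≡ y'
  Exp-unique {x} {y} {y'} (a , b , c) (a' , b' , c') =
    finish (ind₁ (v2 ⋖ v1 ∨̇ (betaF v3 v4 v1 v0 ∧̇ betaF v5 v6 v1 v0)) (x ∷ a ∷ b ∷ a' ∷ b' ∷ [])
      (1# , inj₂ (β⇐ {a} {b} {0#} {1#} (proj₁ c) , β⇐ {a'} {b'} {0#} {1#} (proj₁ c'))) step x)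
    where
    P : A → A → Set
    P i v = x < i ⊎ (BetaB a b i v × BetaB a' b' i v)
    finish : Σ A (P x) → y ≡ y'
    finish (v , inj₁ l) = ⊥-elim (<-irrefl l)
    finish (v , inj₂ (l , r)) = trans (beta-unique {a} {b} {x} (proj₂ (proj₂ c)) (β⇒ {a} {b} {x} {v} l))
                                      (beta-unique {a'} {b'} {x} (β⇒ {a'} {b'} {x} {v} r) (proj₂ (proj₂ c')))
    step : ∀ i → Σ A (P i) → Σ A (P (S i))
    step i (v , inj₁ l) = v , inj₁ (<-trans l x<Sx)
    step i (v , inj₂ (l , r)) with ≤⊎> x i
    ... | inj₁ l' = v , inj₁ (≤⇒<S l')
    ... | inj₂ i<x = 2# * v , inj₂ (β⇐ {a} {b} {S i} {2# * v} (proj₁ (proj₂ c) i i<x v (β⇒ {a} {b} {i} {v} l)) ,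
                                    β⇐ {a'} {b'} {S i} {2# * v} (proj₁ (proj₂ c') i i<x v (β⇒ {a'} {b'} {i} {v} r)))

  Dom : A → Set
  Dom x = Σ A λ y → Exp M x y

  Dom-≤ : ∀ {x y} → x ≤ y → Dom y → Dom x
  Dom-≤ {x} l (y , a , b , c) = Table.E c x , Table.Exp-E c l

  DigitRel : Digit → A → A → Set
  DigitRel e r p = (M ⊨ digitF e v0 v1) (r ∷ p ∷ [])

  Ack : Digit → A → A → Set
  Ack e x y = Σ A λ p → Exp M x p × Σ A λ q → Σ A λ r → y ≡ q * (2# * p) + r × DigitRel e r p

  2*-double : ∀ v → 2# * v ≡ v + v
  2*-double v = trans (*-sucˡ 1# v) (cong (_+ v) (*-identityˡ v))

  Exp-pos : ∀ {x p} → Exp M x p → 0# < p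
  Exp-pos (_ , _ , c) = subst (0# <_) (Table.E-end c) (Table.E-pos c ≤-refl)

  x≤2*x : ∀ {x} → x ≤ 2# * x
  x≤2*x {x} = ≤-trans x≤x+y (≤-reflexive (sym (2*-double x)))

  Ack-exclusive : ∀ {x y} → Ack 𝟙 x y → ¬ Ack 𝟘 x y
  Ack-exclusive {x} {y} (p , ep , q , r , e , l , n) (p' , ep' , q' , r' , e' , l') = absurd (Exp-unique ep' ep) e' l'
    where
    absurd : ∀ {p'} → p' ≡ p → y ≡ q' * (2# * p') + r' → r' < p' → ⊥
    absurd refl e' l' = n (subst (_< p) (sym (proj₂ (divMod-unique {d = 2# * p} {q} {r} {q'} {r'} (e , l) (e' , <-≤-trans l' x≤2*x)))) l')

  Ack-total : ∀ {x} y → Dom x → Ack 𝟙 x y ⊎ Ack 𝟘 x y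
  Ack-total {x} y (p , ep) = cases (divMod y (2# * p) (<-≤-trans (Exp-pos ep) x≤2*x)) em
    where
    cases : (Σ A λ q → Σ A λ r → DivMod y (2# * p) q r) → (∀ {P} → Dec P) → Ack 𝟙 x y ⊎ Ack 𝟘 x y
    cases (q , r , e , l) d with d {r < p}
    ... | yes r<p = inj₂ (p , ep , q , r , e , r<p)
    ... | no n = inj₁ (p , ep , q , r , e , l , n)

  AckB : Digit → A → A → A → Set
  AckB e w x y = (M ⊨ ackF e v0 v1 v2) (w ∷ x ∷ y ∷ [])

  ackF⇒ : ∀ e {w x y} → AckB e w x y → Ack e x y
  ackF⇒ 𝟙 {w} {x} {y} (a , _ , b , _ , p , _ , c , q , _ , r , _ , d) = p , (a , b , expCode⇒ {a} {b} {x} {p} c) , q , r , d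
  ackF⇒ 𝟘 {w} {x} {y} (a , _ , b , _ , p , _ , c , q , _ , r , _ , d) = p , (a , b , expCode⇒ {a} {b} {x} {p} c) , q , r , d

  ackF⇐ : ∀ e {x y} → Ack e x y → Σ A λ w → AckB e w x y
  ackF⇐ e {x} {y} (p , (a , b , c) , q , r , ey , d) = S (a + (b + p)) , bound e d
    where
    q≤y : q ≤ y
    q≤y = ≤-trans (x≤x*y (<-≤-trans (Exp-pos (a , b , c)) x≤2*x)) (≤-trans x≤x+y (≤-reflexive (sym ey)))
    bound : ∀ e → DigitRel e r p → AckB e (S (a + (b + p))) x y
    bound 𝟙 d = a , ≤⇒<S x≤x+y , b , ≤⇒<S (≤-trans x≤x+y y≤x+y) , p , ≤⇒<S (≤-trans y≤x+y y≤x+y) ,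
      expCode⇐ {a} {b} {x} {p} c , q , ≤⇒<S q≤y , r , ≤⇒<S (≤-trans y≤x+y (≤-reflexive (sym ey))) , ey , d
    bound 𝟘 d = a , ≤⇒<S x≤x+y , b , ≤⇒<S (≤-trans x≤x+y y≤x+y) , p , ≤⇒<S (≤-trans y≤x+y y≤x+y) ,
      expCode⇐ {a} {b} {x} {p} c , q , ≤⇒<S q≤y , r , ≤⇒<S (≤-trans y≤x+y (≤-reflexive (sym ey))) , ey , d

  ExpDomB : A → A → Set
  ExpDomB w x = (M ⊨ expDomF v0 v1) (w ∷ x ∷ [])

  expDomF⇒ : ∀ {w x} → ExpDomB w x → Dom x
  expDomF⇒ {w} {x} (a , _ , b , _ , p , _ , c) = p , a , b , expCode⇒ {a} {b} {x} {p} c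

  expDomF⇐ : ∀ {x} → Dom x → Σ A λ w → ExpDomB w x
  expDomF⇐ {x} (p , a , b , c) = S (a + (b + p)) ,
    a , ≤⇒<S x≤x+y , b , ≤⇒<S (≤-trans x≤x+y y≤x+y) , p , ≤⇒<S (≤-trans y≤x+y y≤x+y) , expCode⇐ {a} {b} {x} {p} c

  -- For i below k, 2^k is a multiple of 2^(i+1), so adding multiples of it leaves digit i alone.
  Ack-mod : ∀ e {i k P d q r} → Exp M k P → i < k → d ≡ q * P + r → Ack e i r → Ack e i d
  Ack-mod e {i} {k} {P} {d} {q} {r} (a , b , c) i<k ed (p , ep , q' , r' , er , dig) =
    p , ep , q * h + q' , r' , trans ed (trans (cong₂ (λ P r → q * P + r) P≡ er)
      (solve 6 (λ q t p h q' r' → q :* (t :* p :* h) :+ (q' :* (t :* p) :+ r') := (q :* h :+ q') :* (t :* p) :+ r') refl q 2# p h q' r')) , dig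
    where
    module T = Table c
    div = T.E-divides i<k ≤-refl
    h = proj₁ div
    P≡ : P ≡ 2# * p * h
    P≡ = trans (sym T.E-end) (trans (proj₂ div) (cong (λ p → 2# * p * h) (Exp-unique (T.Exp-E (<⇒≤ i<k)) ep)))

  Ack-𝟙 : ∀ {x y} → Dom x → ¬ Ack 𝟘 x y → Ack 𝟙 x y
  Ack-𝟙 {x} {y} d n = [ id , (λ m → ⊥-elim (n m)) ]′ (Ack-total {x} y d)

  Ack-mod⁻ : ∀ {i k P d q r} → Exp M k P → i < k → d ≡ q * P + r → Ack 𝟙 i d → Ack 𝟙 i r
  Ack-mod⁻ {i} {k} {P} {d} {q} {r} ep i<k ed m = Ack-𝟙 {i} {r} (Dom-≤ (<⇒≤ i<k) (P , ep))
    λ n → Ack-exclusive {i} {d} m (Ack-mod 𝟘 {i} {k} {P} {d} {q} {r} ep i<k ed n)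

-- Σ₁ comprehension for Ackermann sets

module AckermannSets (em : ExcludedMiddle 0ℓ) (M : Structure) (isM : IsModelIΣ₁ M) where
  open Arith em M isM
  open Exponentials em M isM
  open Certificates em M isM using (dne)

  -- Read u as 2^i and 2uh as a higher power of two: if digit i of r is 0, then adding 2^i does not
  -- carry past that power, because r + u stays below (q + 1)2u and q is below h.
  bit-room : ∀ u h {r} q r' → r ≡ q * (2# * u) + r' → r' < u → r < 2# * u * h → r + u < 2# * u * h
  bit-room u h {r} q r' e l l' = <-≤-trans
    (≤-<-trans (≤-reflexive (trans (cong (_+ u) e) (+-assoc _ r' u)))
      (+-mono-≤-< (≤-refl {q * (2# * u)}) (+-mono-<-≤ l (≤-refl {u}))))
    (≤-trans (≤-reflexive (trans (cong (q * (2# * u) +_) (sym (2*-double u)))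
       (trans (sym (*-sucˡ q (2# * u))) (*-comm (S q) (2# * u))))) (*-monoʳ-≤ (2# * u) (<⇒S≤ q<h)))
    where
    q<h : q < h
    q<h = *-cancel-< (2# * u) (≤-<-trans (≤-trans (≤-reflexive (*-comm (2# * u) q)) (≤-trans x≤x+y (≤-reflexive (sym e)))) l')

  module Bits {a b m y : A} (code : ExpCode a b m y) where
    open Table code

    -- Digit 0 read off the fixed table. It is Δ₀ in the parameters a and b, whereas `Ack` brings a
    -- table of its own as a witness.
    CoBit : A → A → Set
    CoBit i d = Σ A λ q → Σ A λ r → d ≡ q * (2# * E i) + r × r < E i

    cobit⇒ : ∀ {i d} → i ≤ m → CoBit i d → Ack 𝟘 i d
    cobit⇒ {i} l c = E i , Exp-E l , c

    cobit⇐ : ∀ {i d} → i ≤ m → Ack 𝟘 i d → CoBit i d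
    cobit⇐ {i} {d} l (p , ep , c) = subst (λ p → Σ A λ q → Σ A λ r → d ≡ q * (2# * p) + r × r < p) (Exp-unique ep (Exp-E l)) c

    -- Adding 2^i where digit i is 0 causes no carry. For j below i it adds a multiple of 2^(j+1);
    -- for j above i the remainder below 2^j has room for 2^i by `bit-room`.
    cobit-add : ∀ {i j d} → i < m → j < m → i ≢ j → CoBit i d → CoBit j d → CoBit j (d + E i)
    cobit-add {i} {j} {d} i<m j<m ne (q' , r' , e' , l') (q , r , e , l) = [ above , [ (λ e → ⊥-elim (ne e)) , below ]′ ]′ (<-cmp i j)
      where
      below : j < i → CoBit j (d + E i)
      below j<i = let h , eh = E-divides j<i (<⇒≤ i<m) in
        q + h , r , trans (cong₂ _+_ e eh)
          (solve 5 (λ q t u r h → q :* (t :* u) :+ r :+ t :* u :* h := (q :+ h) :* (t :* u) :+ r) refl q 2# (E j) r h) , l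
      above : i < j → CoBit j (d + E i)
      above i<j = q , r + E i , trans (cong (_+ E i) e) (+-assoc _ r (E i)) ,
        subst (r + E i <_) (sym eh) (bit-room (E i) h q″ r″ er (subst (_< E i) (sym same) l') (subst (r <_) eh l))
        where
        h = proj₁ (E-divides i<j (<⇒≤ j<m))
        eh = proj₂ (E-divides i<j (<⇒≤ j<m))
        dm = divMod r (2# * E i) (<-≤-trans (E-pos (<⇒≤ i<m)) x≤2*x)
        q″ = proj₁ dm
        r″ = proj₁ (proj₂ dm)
        er : r ≡ q″ * (2# * E i) + r″
        er = proj₁ (proj₂ (proj₂ dm))
        -- Dividing d by 2^(i+1) directly, or after first reducing it modulo 2^(j+1), leaves the
        -- same remainder, so r also has digit 0 at i.
        d≡ : d ≡ (q * (2# * h) + q″) * (2# * E i) + r″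
        d≡ = trans e (trans (cong₂ (λ u r → q * (2# * u) + r) eh er)
          (solve 6 (λ q t u h q″ r″ → q :* (t :* (t :* u :* h)) :+ (q″ :* (t :* u) :+ r″) := (q :* (t :* h) :+ q″) :* (t :* u) :+ r″)
            refl q 2# (E i) h q″ r″))
        same : r″ ≡ r'
        same = proj₂ (divMod-unique {d = 2# * E i} (d≡ , proj₂ (proj₂ (proj₂ dm))) (e' , <-≤-trans l' x≤2*x))

  last-true : ∀ {P : A → Set} → ((∀ x → P x → P (S x)) → ∀ x → P x) → ∀ {y} → ¬ P y → Σ A λ x → P x × ¬ P (S x)
  last-true {P} ind {y} n = dne λ none → n (ind (λ x px → dne λ nsx → none (x , px , nsx)) y)

  -- The greatest d below 2^m all of whose digits 1 satisfy the predicate has digit 1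
  -- exactly where the predicate holds, since adding 2^i would give a larger one.
  ack-comprehension : ∀ {n} (θ : Δ₀F (2 +ℕ n)) ρ m → Dom m →
    Σ A λ d → ∀ i → i < m → (AckE M i d → Σ A λ w → (M ⊨ θ) (w ∷ i ∷ ρ)) × ((Σ A λ w → (M ⊨ θ) (w ∷ i ∷ ρ)) → AckE M i d)
  ack-comprehension {n} θ ρ m (y , a , b , code) = from-greatest greatest
    where
    open Table code
    open Bits code
    σ : Subst (2 +ℕ n) (9 +ℕ n)
    σ = v0 ◂ v1 ◂ ↑ 9
    -- One bound W for all witnesses makes the condition on the digits Δ₀, so that P is Σ₁ and its
    -- induction is available.
    Good : A → A → Set
    Good d W = ∀ i → i < m → CoBit i d ⊎ Σ A λ w → w < W × (M ⊨ θ) (w ∷ i ∷ ρ)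
    P : A → Set
    P k = Σ A λ d → Σ A λ W → k < S d × d < E m × Good d W
    cobitF : Δ₀F (8 +ℕ n)
    cobitF = ∃̇< (sc v5) (betaF v6 v7 v1 v0 ∧̇ ∃̇< (sc v3) (∃̇< (sc v4) (v5 ≐ (v1 *ᵗ (sc (sc zer) *ᵗ v2)) +ᵗ v0 ∧̇ v0 ⋖ v2)))
    F : Δ₀F (7 +ℕ n)
    F = v2 ⋖ sc v1 ∧̇ v1 ⋖ v6 ∧̇ ∀̇< v3 (cobitF ∨̇ ∃̇< v1 (θ [ σ ]))
    PF : A → Set
    PF k = Σ A λ d → Σ A λ W → (M ⊨ F) (W ∷ d ∷ k ∷ m ∷ a ∷ b ∷ E m ∷ ρ)
    cobitF⇒ : ∀ {i W d k} → (M ⊨ cobitF) (i ∷ W ∷ d ∷ k ∷ m ∷ a ∷ b ∷ E m ∷ ρ) → CoBit i d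
    cobitF⇒ {i} {W} {d} (u , _ , bu , q , _ , r , _ , e , l) =
      subst (λ u → Σ A λ q → Σ A λ r → d ≡ q * (2# * u) + r × r < u)
        (beta-unique {a} {b} {i} (β⇒ {a} {b} {i} {u} bu) (β-Beta a b i)) (q , r , e , l)
    cobitF⇐ : ∀ {i W d k} → i < m → CoBit i d → (M ⊨ cobitF) (i ∷ W ∷ d ∷ k ∷ m ∷ a ∷ b ∷ E m ∷ ρ)
    cobitF⇐ {i} l (q , r , e , l') = E i , ≤⇒<S (≤-trans y≤x+y (≤-reflexive (sym (proj₁ (proj₂ (β-Beta a b i)))))) ,
      β⇐ {a} {b} {i} {E i} (β-Beta a b i) ,
      q , ≤⇒<S (≤-trans (x≤x*y (<-≤-trans (E-pos (<⇒≤ l)) x≤2*x)) (≤-trans x≤x+y (≤-reflexive (sym e)))) ,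
      r , ≤⇒<S (≤-trans y≤x+y (≤-reflexive (sym e))) , e , l'
    into : ∀ {k} → PF k → P k
    into {k} (d , W , l , l' , f) = d , W , l , l' , λ i li →
      [ (λ c → inj₁ (cobitF⇒ {i} {W} {d} {k} c)) ,
        (λ { (w , lw , s) → inj₂ (w , lw , sub⇒ M θ {σ} {w ∷ i ∷ W ∷ d ∷ k ∷ m ∷ a ∷ b ∷ E m ∷ ρ} {w ∷ i ∷ ρ} (λ { zero → refl ; (suc zero) → refl ; (suc (suc i)) → refl }) s) }) ]′ (f i li)
    out : ∀ {k} → P k → PF k
    out {k} (d , W , l , l' , f) = d , W , l , l' , λ i li →
      [ (λ c → inj₁ (cobitF⇐ {i} {W} {d} {k} li c)) ,
        (λ { (w , lw , s) → inj₂ (w , lw , sub⇐ M θ {σ} {w ∷ i ∷ W ∷ d ∷ k ∷ m ∷ a ∷ b ∷ E m ∷ ρ} {w ∷ i ∷ ρ} (λ { zero → refl ; (suc zero) → refl ; (suc (suc i)) → refl }) s) }) ]′ (f i li)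
    P-zero : P 0#
    P-zero = 0# , 0# , 0<S , E-pos ≤-refl , λ i l → inj₁ (0# , 0# , sym (trans (+-zero _) (*-zeroˡ _)) , E-pos (<⇒≤ l))
    induction : (∀ x → P x → P (S x)) → ∀ x → P x
    induction step x = into (ind₂ F (m ∷ a ∷ b ∷ E m ∷ ρ) (out P-zero) (λ x p → out (step x (into p))) x)
    greatest : Σ A λ k → P k × ¬ P (S k)
    greatest = last-true induction {E m} λ { (d , _ , l , l' , _) → ≤⇒≯ (<S⇒≤ l) l' }
    from-greatest : (Σ A λ k → P k × ¬ P (S k)) → Σ A λ d → ∀ i → i < m →
      (AckE M i d → Σ A λ w → (M ⊨ θ) (w ∷ i ∷ ρ)) × ((Σ A λ w → (M ⊨ θ) (w ∷ i ∷ ρ)) → AckE M i d)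
    from-greatest (k , (d , W , k≤d , d<Em , good) , maximal) = d , λ i l → only i l , all i l
      where
      only : ∀ i → i < m → AckE M i d → Σ A λ w → (M ⊨ θ) (w ∷ i ∷ ρ)
      only i l x = [ (λ c → ⊥-elim (Ack-exclusive {i} {d} x (cobit⇒ (<⇒≤ l) c))) , (λ { (w , _ , s) → w , s }) ]′ (good i l)
      all : ∀ i → i < m → (Σ A λ w → (M ⊨ θ) (w ∷ i ∷ ρ)) → AckE M i d
      all i l (w , s) = Ack-𝟙 {i} {d} (E i , Exp-E (<⇒≤ l)) λ n → larger (cobit⇐ {i} {d} (<⇒≤ l) n)
        where
        larger : ¬ CoBit i d
        larger c = maximal (d + E i , W + S w , ≤⇒<S (≤-trans (S≤S (<S⇒≤ k≤d)) (<⇒S≤ (≤-<-trans (≤-reflexive (sym (+-zero d))) (+-mono-≤-< (≤-refl {d}) (E-pos (<⇒≤ l)))))) ,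
            subst (d + E i <_) (sym eh) (bit-room (E i) h (proj₁ c) (proj₁ (proj₂ c)) (proj₁ (proj₂ (proj₂ c))) (proj₂ (proj₂ (proj₂ c))) (subst (d <_) eh d<Em)) , good')
          where
          h = proj₁ (E-divides l ≤-refl)
          eh = proj₂ (E-divides l ≤-refl)
          good' : Good (d + E i) (W + S w)
          good' j lj = cases em
            where
            cases : Dec (i ≡ j) → CoBit j (d + E i) ⊎ Σ A λ w' → w' < W + S w × (M ⊨ θ) (w' ∷ j ∷ ρ)
            cases (yes e) = inj₂ (w , <-≤-trans x<Sx y≤x+y , subst (λ j → (M ⊨ θ) (w ∷ j ∷ ρ)) e s)
            cases (no ne) = [ (λ c' → inj₁ (cobit-add l lj ne c c')) , (λ { (w' , l' , s') → inj₂ (w' , <-≤-trans l' x≤x+y , s') }) ]′ (good j lj)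

-- Cuts and overspill

module Model (em : ExcludedMiddle 0ℓ) (M : Structure) (isM : IsModelIΣ₁ M) where
  open Arith em M isM public
  open FinSets em M isM public
  open Certificates em M isM public
  open Exponentials em M isM public
  open AckermannSets em M isM public

  record IsCut (J : A → Set) : Set where
    field
      zero∈ : J 0#
      suc∈  : ∀ {x} → J x → J (S x)
      down∈ : ∀ {x y} → x ≤ y → J y → J x
      outside : A
      outside∉ : ¬ J outside

    ∉⇒> : ∀ {x y} → J x → ¬ J y → x < y
    ∉⇒> {x} {y} jx ny = [ (λ l → ⊥-elim (ny (down∈ l jx))) , id ]′ (≤⊎> y x)

    -- If the formula held nowhere outside J, it would define J and be closed under successor;
    -- induction would carry it to `outside`.
    overspill : ∀ {n} (φ : Δ₀F (2 +ℕ n)) ρ → (∀ x → J x → Σ A λ w → (M ⊨ φ) (w ∷ x ∷ ρ)) →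
      Σ A λ x → ¬ J x × Σ A λ w → (M ⊨ φ) (w ∷ x ∷ ρ)
    overspill φ ρ h = dne λ none → none (outside , outside∉ , ind₁ φ ρ (h 0# zero∈)
      (λ x p → h (S x) (suc∈ (dne λ nx → none (x , nx , p)))) outside)

    -- Overspill for the negation would ask for Π₁ induction. Instead, a Σ₁ formula that fails
    -- throughout J would hold exactly outside J, hence be inherited by predecessors down to 0,
    -- which is in J.
    underspill : ∀ {n} (φ : Δ₀F (2 +ℕ n)) ρ → (∀ x → ¬ J x → Σ A λ w → (M ⊨ φ) (w ∷ x ∷ ρ)) →
      Σ A λ x → J x × Σ A λ w → (M ⊨ φ) (w ∷ x ∷ ρ)
    underspill {n} φ ρ h = dne λ none → absurd none (ind₁ F (outside ∷ ρ) base (step none) outside)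
      where
      σ : Subst (2 +ℕ n) (4 +ℕ n)
      σ = v1 ◂ v0 ◂ ↑ 4
      -- Induction runs downwards from an element outside the cut.
      F : Δ₀F (3 +ℕ n)
      F = v2 ⋖ v1 ∨̇ ∃̇< (sc v2) (v0 +ᵗ v2 ≐ v3 ∧̇ φ [ σ ])
      P : A → Set
      P y = Σ A λ w → (M ⊨ F) (w ∷ y ∷ outside ∷ ρ)
      None : Set
      None = ¬ (Σ A λ x → J x × Σ A λ w → (M ⊨ φ) (w ∷ x ∷ ρ))
      from : ∀ {z w y} → (M ⊨ φ [ σ ]) (z ∷ w ∷ y ∷ outside ∷ ρ) → (M ⊨ φ) (w ∷ z ∷ ρ)
      from = sub⇒ M φ (λ { zero → refl ; (suc zero) → refl ; (suc (suc i)) → refl })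
      put : ∀ {z y} → z + y ≡ outside → (Σ A λ w → (M ⊨ φ) (w ∷ z ∷ ρ)) → P y
      put {z} e (w , s) = w , inj₂ (z , ≤⇒<S (_ , e) , e ,
        sub⇐ M φ (λ { zero → refl ; (suc zero) → refl ; (suc (suc i)) → refl }) s)
      base : P 0#
      base = put (+-zero outside) (h outside outside∉)
      step : None → ∀ y → P y → P (S y)
      step none y (w , inj₁ l) = w , inj₁ (<-trans l x<Sx)
      step none y (w , inj₂ (z , _ , e , s)) = pred (zero-or-suc z)
        where
        z∉ : ¬ J z
        z∉ jz = none (z , jz , w , from {z} {w} {y} s)
        pred : z ≡ 0# ⊎ (Σ A λ z' → z ≡ S z') → P (S y)
        pred (inj₁ z≡0) = ⊥-elim (z∉ (subst J (sym z≡0) zero∈))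
        pred (inj₂ (z' , z≡S)) = put (trans (+-suc z' y) (trans (sym (+-sucˡ z' y)) (trans (cong (_+ y) (sym z≡S)) e)))
          (h z' λ jz' → z∉ (subst J (sym z≡S) (suc∈ jz')))
      absurd : None → ¬ P outside
      absurd none (w , inj₁ l) = <-irrefl l
      absurd none (w , inj₂ (z , _ , e , s)) =
        none (z , subst J (sym (+-cancelʳ z 0# outside (trans e (sym (+-identityˡ outside))))) zero∈ , w , from {z} {w} {outside} s)

    module _ (dom : ∀ x → J x → Dom x) where

      Dom-overspill : Σ A λ m → ¬ J m × Dom m
      Dom-overspill = let m , m∉ , w , s = overspill (expDomF v0 v1) [] (λ x jx → expDomF⇐ {x} (dom x jx)) in
        m , m∉ , expDomF⇒ {w} {m} s

      -- The complement of a Σ₁ set is Π₁, outside the scope of `ack-comprehension`. Once the set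
      -- itself has a code `d₀`, its complement on J is where `d₀` has digit 0, a Σ₁ condition, and
      -- a second comprehension codes it.
      code-complement : ∀ {n} (θ : Δ₀F (2 +ℕ n)) ρ → Σ A λ d → ∀ i → J i →
        (AckE M i d → ¬ (Σ A λ w → (M ⊨ θ) (w ∷ i ∷ ρ))) × (¬ (Σ A λ w → (M ⊨ θ) (w ∷ i ∷ ρ)) → AckE M i d)
      code-complement θ ρ = d , λ i ji →
        (λ x y → Ack-exclusive {i} {d₀} (proj₂ (spec₀ i (∉⇒> ji m∉)) y)
          (let w , s = proj₁ (spec i (∉⇒> ji m∉)) x in ackF⇒ 𝟘 {w} {i} {d₀} s)) ,
        (λ n → proj₂ (spec i (∉⇒> ji m∉)) (ackF⇐ 𝟘 {i} {d₀}
          ([ (λ x → ⊥-elim (n (proj₁ (spec₀ i (∉⇒> ji m∉)) x))) , id ]′ (Ack-total {i} d₀ (dom i ji)))))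
        where
        m = proj₁ Dom-overspill
        m∉ = proj₁ (proj₂ Dom-overspill)
        set = ack-comprehension θ ρ m (proj₂ (proj₂ Dom-overspill))
        d₀ = proj₁ set
        spec₀ = proj₂ set
        complement = ack-comprehension (ackF 𝟘 v0 v1 v2) (d₀ ∷ []) m (proj₂ (proj₂ Dom-overspill))
        d = proj₁ complement
        spec = proj₂ complement

-- The shared cut

module Shared (em : ExcludedMiddle 0ℓ) (M N : Structure) (isM : IsModelIΣ₁ M) (isN : IsModelIΣ₁ N)
  (C : SharedCut M N) (closed : ClosedUnderExp C) where
  module 𝓜 = Model em M isM
  module 𝓝 = Model em N isN

  Twin : Carrier M → Carrier N → Set
  Twin x y = Σ (I C) λ i → ιM C i ≡ x × ιN C i ≡ y

  InM : Carrier M → Set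
  InM x = Σ (I C) λ i → ιM C i ≡ x

  InN : Carrier N → Set
  InN y = Σ (I C) λ i → ιN C i ≡ y

  twin-M : ∀ {x} → InM x → Σ (Carrier N) (Twin x)
  twin-M (i , e) = ιN C i , i , e , refl

  twin-N : ∀ {y} → InN y → Σ (Carrier M) λ x → Twin x y
  twin-N (i , e) = ιM C i , i , refl , e

  inM : ∀ {x y} → Twin x y → InM x
  inM (i , e , _) = i , e

  inN : ∀ {x y} → Twin x y → InN y
  inN (i , _ , e) = i , e

  down-M : ∀ {x x'} → x' 𝓜.≤ x → InM x → InM x'
  down-M l (i , refl) = [ (λ { refl → i , refl }) , (λ l → M-initial C i _ l) ]′ (𝓜.≤⇒≡⊎< l)

  down-N : ∀ {x x'} → x' 𝓝.≤ x → InN x → InN x'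
  down-N l (i , refl) = [ (λ { refl → i , refl }) , (λ l → N-initial C i _ l) ]′ (𝓝.≤⇒≡⊎< l)

  cut-M : 𝓜.IsCut InM
  cut-M = record
    { zero∈ = down-M 𝓜.0≤ (nonempty C , refl)
    ; suc∈ = λ { (i , refl) → down-M (𝓜.<⇒S≤ (proj₂ (M-nomax C i))) (proj₁ (M-nomax C i) , refl) }
    ; down∈ = down-M
    ; outside = proj₁ (M-proper C)
    ; outside∉ = λ { (i , e) → proj₂ (M-proper C) i e } }

  cut-N : 𝓝.IsCut InN
  cut-N = record
    { zero∈ = down-N 𝓝.0≤ (nonempty C , refl)
    ; suc∈ = λ { (i , refl) → down-N (𝓝.<⇒S≤ (proj₂ (N-nomax C i))) (proj₁ (N-nomax C i) , refl) }
    ; down∈ = down-N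
    ; outside = proj₁ (N-proper C)
    ; outside∉ = λ { (i , e) → proj₂ (N-proper C) i e } }

  open 𝓜.IsCut cut-M using () renaming (zero∈ to zero∈M; suc∈ to suc∈M)

  twin-zero : Twin 𝓜.0# 𝓝.0#
  twin-zero = let i , e = zero∈M in i , e , same-0 C i e

  twin-suc : ∀ {x y} → Twin x y → Twin (𝓜.S x) (𝓝.S y)
  twin-suc (i , refl , refl) = let j , e = suc∈M (i , refl) in j , e , sym (same-S C i j (sym e))

  dom-M : ∀ x → InM x → 𝓜.Dom x
  dom-M x (i , refl) = let y , e , _ = closed i in y , e

  exp-M : ∀ {x} → InM x → Σ (Carrier M) λ y → Exp M x y × InM y
  exp-M (i , refl) = let y , e , k = closed i in y , e , k

  -- Both values are at most 2^(x+1), which lies in I.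
  double-square : ∀ {x} → InM x → InM (x 𝓜.+ x) × InM (x 𝓜.* x)
  double-square {x} jx = bound (exp-M (suc∈M jx))
    where
    bound : (Σ (Carrier M) λ y → Exp M (𝓜.S x) y × InM y) → InM (x 𝓜.+ x) × InM (x 𝓜.* x)
    bound (y , (a , b , c) , jy) =
      down-M (𝓜.≤-trans (𝓜.≤-reflexive (sym (𝓜.2*-double x))) (𝓜.≤-trans (𝓜.*-monoʳ-≤ 𝓜.2# (𝓜.<⇒≤ (proj₁ (T.E-growth x 𝓜.x≤Sx)))) (𝓜.≤-reflexive y≡))) jy ,
      down-M (𝓜.≤-trans (proj₂ (T.E-growth x 𝓜.x≤Sx)) (𝓜.≤-reflexive y≡)) jy
      where
      module T = 𝓜.Table c
      y≡ : 𝓜.2# 𝓜.* T.E x ≡ y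
      y≡ = trans (sym (T.E-suc 𝓜.x<Sx)) T.E-end

  plus-times : ∀ {x x'} → InM x → InM x' → InM (x 𝓜.+ x') × InM (x 𝓜.* x')
  plus-times {x} {x'} j j' = [ (λ l → at l 𝓜.≤-refl j') , (λ l → at 𝓜.≤-refl (𝓜.<⇒≤ l) j) ]′ (𝓜.≤⊎> x x')
    where
    at : ∀ {m} → x 𝓜.≤ m → x' 𝓜.≤ m → InM m → InM (x 𝓜.+ x') × InM (x 𝓜.* x')
    at l l' jm = down-M (𝓜.+-mono-≤ l l') (proj₁ (double-square jm)) , down-M (𝓜.*-mono-≤ l l') (proj₂ (double-square jm))

  twin-+ : ∀ {x y x' y'} → Twin x y → Twin x' y' → Twin (x 𝓜.+ x') (y 𝓝.+ y')
  twin-+ (i , refl , refl) (j , refl , refl) = let k , e = proj₁ (plus-times (i , refl) (j , refl)) in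
    k , e , sym (same-+ C i j k (sym e))

  twin-* : ∀ {x y x' y'} → Twin x y → Twin x' y' → Twin (x 𝓜.* x') (y 𝓝.* y')
  twin-* (i , refl , refl) (j , refl , refl) = let k , e = proj₂ (plus-times (i , refl) (j , refl)) in
    k , e , sym (same-* C i j k (sym e))

  twin-pair : ∀ {x y x' y'} → Twin x y → Twin x' y' → Twin (𝓜.pair x x') (𝓝.pair y y')
  twin-pair p q = twin-+ (twin-* (twin-+ p q) (twin-+ p q)) p

  twin-numeral : ∀ k → Twin (numeral M k) (numeral N k)
  twin-numeral zero = twin-zero
  twin-numeral (suc k) = twin-suc (twin-numeral k)

  twin-node : ∀ t {a b a' b'} → Twin a a' → Twin b b' → Twin (𝓜.node t a b) (𝓝.node t a' b')
  twin-node t p q = twin-pair (twin-numeral (tagℕ t)) (twin-pair p q)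

  -- Codes are built from numerals by pairing, so they lie in I and may be parameters of a transfer.
  twin-code : ∀ {n} (e : Expr n) → Twin (𝓜.code e) (𝓝.code e)
  twin-code nil = twin-node nilT twin-zero twin-zero
  twin-code top = twin-node topT twin-zero twin-zero
  twin-code (drop e) = twin-node dropT (twin-code e) twin-zero
  twin-code (bin o e f) = twin-node (binT o) (twin-code e) (twin-code f)
  twin-code (some t e) = twin-node someT (twin-code t) (twin-code e)

  twin-< : ∀ {x y x' y'} → Twin x y → Twin x' y' → y 𝓝.< y' → x 𝓜.< x'
  twin-< (i , refl , refl) (j , refl , refl) = same-<' C i j

  Matched : Carrier M → Carrier N → Set
  Matched d d' = ∀ {x y} → Twin x y → (AckE M x d → AckE N y d') × (AckE N y d' → AckE M x d)

  match-M : SameSSy C → ∀ d → Σ (Carrier N) (Matched d)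
  match-M s d = let d' , f = proj₁ s d in d' , λ { (i , refl , refl) → f i }

  match-N : SameSSy C → ∀ d' → Σ (Carrier M) λ d → Matched d d'
  match-N s d' = let d , f = proj₂ s d' in d , λ { (i , refl , refl) → f i }

  -- The remainder of d modulo 2^k is below 2^k, an element of I, so it has a twin in N; d itself
  -- may lie outside I.
  restrict : ∀ {k k'} → Twin k k' → ∀ d → Σ (Carrier M) λ r → Σ (Carrier N) λ r' → Twin r r' ×
    (∀ x → x 𝓜.< k → (AckE M x r → AckE M x d) × (AckE M x d → AckE M x r))
  restrict {k} {k'} tk d = r , proj₁ tr , proj₂ tr , λ x l →
      𝓜.Ack-mod 𝟙 {x} {k} {P} {d} {q} {r} ep l ed , 𝓜.Ack-mod⁻ {x} {k} {P} {d} {q} {r} ep l ed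
    where
    expk = exp-M (inM tk)
    P = proj₁ expk
    ep = proj₁ (proj₂ expk)
    dm = 𝓜.divMod d P (𝓜.Exp-pos ep)
    q = proj₁ dm
    r = proj₁ (proj₂ dm)
    ed = proj₁ (proj₂ (proj₂ dm))
    tr = twin-M (down-M (𝓜.<⇒≤ (proj₂ (proj₂ (proj₂ dm)))) (proj₂ (proj₂ expk)))

  module Extension (b : Carrier N) where

    Inv : ∀ {n} → Vec (Carrier M) n → Vec (Carrier N) n → Set
    Inv {n} ρ σ = ∀ {x y} → Twin x y → (δ : Δ₀F (2 +ℕ n)) →
      (Σ (Carrier M) λ z → (M ⊨ δ) (z ∷ x ∷ ρ)) → Σ (Carrier N) λ z → z 𝓝.< b × (N ⊨ δ) (z ∷ y ∷ σ)

    -- The invariant admits one parameter from I. Two are packed into a pair, again in I, and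
    -- unpacked by bounded quantifiers.
    Inv-pair : ∀ {n} {ρ : Vec (Carrier M) n} {σ} → Inv ρ σ → ∀ {x y x' y'} → Twin x y → Twin x' y' →
      (δ : Δ₀F (3 +ℕ n)) → (Σ (Carrier M) λ z → (M ⊨ δ) (z ∷ x ∷ x' ∷ ρ)) →
      Σ (Carrier N) λ z → z 𝓝.< b × (N ⊨ δ) (z ∷ y ∷ y' ∷ σ)
    Inv-pair {n} {ρ} {σ} inv {x} {y} {x'} {y'} t t' δ (z , s) =
      let z' , l , u , _ , u' , _ , e , s' = inv (twin-pair t t') δ' (z , x , 𝓜.≤⇒<S (𝓜.fst≤pair {x} {x'}) ,
            x' , 𝓜.≤⇒<S (𝓜.snd≤pair {x} {x'}) , refl ,
            sub⇐ M δ {τ} {x' ∷ x ∷ z ∷ 𝓜.pair x x' ∷ ρ} {z ∷ x ∷ x' ∷ ρ}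
              (λ { zero → refl ; (suc zero) → refl ; (suc (suc zero)) → refl ; (suc (suc (suc i))) → refl }) s)
      in z' , l , out e (sub⇒ N δ {τ} {u' ∷ u ∷ z' ∷ 𝓝.pair y y' ∷ σ} {z' ∷ u ∷ u' ∷ σ}
              (λ { zero → refl ; (suc zero) → refl ; (suc (suc zero)) → refl ; (suc (suc (suc i))) → refl }) s')
      where
      τ : Subst (3 +ℕ n) (4 +ℕ n)
      τ = v2 ◂ v1 ◂ v0 ◂ ↑ 4
      δ' : Δ₀F (2 +ℕ n)
      δ' = ∃̇< (sc v1) (∃̇< (sc v2) (v3 ≐ pairᵗ v1 v0 ∧̇ δ [ τ ]))
      out : ∀ {z u u'} → 𝓝.pair y y' ≡ 𝓝.pair u u' → (N ⊨ δ) (z ∷ u ∷ u' ∷ σ) → (N ⊨ δ) (z ∷ y ∷ y' ∷ σ)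
      out {z} e s = subst₂ (λ u u' → (N ⊨ δ) (z ∷ u ∷ u' ∷ σ)) (sym (proj₁ (𝓝.pair-injective e))) (sym (proj₂ (𝓝.pair-injective e))) s

    module _ {n} {ρ : Vec (Carrier M) n} {σ : Vec (Carrier N) n} (inv : Inv ρ σ) where

      weaken : Δ₀F 3 → Δ₀F (3 +ℕ n)
      weaken δ = δ [ v0 ◂ v1 ◂ v2 ◂ (λ ()) ]

      transfer : ∀ {x y x' y'} → Twin x y → Twin x' y' → (δ : Δ₀F 3) →
        (Σ (Carrier M) λ z → (M ⊨ δ) (z ∷ x ∷ x' ∷ [])) → Σ (Carrier N) λ z → (N ⊨ δ) (z ∷ y ∷ y' ∷ [])
      transfer t t' δ (z , s) =
        let z' , _ , s' = Inv-pair inv t t' (weaken δ) (z , sub⇐ M δ (λ { zero → refl ; (suc zero) → refl ; (suc (suc zero)) → refl }) s)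
        in z' , sub⇒ N δ (λ { zero → refl ; (suc zero) → refl ; (suc (suc zero)) → refl }) s'

      ack-up : ∀ e {x y x' y'} → Twin x y → Twin x' y' → 𝓜.Ack e x x' → 𝓝.Ack e y y'
      ack-up e {x} {y} {x'} {y'} t t' a =
        let w , s = transfer t t' (ackF e v0 v1 v2) (𝓜.ackF⇐ e {x} {x'} a) in 𝓝.ackF⇒ e {w} {y} {y'} s

      -- Transfer runs only from M to N, so the converse is obtained by moving digit 0 upwards.
      ack-down : ∀ {x y x' y'} → Twin x y → Twin x' y' → AckE N y y' → AckE M x x'
      ack-down {x} {y} {x'} {y'} t t' a = 𝓜.Ack-𝟙 {x} {x'} (dom-M x (inM t))
        λ z → 𝓝.Ack-exclusive {y} {y'} a (ack-up 𝟘 t t' z)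

      -- Closure under exponentiation is stated in M; the existence of a power of two is Σ₁ and is
      -- transferred.
      dom-N : ∀ y → InN y → 𝓝.Dom y
      dom-N y jy = let x , t = twin-N jy
                       w , s = transfer t t (expDomF v0 v1) (𝓜.expDomF⇐ {x} (dom-M x (inM t)))
                   in 𝓝.expDomF⇒ {w} {y} s

-- The forth and back steps

σ-forth : ∀ {n} → Subst (3 +ℕ n) (6 +ℕ n)
σ-forth = v0 ◂ v1 ◂ v2 ◂ ↑ 6

σ-bounded : ∀ {n} → Subst (3 +ℕ n) (6 +ℕ n)
σ-bounded = v0 ◂ v2 ◂ v3 ◂ ↑ 6

σ-spill : ∀ {n} → Subst (5 +ℕ n) (7 +ℕ n)
σ-spill = v0 ◂ v1 ◂ v2 ◂ v5 ◂ v6 ◂ ↑ 7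

σ-witness : ∀ {n} → Subst (3 +ℕ n) (6 +ℕ n)
σ-witness = v0 ◂ v1 ◂ v3 ◂ ↑ 6

σ-back : ∀ {n} → Subst (4 +ℕ n) (5 +ℕ n)
σ-back = v0 ◂ v1 ◂ v3 ◂ v4 ◂ ↑ 5

σ-below : ∀ {n} → Subst (3 +ℕ n) (5 +ℕ n)
σ-below = v0 ◂ v2 ◂ v4 ◂ ↑ 5

σ-collect : ∀ {n} → Subst (3 +ℕ n) (4 +ℕ n)
σ-collect = v0 ◂ v1 ◂ v3 ◂ ↑ 4

module _ {n : ℕ} (θ : Δ₀F (3 +ℕ n)) where

  -- some y < z satisfies: for all x < k, x E d or θ(w, x, y) for some w < z
  forthF : Δ₀F (3 +ℕ n)
  forthF = ∃̇< v0 (∀̇< v2 (∃̇< v2 (ackF 𝟙 v0 v1 v5 ∨̇ θ [ σ-forth ])))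

  -- The witness v is for the digit alone. The witness of θ is bounded by the parameter b, so that
  -- bound is unaffected by overspill.
  boundedF : Δ₀F (5 +ℕ n)
  boundedF = ackF 𝟙 v0 v1 v3 ∨̇ ∃̇< v4 (θ [ σ-bounded ])

  forthSpillF : Δ₀F (4 +ℕ n)
  forthSpillF = ∃̇< v3 (∀̇< v2 (∃̇< v2 (boundedF [ σ-spill ])))

  -- W bounds the witnesses of digit and θ together, as `collection` expects a single existential
  -- quantifier.
  backWitnessF : Δ₀F (4 +ℕ n)
  backWitnessF = ∃̇< v2 (∃̇< v1 (ackF 𝟙 v0 v1 v5) ∧̇ ∃̇< v1 (θ [ σ-witness ]))

  -- for all m < ρ(l), some x < k satisfies x E d and θ(w, x, m) for some w < z
  backF : Fin n → Δ₀F (3 +ℕ n)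
  backF l = ∀̇< (var (3 ↑ʳ l)) (∃̇< v1 (backWitnessF [ σ-back ]))

  -- Variable 0 is a dummy that gives the formula the shape required by `code-complement`.
  existsBelowF : Δ₀F (4 +ℕ n)
  existsBelowF = ∃̇< v2 (θ [ σ-below ])

module StepFormulas (em : ExcludedMiddle 0ℓ) (M : Structure) (isM : IsModelIΣ₁ M) {n : ℕ} (θ : Δ₀F (3 +ℕ n)) (ρ : Vec (Carrier M) n) where
  open Model em M isM

  forthF-intro : ∀ {k d m} → (∀ x → x < k → AckE M x d ⊎ Σ A λ w → (M ⊨ θ) (w ∷ x ∷ m ∷ ρ)) →
    Σ A λ z → (M ⊨ forthF θ) (z ∷ k ∷ d ∷ ρ)
  forthF-intro {k} {d} {m} h = z , m , <-≤-trans x<Sx y≤x+y , λ x l →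
      let w , lw , s = proj₂ coll x l in w , <-≤-trans lw x≤x+y ,
        [ inj₁ , (λ s → inj₂ (sub⇐ M θ {σ-forth} {w ∷ x ∷ m ∷ z ∷ k ∷ d ∷ ρ} {w ∷ x ∷ m ∷ ρ} (λ { zero → refl ; (suc zero) → refl ; (suc (suc zero)) → refl ; (suc (suc (suc i))) → refl })
           (sub⇒ M θ {σ-collect} {w ∷ x ∷ d ∷ m ∷ ρ} {w ∷ x ∷ m ∷ ρ} (λ { zero → refl ; (suc zero) → refl ; (suc (suc zero)) → refl ; (suc (suc (suc i))) → refl }) s))) ]′ s
    where
    θ∨ : Δ₀F (4 +ℕ n)
    θ∨ = ackF 𝟙 v0 v1 v2 ∨̇ θ [ σ-collect ]
    witness : ∀ x → AckE M x d ⊎ (Σ A λ w → (M ⊨ θ) (w ∷ x ∷ m ∷ ρ)) → Σ A λ w → (M ⊨ θ∨) (w ∷ x ∷ d ∷ m ∷ ρ)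
    witness x (inj₁ a) = let w , s = ackF⇐ 𝟙 {x} {d} a in w , inj₁ s
    witness x (inj₂ (w , s)) = w , inj₂ (sub⇐ M θ {σ-collect} {w ∷ x ∷ d ∷ m ∷ ρ} {w ∷ x ∷ m ∷ ρ} (λ { zero → refl ; (suc zero) → refl ; (suc (suc zero)) → refl ; (suc (suc (suc i))) → refl }) s)
    coll = collection θ∨ (d ∷ m ∷ ρ) k (λ x l → witness x (h x l))
    W = proj₁ coll
    -- z must exceed m as well as the witnesses, since `forthF` also looks for y below z.
    z = W + S m

  forthF-elim : ∀ {z k d} → (M ⊨ forthF θ) (z ∷ k ∷ d ∷ ρ) →
    Σ A λ y → y < z × ∀ x → x < k → AckE M x d ⊎ Σ A λ w → w < z × (M ⊨ θ) (w ∷ x ∷ y ∷ ρ)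
  forthF-elim {z} {k} {d} (y , ly , f) = y , ly , λ x l → let w , lw , s = f x l in
    [ (λ s → inj₁ (ackF⇒ 𝟙 {w} {x} {d} s)) ,
      (λ s → inj₂ (w , lw , sub⇒ M θ {σ-forth} {w ∷ x ∷ y ∷ z ∷ k ∷ d ∷ ρ} {w ∷ x ∷ y ∷ ρ} (λ { zero → refl ; (suc zero) → refl ; (suc (suc zero)) → refl ; (suc (suc (suc i))) → refl }) s)) ]′ s

  boundedF-intro : ∀ {b x y d} → AckE M x d ⊎ (Σ A λ w → w < b × (M ⊨ θ) (w ∷ x ∷ y ∷ ρ)) →
    Σ A λ v → (M ⊨ boundedF θ) (v ∷ x ∷ y ∷ d ∷ b ∷ ρ)
  boundedF-intro {b} {x} {y} {d} (inj₁ a) = let v , s = ackF⇐ 𝟙 {x} {d} a in v , inj₁ s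
  boundedF-intro {b} {x} {y} {d} (inj₂ (w , l , s)) = 0# , inj₂ (w , l , sub⇐ M θ {σ-bounded} {w ∷ 0# ∷ x ∷ y ∷ d ∷ b ∷ ρ} {w ∷ x ∷ y ∷ ρ}
    (λ { zero → refl ; (suc zero) → refl ; (suc (suc zero)) → refl ; (suc (suc (suc i))) → refl }) s)

  boundedF-elim : ∀ {b v x y d} → (M ⊨ boundedF θ) (v ∷ x ∷ y ∷ d ∷ b ∷ ρ) →
    AckE M x d ⊎ (Σ A λ w → w < b × (M ⊨ θ) (w ∷ x ∷ y ∷ ρ))
  boundedF-elim {b} {v} {x} {y} {d} (inj₁ s) = inj₁ (ackF⇒ 𝟙 {v} {x} {d} s)
  boundedF-elim {b} {v} {x} {y} {d} (inj₂ (w , l , s)) = inj₂ (w , l , sub⇒ M θ {σ-bounded} {w ∷ v ∷ x ∷ y ∷ d ∷ b ∷ ρ} {w ∷ x ∷ y ∷ ρ}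
    (λ { zero → refl ; (suc zero) → refl ; (suc (suc zero)) → refl ; (suc (suc (suc i))) → refl }) s)

  forthSpillF-intro : ∀ {k d b y} → y < b → (∀ x → x < k → AckE M x d ⊎ Σ A λ w → w < b × (M ⊨ θ) (w ∷ x ∷ y ∷ ρ)) →
    Σ A λ V → (M ⊨ forthSpillF θ) (V ∷ k ∷ d ∷ b ∷ ρ)
  forthSpillF-intro {k} {d} {b} {y} ly h = V , y , ly , λ x l → let v , lv , s = proj₂ coll x l in v , lv ,
      sub⇐ M (boundedF θ) {σ-spill} {v ∷ x ∷ y ∷ V ∷ k ∷ d ∷ b ∷ ρ} {v ∷ x ∷ y ∷ d ∷ b ∷ ρ}
        (λ { zero → refl ; (suc zero) → refl ; (suc (suc zero)) → refl ; (suc (suc (suc zero))) → refl ; (suc (suc (suc (suc zero)))) → refl ; (suc (suc (suc (suc (suc i))))) → refl }) s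
    where
    coll = collection (boundedF θ) (y ∷ d ∷ b ∷ ρ) k (λ x l → boundedF-intro {b} {x} {y} {d} (h x l))
    V = proj₁ coll

  forthSpillF-elim : ∀ {V k d b} → (M ⊨ forthSpillF θ) (V ∷ k ∷ d ∷ b ∷ ρ) →
    Σ A λ y → ∀ x → x < k → AckE M x d ⊎ Σ A λ w → w < b × (M ⊨ θ) (w ∷ x ∷ y ∷ ρ)
  forthSpillF-elim {V} {k} {d} {b} (y , ly , f) = y , λ x l → let v , lv , s = f x l in
    boundedF-elim {b} {v} {x} {y} {d} (sub⇒ M (boundedF θ) {σ-spill} {v ∷ x ∷ y ∷ V ∷ k ∷ d ∷ b ∷ ρ} {v ∷ x ∷ y ∷ d ∷ b ∷ ρ}
        (λ { zero → refl ; (suc zero) → refl ; (suc (suc zero)) → refl ; (suc (suc (suc zero))) → refl ; (suc (suc (suc (suc zero)))) → refl ; (suc (suc (suc (suc (suc i))))) → refl }) s)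

  backF-intro : ∀ l {k d} → (∀ m → m < lookup ρ l → Σ A λ x → x < k × AckE M x d × Σ A λ w → (M ⊨ θ) (w ∷ x ∷ m ∷ ρ)) →
    Σ A λ z → (M ⊨ backF θ l) (z ∷ k ∷ d ∷ ρ)
  backF-intro l {k} {d} h = z , λ m lm → let W , lW , s = proj₂ coll m lm in W , lW ,
      sub⇐ M (backWitnessF θ) {σ-back} {W ∷ m ∷ z ∷ k ∷ d ∷ ρ} {W ∷ m ∷ k ∷ d ∷ ρ}
        (λ { zero → refl ; (suc zero) → refl ; (suc (suc zero)) → refl ; (suc (suc (suc zero))) → refl ; (suc (suc (suc (suc i)))) → refl }) s
    where
    witness : ∀ m → (Σ A λ x → x < k × AckE M x d × Σ A λ w → (M ⊨ θ) (w ∷ x ∷ m ∷ ρ)) → Σ A λ W → (M ⊨ backWitnessF θ) (W ∷ m ∷ k ∷ d ∷ ρ)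
    witness m (x , lx , a , w , s) = let v , s' = ackF⇐ 𝟙 {x} {d} a in
      S (v + w) , x , lx , (v , ≤⇒<S x≤x+y , s') , w , ≤⇒<S y≤x+y ,
      sub⇐ M θ {σ-witness} {w ∷ x ∷ S (v + w) ∷ m ∷ k ∷ d ∷ ρ} {w ∷ x ∷ m ∷ ρ} (λ { zero → refl ; (suc zero) → refl ; (suc (suc zero)) → refl ; (suc (suc (suc i))) → refl }) s
    coll = collection (backWitnessF θ) (k ∷ d ∷ ρ) (lookup ρ l) (λ m lm → witness m (h m lm))
    z = proj₁ coll

  backF-elim : ∀ l {z k d} → (M ⊨ backF θ l) (z ∷ k ∷ d ∷ ρ) → ∀ m → m < lookup ρ l →
    Σ A λ x → x < k × AckE M x d × Σ A λ w → w < z × (M ⊨ θ) (w ∷ x ∷ m ∷ ρ)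
  backF-elim l {z} {k} {d} f m lm = let W , lW , s = f m lm in unpack W lW
      (sub⇒ M (backWitnessF θ) {σ-back} {W ∷ m ∷ z ∷ k ∷ d ∷ ρ} {W ∷ m ∷ k ∷ d ∷ ρ}
        (λ { zero → refl ; (suc zero) → refl ; (suc (suc zero)) → refl ; (suc (suc (suc zero))) → refl ; (suc (suc (suc (suc i)))) → refl }) s)
    where
    unpack : ∀ W → W < z → (M ⊨ backWitnessF θ) (W ∷ m ∷ k ∷ d ∷ ρ) →
      Σ A λ x → x < k × AckE M x d × Σ A λ w → w < z × (M ⊨ θ) (w ∷ x ∷ m ∷ ρ)
    unpack W lW (x , lx , (v , _ , a) , w , lw , s) = x , lx , ackF⇒ 𝟙 {v} {x} {d} a , w , <-trans lw lW ,
      sub⇒ M θ {σ-witness} {w ∷ x ∷ W ∷ m ∷ k ∷ d ∷ ρ} {w ∷ x ∷ m ∷ ρ} (λ { zero → refl ; (suc zero) → refl ; (suc (suc zero)) → refl ; (suc (suc (suc i))) → refl }) s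

  existsBelowF-intro : ∀ {u x b y} → (Σ A λ w → w < b × (M ⊨ θ) (w ∷ x ∷ y ∷ ρ)) → (M ⊨ existsBelowF θ) (u ∷ x ∷ b ∷ y ∷ ρ)
  existsBelowF-intro {u} {x} {b} {y} (w , l , s) = w , l ,
    sub⇐ M θ {σ-below} {w ∷ u ∷ x ∷ b ∷ y ∷ ρ} {w ∷ x ∷ y ∷ ρ} (λ { zero → refl ; (suc zero) → refl ; (suc (suc zero)) → refl ; (suc (suc (suc i))) → refl }) s

  existsBelowF-elim : ∀ {u x b y} → (M ⊨ existsBelowF θ) (u ∷ x ∷ b ∷ y ∷ ρ) → Σ A λ w → w < b × (M ⊨ θ) (w ∷ x ∷ y ∷ ρ)
  existsBelowF-elim {u} {x} {b} {y} (w , l , s) = w , l ,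
    sub⇒ M θ {σ-below} {w ∷ u ∷ x ∷ b ∷ y ∷ ρ} {w ∷ x ∷ y ∷ ρ} (λ { zero → refl ; (suc zero) → refl ; (suc (suc zero)) → refl ; (suc (suc (suc i))) → refl }) s

module Steps (em : ExcludedMiddle 0ℓ) (M N : Structure) (isM : IsModelIΣ₁ M) (isN : IsModelIΣ₁ N)
  (C : SharedCut M N) (closed : ClosedUnderExp C) (sameSSy : SameSSy C) (b : Carrier N) where
  open Shared em M N isM isN C closed public
  open Extension b public

  Transfers : ∀ {n} → Δ₀F (2 +ℕ n) → Vec (Carrier M) n → Vec (Carrier N) n → Set
  Transfers θ ρ σ = ∀ x y → Twin x y → (Σ (Carrier M) λ w → (M ⊨ θ) (w ∷ x ∷ ρ)) →
    Σ (Carrier N) λ w → w 𝓝.< b × (N ⊨ θ) (w ∷ y ∷ σ)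

  universal-Inv : ∀ {n} {ρ : Vec (Carrier M) n} {σ} → Transfers (universalF n) ρ σ → Inv ρ σ
  universal-Inv {n} {ρ} {σ} h {x} {y} t δ (z , s) =
    let w , u = 𝓜.universal-complete ρ δ {z} {x} s
        w' , l , u' = h (𝓜.pair (𝓜.code (truthᴱ δ)) x) (𝓝.pair (𝓝.code (truthᴱ δ)) y) (twin-pair (twin-code (truthᴱ δ)) t) (w , 𝓜.universalF⇐ ρ {w} u)
        z' , l' , s' = 𝓝.universal-sound σ δ {w'} {y} (𝓝.universalF⇒ σ {w'} u')
    in z' , 𝓝.<-trans l' l , s'

  module _ {n} {ρ : Vec (Carrier M) n} {σ : Vec (Carrier N) n} (inv : Inv ρ σ) (θ : Δ₀F (3 +ℕ n)) where
    private
      module FM = StepFormulas em M isM θ ρ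
      module FN = StepFormulas em N isN θ σ

    -- For k in I, m itself shows in M that some y satisfies θ at every x below k outside the piece
    -- of d below k. Transfer gives such a y below b in N, with witnesses below b, and overspill
    -- gives one y for all of I. If θ holds at x in M, then x is not in d, so its twin is not in the
    -- matching set and θ must hold there below b.
    forth-θ : ∀ m → Σ (Carrier N) λ y → Transfers θ (m ∷ ρ) (y ∷ σ)
    forth-θ m = from-code (𝓜.IsCut.code-complement cut-M dom-M θ (m ∷ ρ))
      where
      from-code : (Σ (Carrier M) λ d → ∀ i → InM i →
        (AckE M i d → ¬ (Σ (Carrier M) λ w → (M ⊨ θ) (w ∷ i ∷ m ∷ ρ))) ×
        (¬ (Σ (Carrier M) λ w → (M ⊨ θ) (w ∷ i ∷ m ∷ ρ)) → AckE M i d)) → Σ (Carrier N) λ y → Transfers θ (m ∷ ρ) (y ∷ σ)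
      from-code (d , spec) = with-match (match-M sameSSy d)
        where
        with-match : Σ (Carrier N) (Matched d) → Σ (Carrier N) λ y → Transfers θ (m ∷ ρ) (y ∷ σ)
        with-match (d' , matched) = conclude (𝓝.IsCut.overspill cut-N (forthSpillF θ) (d' ∷ b ∷ σ) spill)
          where
          spill : ∀ k' → InN k' → Σ (Carrier N) λ V → (N ⊨ forthSpillF θ) (V ∷ k' ∷ d' ∷ b ∷ σ)
          spill k' jk' = FN.forthSpillF-intro {k'} {d'} {b} {y} (𝓝.<-trans ly lz) λ x lx →
              [ (λ a → inj₁ (to-d' x lx a)) , (λ { (w , lw , s) → inj₂ (w , 𝓝.<-trans lw lz , s) }) ]′ (f x lx)
            where
            k = proj₁ (twin-N jk')
            tk : Twin k k'
            tk = proj₂ (twin-N jk')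
            res = restrict tk d
            r = proj₁ res
            r' = proj₁ (proj₂ res)
            tr : Twin r r'
            tr = proj₁ (proj₂ (proj₂ res))
            agree = proj₂ (proj₂ (proj₂ res))
            in-M : ∀ x → x 𝓜.< k → AckE M x r ⊎ Σ (Carrier M) λ w → (M ⊨ θ) (w ∷ x ∷ m ∷ ρ)
            in-M x l = cases em
              where
              cases : Dec (Σ (Carrier M) λ w → (M ⊨ θ) (w ∷ x ∷ m ∷ ρ)) → AckE M x r ⊎ Σ (Carrier M) λ w → (M ⊨ θ) (w ∷ x ∷ m ∷ ρ)
              cases (yes p) = inj₂ p
              cases (no n) = inj₁ (proj₂ (agree x l) (proj₂ (spec x (down-M (𝓜.<⇒≤ l) (inM tk))) n))
            moved = Inv-pair inv tk tr (forthF θ) (FM.forthF-intro {k} {r} {m} in-M)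
            lz = proj₁ (proj₂ moved)
            elim = FN.forthF-elim {proj₁ moved} {k'} {r'} (proj₂ (proj₂ moved))
            y = proj₁ elim
            ly = proj₁ (proj₂ elim)
            f = proj₂ (proj₂ elim)
            to-d' : ∀ x → x 𝓝.< k' → AckE N x r' → AckE N x d'
            to-d' x lx a = let x₀ , tx = twin-N (down-N (𝓝.<⇒≤ lx) (inN tk)) in
              proj₁ (matched tx) (proj₁ (agree x₀ (twin-< tx tk lx)) (ack-down inv tx tr a))
          conclude : (Σ (Carrier N) λ k → ¬ InN k × Σ (Carrier N) λ V → (N ⊨ forthSpillF θ) (V ∷ k ∷ d' ∷ b ∷ σ)) →
            Σ (Carrier N) λ y → Transfers θ (m ∷ ρ) (y ∷ σ)
          conclude (k , k∉ , V , s) = let y , f = FN.forthSpillF-elim {V} {k} {d'} {b} s in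
            y , λ x x' t p → [ (λ a → ⊥-elim (proj₁ (spec x (inM t)) (proj₂ (matched t) a) p)) , id ]′
              (f x' (𝓝.IsCut.∉⇒> cut-N (inN t) k∉))

    -- Suppose every m satisfies θ at some x of I in d. Then for each k outside I, every m below
    -- ρ(l) does so at some x below k; underspill moves k into I. After transfer every m below σ(l)
    -- satisfies θ with a witness below b at some x in `d'`. For m = y this contradicts the choice
    -- of `d'`.
    back-θ : ∀ l y → y 𝓝.< lookup σ l → Σ (Carrier M) λ m → Transfers θ (m ∷ ρ) (y ∷ σ)
    back-θ l y y<u = from-code (𝓝.IsCut.code-complement cut-N (dom-N inv) (existsBelowF θ) (b ∷ y ∷ σ))
      where
      Goal = Σ (Carrier M) λ m → Transfers θ (m ∷ ρ) (y ∷ σ)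
      from-code : (Σ (Carrier N) λ d' → ∀ i → InN i →
        (AckE N i d' → ¬ (Σ (Carrier N) λ u → (N ⊨ existsBelowF θ) (u ∷ i ∷ b ∷ y ∷ σ))) ×
        (¬ (Σ (Carrier N) λ u → (N ⊨ existsBelowF θ) (u ∷ i ∷ b ∷ y ∷ σ)) → AckE N i d')) → Goal
      from-code (d' , spec) = with-match (match-N sameSSy d')
        where
        with-match : (Σ (Carrier M) λ d → Matched d d') → Goal
        with-match (d , matched) = let m , f = 𝓜.dne no-none in
            m , λ x x' t p → 𝓜.dne λ n → f x (inM t) (proj₂ (matched t) (proj₂ (spec x' (inN t))
              λ { (u , s) → n (FN.existsBelowF-elim {u} {x'} {b} {y} s) })) p
          where
          Avoids : Carrier M → Set
          Avoids m = ∀ x → InM x → AckE M x d → ¬ (Σ (Carrier M) λ w → (M ⊨ θ) (w ∷ x ∷ m ∷ ρ))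
          no-none : ¬ ¬ (Σ (Carrier M) Avoids)
          no-none none = contradict (𝓜.IsCut.underspill cut-M (backF θ l) (d ∷ ρ) λ k k∉ →
              FM.backF-intro l {k} {d} λ m _ → let x , jx , a , p = hit m in x , 𝓜.IsCut.∉⇒> cut-M jx k∉ , a , p)
            where
            hit : ∀ m → Σ (Carrier M) λ x → InM x × AckE M x d × Σ (Carrier M) λ w → (M ⊨ θ) (w ∷ x ∷ m ∷ ρ)
            hit m = 𝓜.dne λ n → none (m , λ x jx a p → n (x , jx , a , p))
            contradict : ¬ (Σ (Carrier M) λ k → InM k × Σ (Carrier M) λ z → (M ⊨ backF θ l) (z ∷ k ∷ d ∷ ρ))
            contradict (k , jk , z , s) = absurd (FN.backF-elim l {proj₁ moved} {k'} {r'} (proj₂ (proj₂ moved)) y y<u)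
              where
              k' = proj₁ (twin-M jk)
              tk : Twin k k'
              tk = proj₂ (twin-M jk)
              res = restrict tk d
              r = proj₁ res
              r' = proj₁ (proj₂ res)
              tr : Twin r r'
              tr = proj₁ (proj₂ (proj₂ res))
              agree = proj₂ (proj₂ (proj₂ res))
              moved = Inv-pair inv tk tr (backF θ l) (FM.backF-intro l {k} {r} λ m lm →
                let x , lx , a , w , _ , s' = FM.backF-elim l {z} {k} {d} s m lm in x , lx , proj₂ (agree x lx) a , w , s')
              absurd : ¬ (Σ (Carrier N) λ x → x 𝓝.< k' × AckE N x r' × Σ (Carrier N) λ w → w 𝓝.< proj₁ moved × (N ⊨ θ) (w ∷ x ∷ y ∷ σ))
              absurd (x , lx , a , w , lw , s') =
                let x₀ , tx = twin-N (down-N (𝓝.<⇒≤ lx) (inN tk)) in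
                proj₁ (spec x (inN tx)) (proj₁ (matched tx) (proj₁ (agree x₀ (twin-< tx tk lx)) (ack-down inv tx tr a)))
                  (𝓝.0# , FN.existsBelowF-intro {𝓝.0#} {x} {b} {y} (w , 𝓝.<-trans lw (proj₁ (proj₂ moved)) , s'))

  forth : ∀ {n} {ρ : Vec (Carrier M) n} {σ} → Inv ρ σ → ∀ m → Σ (Carrier N) λ y → Inv (m ∷ ρ) (y ∷ σ)
  forth {n} {ρ} {σ} inv m = map₂ (λ {y} → universal-Inv {suc n} {m ∷ ρ} {y ∷ σ}) (forth-θ {n} {ρ} {σ} inv (universalF (suc n)) m)

  back : ∀ {n} {ρ : Vec (Carrier M) n} {σ} → Inv ρ σ → ∀ l y → y 𝓝.< lookup σ l → Σ (Carrier M) λ m → Inv (m ∷ ρ) (y ∷ σ)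
  back {n} {ρ} {σ} inv l y y<u = map₂ (λ {m} → universal-Inv {suc n} {m ∷ ρ} {y ∷ σ}) (back-θ {n} {ρ} {σ} inv (universalF (suc n)) l y y<u)

-- The theorem

module BackAndForth (em : ExcludedMiddle 0ℓ) (M N : Structure) (isM : IsModelIΣ₁ M) (isN : IsModelIΣ₁ N)
  (countM : Countable M) (countN : Countable N) (c : Carrier M) (a b : Carrier N)
  (C : SharedCut M N) (closed : ClosedUnderExp C) (cond : Cond2 M N C c a b) where
  open Steps em M N isM isN C closed (proj₁ cond) b

  private
    f = proj₁ countM
    g = proj₁ countN

  State : Set
  State = Σ ℕ λ n → Σ (Vec (Carrier M) n) λ ρ → Σ (Vec (Carrier N) n) λ σ → Inv ρ σ

  _∋_↦_ : State → Carrier M → Carrier N → Set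
  (n , ρ , σ , _) ∋ x ↦ y = Σ (Fin n) λ l → lookup ρ l ≡ x × lookup σ l ≡ y

  _⊑_ : State → State → Set
  s ⊑ s' = ∀ {x y} → s ∋ x ↦ y → s' ∋ x ↦ y

  start : State
  start = 1 , c ∷ [] , a ∷ [] , inv
    where
    τ : Subst 3 3
    τ = v2 ◂ v0 ◂ v1 ◂ λ ()
    inv : Inv (c ∷ []) (a ∷ [])
    inv (i , refl , refl) δ (z , s) =
      let z' , l , s' = proj₂ cond i (formula (δ [ τ ])) (bounded (δ [ τ ])) (z , sub⇐ M δ {τ} {ιM C i ∷ c ∷ z ∷ []} {z ∷ ιM C i ∷ c ∷ []}
            (λ { zero → refl ; (suc zero) → refl ; (suc (suc zero)) → refl }) s)
      in z' , l , sub⇒ N δ {τ} {ιN C i ∷ a ∷ z' ∷ []} {z' ∷ ιN C i ∷ a ∷ []}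
            (λ { zero → refl ; (suc zero) → refl ; (suc (suc zero)) → refl }) s'

  addM : State → Carrier M → State
  addM (n , ρ , σ , inv) m = suc n , m ∷ ρ , proj₁ (forth inv m) ∷ σ , λ {x} {y} → proj₂ (forth inv m) {x} {y}

  addM-⊑ : ∀ s m → s ⊑ addM s m
  addM-⊑ s m (l , e) = suc l , e

  -- The back step applies only below an entry of the tuple. Other elements are passed over, since
  -- initiality concerns only what lies below the image.
  Dominated : State → Carrier N → Set
  Dominated (n , _ , σ , _) y = Σ (Fin n) λ l → y 𝓝.< lookup σ l

  addN-cases : ∀ s y → Dec (Dominated s y) → State
  addN-cases s@(n , ρ , σ , inv) y (yes (l , y<u)) =
    suc n , proj₁ (back inv l y y<u) ∷ ρ , y ∷ σ , λ {x} {y'} → proj₂ (back inv l y y<u) {x} {y'}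
  addN-cases s y (no _) = s

  addN : State → Carrier N → State
  addN s y = addN-cases s y em

  addN-cases-⊑ : ∀ s y (d : Dec (Dominated s y)) → s ⊑ addN-cases s y d
  addN-cases-⊑ s y (yes _) (l , e) = suc l , e
  addN-cases-⊑ s y (no _) p = p

  addN-cases-hit : ∀ s y (d : Dec (Dominated s y)) {x₀ y₀} → s ∋ x₀ ↦ y₀ → y 𝓝.< y₀ → Σ (Carrier M) λ x → addN-cases s y d ∋ x ↦ y
  addN-cases-hit s y (yes _) _ _ = _ , zero , refl , refl
  addN-cases-hit s y (no n) (l , _ , refl) y<u = ⊥-elim (n (l , y<u))

  -- Each g i is tried again at every stage from i on, because it may become dominated only later.
  backs : ℕ → State → State
  backs zero s = addN s (g zero)
  backs (suc k) s = addN (backs k s) (g (suc k))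

  backs-⊑ : ∀ k s → s ⊑ backs k s
  backs-⊑ zero s = addN-cases-⊑ s (g zero) em
  backs-⊑ (suc k) s p = addN-cases-⊑ (backs k s) (g (suc k)) em (backs-⊑ k s p)

  backs-hit : ∀ {i k} s → i ≤′ k → ∀ {x₀ y₀} → s ∋ x₀ ↦ y₀ → g i 𝓝.< y₀ →
    Σ (Carrier M) λ x → backs k s ∋ x ↦ g i
  backs-hit {zero} s (≤′-reflexive refl) p l = addN-cases-hit s (g zero) em p l
  backs-hit {suc i} s (≤′-reflexive refl) p l = addN-cases-hit (backs i s) (g (suc i)) em (backs-⊑ i s p) l
  backs-hit s (≤′-step {k} i≤k) p l = let x , q = backs-hit s i≤k p l in x , addN-cases-⊑ (backs k s) (g (suc k)) em q

  state : ℕ → State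
  state zero = start
  state (suc k) = backs k (addM (state k) (f k))

  state-⊑ : ∀ {i k} → i ≤′ k → state i ⊑ state k
  state-⊑ (≤′-reflexive refl) p = p
  state-⊑ (≤′-step {k} l) p = backs-⊑ k (addM (state k) (f k)) (addM-⊑ (state k) (f k) (state-⊑ l p))

  image : ∀ x → Σ (Carrier N) λ y → Σ ℕ λ k → state k ∋ x ↦ y
  image x = let k , e = proj₂ countM x in
    proj₁ (forth (proj₂ (proj₂ (proj₂ (state k)))) (f k)) , suc k , backs-⊑ k (addM (state k) (f k)) (zero , e , refl)

  j : Carrier M → Carrier N
  j x = proj₁ (image x)

  Related : Carrier M → Carrier N → Set
  Related x y = Σ ℕ λ k → state k ∋ x ↦ y

  -- The requirements of an embedding mention at most three elements at a time, so one stage decides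
  -- each of them.
  common₃ : ∀ {x y x' y' x'' y''} → Related x y → Related x' y' → Related x'' y'' →
    Σ State λ s → s ∋ x ↦ y × s ∋ x' ↦ y' × s ∋ x'' ↦ y''
  common₃ (k₁ , p₁) (k₂ , p₂) (k₃ , p₃) = state (k₁ +ℕ (k₂ +ℕ k₃)) ,
    state-⊑ (ℕₚ.≤⇒≤′ (ℕₚ.m≤m+n k₁ (k₂ +ℕ k₃))) p₁ ,
    state-⊑ (ℕₚ.≤⇒≤′ (ℕₚ.≤-trans (ℕₚ.m≤m+n k₂ k₃) (ℕₚ.m≤n+m (k₂ +ℕ k₃) k₁))) p₂ ,
    state-⊑ (ℕₚ.≤⇒≤′ (ℕₚ.≤-trans (ℕₚ.m≤n+m k₃ k₂) (ℕₚ.m≤n+m (k₂ +ℕ k₃) k₁))) p₃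

  preserved : ∀ {n} {ρ : Vec (Carrier M) n} {σ} → Inv ρ σ → (φ : Δ₀F n) → (M ⊨ φ) ρ → (N ⊨ φ) σ
  preserved {n} {ρ} {σ} inv φ s =
    let z , _ , s' = inv twin-zero (φ [ ↑ 2 ]) (𝓜.0# , sub⇐ M φ {↑ 2} {𝓜.0# ∷ 𝓜.0# ∷ ρ} {ρ} (λ _ → refl) s)
    in sub⇒ N φ {↑ 2} {z ∷ 𝓝.0# ∷ σ} {σ} (λ _ → refl) s'

  -- Δ₀ formulas are closed under negation, so the one-directional invariant already gives
  -- equivalence.
  reflected : ∀ {n} {ρ : Vec (Carrier M) n} {σ} → Inv ρ σ → (φ : Δ₀F n) → (N ⊨ φ) σ → (M ⊨ φ) ρ
  reflected inv φ s = 𝓜.dne λ n → preserved inv (¬̇ φ) n s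

  module _ {x y x' y' x'' y''} (r : Related x y) (r' : Related x' y') (r'' : Related x'' y'') (φ : Δ₀F 3) where
    private
      τ : ∀ {n} → Fin n → Fin n → Fin n → Subst 3 n
      τ l l' l'' = var l ◂ var l' ◂ var l'' ◂ λ ()

      related-at : (Σ State λ s → s ∋ x ↦ y × s ∋ x' ↦ y' × s ∋ x'' ↦ y'') →
        ((M ⊨ φ) (x ∷ x' ∷ x'' ∷ []) → (N ⊨ φ) (y ∷ y' ∷ y'' ∷ [])) ×
        ((N ⊨ φ) (y ∷ y' ∷ y'' ∷ []) → (M ⊨ φ) (x ∷ x' ∷ x'' ∷ []))
      related-at ((n , ρ , σ , inv) , (l , refl , refl) , (l' , refl , refl) , (l'' , refl , refl)) =
        (λ s → sub⇒ N φ {τ l l' l''} {σ} {y ∷ y' ∷ y'' ∷ []} (λ { zero → refl ; (suc zero) → refl ; (suc (suc zero)) → refl })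
          (preserved inv (φ [ τ l l' l'' ]) (sub⇐ M φ {τ l l' l''} {ρ} {x ∷ x' ∷ x'' ∷ []} (λ { zero → refl ; (suc zero) → refl ; (suc (suc zero)) → refl }) s))) ,
        (λ s → sub⇒ M φ {τ l l' l''} {ρ} {x ∷ x' ∷ x'' ∷ []} (λ { zero → refl ; (suc zero) → refl ; (suc (suc zero)) → refl })
          (reflected inv (φ [ τ l l' l'' ]) (sub⇐ N φ {τ l l' l''} {σ} {y ∷ y' ∷ y'' ∷ []} (λ { zero → refl ; (suc zero) → refl ; (suc (suc zero)) → refl }) s)))

    related⇒ : (M ⊨ φ) (x ∷ x' ∷ x'' ∷ []) → (N ⊨ φ) (y ∷ y' ∷ y'' ∷ [])
    related⇒ = proj₁ (related-at (common₃ r r' r''))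

    related⇐ : (N ⊨ φ) (y ∷ y' ∷ y'' ∷ []) → (M ⊨ φ) (x ∷ x' ∷ x'' ∷ [])
    related⇐ = proj₂ (related-at (common₃ r r' r''))

  J : ∀ x → Related x (j x)
  J x = proj₂ (image x)

  functional : ∀ {x y y'} → Related x y → Related x y' → y ≡ y'
  functional r r' = related⇒ r r' r' (v0 ≐ v1) refl

  isEmbedding : IsEmbedding M N j
  isEmbedding = record
    { inj = λ x y e → related⇐ (J x) (J y) (J y) (v0 ≐ v1) e
    ; pres-0 = related⇒ (J 𝓜.0#) (J 𝓜.0#) (J 𝓜.0#) (v0 ≐ zer) refl
    ; pres-S = λ x → related⇒ (J (𝓜.S x)) (J x) (J x) (v0 ≐ sc v1) refl
    ; pres-+ = λ x y → related⇒ (J (x 𝓜.+ y)) (J x) (J y) (v0 ≐ v1 +ᵗ v2) refl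
    ; pres-* = λ x y → related⇒ (J (x 𝓜.* y)) (J x) (J y) (v0 ≐ v1 *ᵗ v2) refl
    ; pres-< = λ x y → related⇒ (J x) (J y) (J y) (v0 ⋖ v1)
    ; refl-< = λ x y → related⇐ (J x) (J y) (J y) (v0 ⋖ v1) }

  below : ∀ x → j x 𝓝.< b
  below x = at (proj₁ (proj₂ (image x))) (proj₂ (proj₂ (image x)))
    where
    at : ∀ k {y} → state k ∋ x ↦ y → y 𝓝.< b
    -- The only witness of "z equals the l-th entry" is that entry, so the bound on witnesses bounds
    -- the image.
    at k (l , refl , refl) = let z , z<b , e = proj₂ (proj₂ (proj₂ (state k))) twin-zero (v0 ≐ var (2 ↑ʳ l)) (_ , refl)
      in subst (𝓝._< b) e z<b

  fixes : ∀ {x y} → Twin x y → j x ≡ y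
  fixes {x} {y} t = at (proj₁ (proj₂ (image x))) (proj₂ (proj₂ (image x)))
    where
    at : ∀ k {y'} → state k ∋ x ↦ y' → y' ≡ y
    at k (l , refl , refl) = let z , _ , e = proj₂ (proj₂ (proj₂ (state k))) t (var (2 ↑ʳ l) ≐ v1) (𝓜.0# , refl) in e

  initial : IsInitial M N j
  initial x y y<jx = at (J x) (proj₂ countN y)
    where
    at : Related x (j x) → (Σ ℕ λ i → g i ≡ y) → Σ (Carrier M) λ z → j z ≡ y
    at (k , p) (i , refl) =
      -- At stage K the pair of x and its image is already present and g i is among the elements
      -- tried, so it is dominated and receives a preimage.
      let K = k +ℕ i
          z , q = backs-hit (addM (state K) (f K)) (ℕₚ.≤⇒≤′ (ℕₚ.m≤n+m i k))
                    (addM-⊑ (state K) (f K) (state-⊑ (ℕₚ.≤⇒≤′ (ℕₚ.m≤m+n k i)) p)) y<jx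
      in z , functional (J z) (suc K , q)

  cond1 : Cond1 M N C c a b
  cond1 = j , isEmbedding , initial , (b , λ x e → 𝓝.<-irrefl (subst (𝓝._< b) e (below x))) ,
    functional (J c) (0 , zero , refl , refl) , below , λ i → fixes (i , refl , refl)

-- Δ₀ absoluteness and the necessity of the second condition.

module Absoluteness (M N : Structure) (j : Carrier M → Carrier N) (isEmbedding : IsEmbedding M N j) (initial : IsInitial M N j) where
  open IsEmbedding isEmbedding

  ⟦⟧ᵗ-map : ∀ {n} (t : Term n) ρ → j (⟦_⟧ᵗ M t ρ) ≡ ⟦_⟧ᵗ N t (Vec.map j ρ)
  ⟦⟧ᵗ-map (var i) ρ = sym (lookup-map i j ρ)
  ⟦⟧ᵗ-map zer ρ = pres-0
  ⟦⟧ᵗ-map (sc t) ρ = trans (pres-S _) (cong (St.𝐒 N) (⟦⟧ᵗ-map t ρ))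
  ⟦⟧ᵗ-map (t +ᵗ u) ρ = trans (pres-+ _ _) (cong₂ (St._⊕_ N) (⟦⟧ᵗ-map t ρ) (⟦⟧ᵗ-map u ρ))
  ⟦⟧ᵗ-map (t *ᵗ u) ρ = trans (pres-* _ _) (cong₂ (St._⊗_ N) (⟦⟧ᵗ-map t ρ) (⟦⟧ᵗ-map u ρ))

  absolute : ∀ {n} {φ : Formula n} → IsΔ₀ φ → ∀ ρ →
    (Sat M φ ρ → Sat N φ (Vec.map j ρ)) × (Sat N φ (Vec.map j ρ) → Sat M φ ρ)
  absolute (eq t u) ρ = (λ e → trans (sym (⟦⟧ᵗ-map t ρ)) (trans (cong j e) (⟦⟧ᵗ-map u ρ))) ,
                        (λ e → inj _ _ (trans (⟦⟧ᵗ-map t ρ) (trans e (sym (⟦⟧ᵗ-map u ρ)))))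
  absolute (lt t u) ρ = (λ l → subst₂ (St._≺_ N) (⟦⟧ᵗ-map t ρ) (⟦⟧ᵗ-map u ρ) (pres-< _ _ l)) ,
                        (λ l → refl-< _ _ (subst₂ (St._≺_ N) (sym (⟦⟧ᵗ-map t ρ)) (sym (⟦⟧ᵗ-map u ρ)) l))
  absolute bot ρ = id , id
  absolute (and p q) ρ = map (proj₁ (absolute p ρ)) (proj₁ (absolute q ρ)) , map (proj₂ (absolute p ρ)) (proj₂ (absolute q ρ))
  absolute (or p q) ρ = Sum.map (proj₁ (absolute p ρ)) (proj₁ (absolute q ρ)) , Sum.map (proj₂ (absolute p ρ)) (proj₂ (absolute q ρ))
  absolute (imp p q) ρ = (λ h s → proj₁ (absolute q ρ) (h (proj₂ (absolute p ρ) s))) ,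
                         (λ h s → proj₂ (absolute q ρ) (h (proj₁ (absolute p ρ) s)))
  absolute (ball t {φ} p) ρ =
    (λ h y l → let l' = subst (St._≺_ N y) (sym (⟦⟧ᵗ-map t ρ)) l ; x , e = initial _ y l' in
       subst (λ y → Sat N φ (y ∷ Vec.map j ρ)) e (proj₁ (absolute p (x ∷ ρ)) (h x (refl-< _ _ (subst (λ y → St._≺_ N y _) (sym e) l'))))) ,
    (λ h x l → proj₂ (absolute p (x ∷ ρ)) (h (j x) (subst (St._≺_ N (j x)) (⟦⟧ᵗ-map t ρ) (pres-< _ _ l))))
  absolute (bex t {φ} p) ρ =
    (λ { (x , l , s) → j x , subst (St._≺_ N (j x)) (⟦⟧ᵗ-map t ρ) (pres-< _ _ l) , proj₁ (absolute p (x ∷ ρ)) s }) ,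
    (λ { (y , l , s) → let l' = subst (St._≺_ N y) (sym (⟦⟧ᵗ-map t ρ)) l ; x , e = initial _ y l' in
       x , refl-< _ _ (subst (λ y → St._≺_ N y _) (sym e) l') ,
       proj₂ (absolute p (x ∷ ρ)) (subst (λ y → Sat N φ (y ∷ Vec.map j ρ)) (sym e) s) })

module Necessity (em : ExcludedMiddle 0ℓ) (M N : Structure) (isM : IsModelIΣ₁ M) (isN : IsModelIΣ₁ N)
  (C : SharedCut M N) (closed : ClosedUnderExp C)
  (j : Carrier M → Carrier N) (isEmbedding : IsEmbedding M N j) (initial : IsInitial M N j)
  (fixes : (i : I C) → j (ιM C i) ≡ ιN C i) where
  open Shared em M N isM isN C closed
  open Absoluteness M N j isEmbedding initial
  open IsEmbedding isEmbedding

  up : ∀ {n} (φ : Δ₀F n) ρ → (M ⊨ φ) ρ → (N ⊨ φ) (Vec.map j ρ)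
  up φ ρ = proj₁ (absolute (bounded φ) ρ)

  ack-up : ∀ e {x y} → 𝓜.Ack e x y → 𝓝.Ack e (j x) (j y)
  ack-up e {x} {y} a = let w , s = 𝓜.ackF⇐ e {x} {y} a in
    𝓝.ackF⇒ e {j w} {j x} {j y} (up (ackF e v0 v1 v2) (w ∷ x ∷ y ∷ []) s)

  ack-down : ∀ {x y} → 𝓜.Dom x → AckE N (j x) (j y) → AckE M x y
  ack-down {x} {y} d a = 𝓜.Ack-𝟙 {x} {y} d λ z → 𝓝.Ack-exclusive {j x} {j y} a (ack-up 𝟘 {x} {y} z)

  exp-up : ∀ {x y} → Exp M x y → Exp N (j x) (j y)
  exp-up {x} {y} (a , b , c) = j a , j b , 𝓝.expCode⇒ {j a} {j b} {j x} {j y}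
    (up (expCodeF v0 v1 v2 v3) (a ∷ b ∷ x ∷ y ∷ []) (𝓜.expCode⇐ {a} {b} {x} {y} c))

  sameSSy : SameSSy C
  sameSSy = (λ c → j c , λ i → at i c (j c) (ack-up 𝟙 {ιM C i} {c}) (ack-down {ιM C i} {c} (dom-M _ (i , refl)))) ,
            (λ d → trace d (𝓜.IsCut.Dom-overspill cut-M dom-M))
    where
    at : ∀ i c d → (AckE M (ιM C i) c → AckE N (j (ιM C i)) d) → (AckE N (j (ιM C i)) d → AckE M (ιM C i) c) →
      (AckE M (ιM C i) c → AckE N (ιN C i) d) × (AckE N (ιN C i) d → AckE M (ιM C i) c)
    at i c d h k = (λ m → subst (λ x → AckE N x d) (fixes i) (h m)) , (λ m → k (subst (λ x → AckE N x d) (sym (fixes i)) m))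
    trace : ∀ d → (Σ (Carrier M) λ m → ¬ InM m × 𝓜.Dom m) → Σ (Carrier M) λ c → (i : I C) →
      (AckE M (ιM C i) c → AckE N (ιN C i) d) × (AckE N (ιN C i) d → AckE M (ιM C i) c)
    -- Here `em` is the proof that P is 2^m in M, not excluded middle.
    trace d (m , m∉ , P , em) = c , λ i → at i c d
        (λ h → 𝓝.Ack-mod 𝟙 {j (ιM C i)} {j m} {j P} {d} {q} {r} (exp-up em) (i<m i) ed (subst (AckE N (j (ιM C i))) jc≡r (ack-up 𝟙 {ιM C i} {c} h)))
        (λ h → ack-down {ιM C i} {c} (dom-M _ (i , refl)) (subst (AckE N (j (ιM C i))) (sym jc≡r)
          (𝓝.Ack-mod⁻ {j (ιM C i)} {j m} {j P} {d} {q} {r} (exp-up em) (i<m i) ed h)))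
      where
      dm = 𝓝.divMod d (j P) (𝓝.Exp-pos (exp-up em))
      q = proj₁ dm
      r = proj₁ (proj₂ dm)
      ed = proj₁ (proj₂ (proj₂ dm))
      pre = initial P r (proj₂ (proj₂ (proj₂ dm)))
      c = proj₁ pre
      jc≡r = proj₂ pre
      i<m : ∀ i → j (ιM C i) 𝓝.< j m
      i<m i = pres-< _ _ (𝓜.IsCut.∉⇒> cut-M (i , refl) m∉)

theorem3p3 : ExcludedMiddle 0ℓ →
    (M N : Structure) → IsModelIΣ₁ M → IsModelIΣ₁ N →
    Countable M → Countable N → Nonstandard M → Nonstandard N →
    (c : Carrier M) (a b : Carrier N) →
    (C : SharedCut M N) → ClosedUnderExp C →
    Cond1 M N C c a b ⇔ Cond2 M N C c a b
theorem3p3 em M N isM isN countM countN _ _ c a b C closed = mk⇔ necessity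
    (λ cond → BackAndForth.cond1 em M N isM isN countM countN c a b C closed cond)
  where
  necessity : Cond1 M N C c a b → Cond2 M N C c a b
  necessity (j , emb , initial , _ , refl , below , fixes) =
    Necessity.sameSSy em M N isM isN C closed j emb initial fixes ,
    λ i δ isΔ₀ → λ { (z , s) → j z , below z ,
      subst (λ y → Sat N δ (y ∷ j c ∷ j z ∷ [])) (fixes i)
        (proj₁ (Absoluteness.absolute M N j emb initial isΔ₀ (ιM C i ∷ c ∷ z ∷ [])) s) }
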